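{- Every connected locally finite graph $G$ without thick ends has a canonical tree-decomposition which efficiently distinguishes all its tangles.
   Context: Let $G$ be a graph. A separation of $G$ is an unordered pair $\{A,B\}$ of subsets of $V(G)$ with $A\cup B=V(G)$ such that no edge of $G$ has one endvertex in $A\setminus B$ and the other in $B\setminus A$; its order is $|A\cap B|$. Its orientations are the ordered pairs $(A,B)$ and $(B,A)$ (oriented separations), partially ordered by $(A,B)\le(C,D)$ iff $A\subseteq C$ and $B\supseteq D$. A set $O$ of oriented separations is consistent if there are no $(A,B),(C,D)\in O$ with $\{A,B\}\ne\{C,D\}$ and $(B,A)\le(C,D)$. A pre-tangle in $G$ is a set $P$ of oriented separations such that for some $k\in\mathbb N\cup\{\aleph_0\}$, $P$ is a consistent set containing exactly one orientation of each separation of $G$ of order less than $k$. A tangle is a pre-tangle $P$ such that for any three (not necessarily distinct) $(A_1,B_1),(A_2,B_2),(A_3,B_3)\in P$ we have $G[A_1]\cup G[A_2]\cup G[A_3]\ne G$. A separation distinguishes two tangles if both contain an orientation of it but not the same one; it does so efficiently if it has minimum order among all separations of $G$ distinguishing them; two tangles are distinguishable if some separation distinguishes them. For a tree-decomposition $(T,(V_t)_{t\in T})$ of $G$, each edge $t_1t_2$ of $T$ induces the separation $\{\bigcup_{t\in T_1}V_t,\bigcup_{t\in T_2}V_t\}$, where $T_1,T_2$ are the components of $T-t_1t_2$. The tree-decomposition efficiently distinguishes all tangles of $G$ if any two distinguishable tangles in $G$ are efficiently distinguished by a separation induced by some edge of $T$. It is canonical if it is invariant under the automorphisms of $G$, i.e.,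 for every automorphism $\varphi$ of $G$ there is an automorphism $\psi$ of $T$ with $\varphi(V_t)=V_{\psi(t)}$ for all $t$. A graph is locally finite if every vertex has finitely many neighbours. An end of $G$ (an equivalence class of rays, two rays being equivalent if no finite vertex set separates them) is thick if it contains infinitely many pairwise disjoint rays. -}

module Defs where

open import Level using (0ℓ) renaming (suc to lsuc)
open import Data.Nat using (ℕ; zero; suc; _≤_; _<_)
open import Data.List using (List; []; _∷_; length)
open import Data.List.Membership.Propositional using (_∈_)
open import Data.List.Relation.Unary.Unique.Propositional using (Unique)
open import Data.Product using (Σ; ∃; _×_; _,_)
open import Data.Sum using (_⊎_)
open import Data.Empty using (⊥)
open import Relation.Nullary using (¬_)
open import Relation.Binary.PropositionalEquality using (_≡_; _≢_)

record Graph : Set₁ where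
  field
    V      : Set
    E      : V → V → Set
    E-sym  : ∀ {u v} → E u v → E v u
    E-irr  : ∀ {v} → ¬ E v v

Subset : Set → Set₁
Subset X = X → Set

_⊆_ : {X : Set} → Subset X → Subset X → Set
A ⊆ B = ∀ x → A x → B x

_≐_ : {X : Set} → Subset X → Subset X → Set
A ≐ B = A ⊆ B × B ⊆ A

_⇔_ : Set → Set → Set
P ⇔ Q = (P → Q) × (Q → P)

FiniteSet : {X : Set} → Subset X → Set
FiniteSet {X} S = Σ (List X) λ l → ∀ x → S x → x ∈ l

HasCard : {X : Set} → Subset X → ℕ → Set
HasCard {X} S n = Σ (List X) λ l → length l ≡ n × Unique l × (∀ x → S x ⇔ (x ∈ l))

data Reach {X : Set} (R : X → X → Set) : X → X → Set where
  here : ∀ {x} → Reach R x x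
  step : ∀ {x y z} → R x y → Reach R y z → Reach R x z

data Walk {X : Set} (R : X → X → Set) : X → X → List X → Set where
  single : ∀ x → Walk R x x (x ∷ [])
  cons   : ∀ {x y z l} → R x y → Walk R y z l → Walk R x z (x ∷ l)


module _ (G : Graph) where
  open Graph G

  Connected : Set
  Connected = V × (∀ u v → Reach E u v)

  LocallyFinite : Set
  LocallyFinite = ∀ v → FiniteSet (E v)

  record Ray : Set where
    field
      r     : ℕ → V
      r-inj : ∀ m n → r m ≡ r n → m ≡ n
      r-adj : ∀ n → E (r n) (r (suc n))

  open Ray

  Avoid : Subset V → V → V → Set
  Avoid S u v = E u v × ¬ S u × ¬ S v

  RayEquiv : Ray → Ray → Set₁
  RayEquiv ρ σ = ∀ (S : Subset V) → FiniteSet S →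
    Σ ℕ λ i → Σ ℕ λ j →
      (∀ n → i ≤ n → ¬ S (r ρ n)) × (∀ n → j ≤ n → ¬ S (r σ n)) ×
      Reach (Avoid S) (r ρ i) (r σ j)

  ThickEndOf : Ray → Set₁
  ThickEndOf ρ = Σ (ℕ → Ray) λ R →
    (∀ i j → i ≢ j → ∀ m n → r (R i) m ≢ r (R j) n) ×
    (∀ i → RayEquiv ρ (R i))

  NoThickEnds : Set₁
  NoThickEnds = ∀ (ρ : Ray) → ¬ ThickEndOf ρ

  IsSep : Subset V → Subset V → Set
  IsSep A B = (∀ v → A v ⊎ B v) ×
              (∀ u v → E u v → A u → ¬ B u → B v → ¬ A v → ⊥)

  Order : Subset V → Subset V → ℕ → Set
  Order A B n = HasCard (λ v → A v × B v) n

  data Bound : Set where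
    fin : ℕ → Bound
    ℵ₀  : Bound

  OrderLt : Bound → Subset V → Subset V → Set
  OrderLt (fin m) A B = Σ ℕ λ n → Order A B n × n < m
  OrderLt ℵ₀      A B = Σ ℕ λ n → Order A B n

  _≼_ : Subset V × Subset V → Subset V × Subset V → Set
  (A , B) ≼ (C , D) = A ⊆ C × D ⊆ B

  OSepSet : Set₁
  OSepSet = Subset V → Subset V → Set

  _∈ᴾ_ : Subset V × Subset V → OSepSet → Set₁
  (A , B) ∈ᴾ P = Σ (Subset V) λ C → Σ (Subset V) λ D → P C D × C ≐ A × D ≐ B

  SepNeq : Subset V → Subset V → Subset V → Subset V → Set
  SepNeq A B C D = ¬ (A ≐ C × B ≐ D) × ¬ (A ≐ D × B ≐ C)

  Consistent : OSepSet → Set₁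
  Consistent P = ∀ A B C D → P A B → P C D → SepNeq A B C D → ¬ ((B , A) ≼ (C , D))

  IsPreTangleOf : Bound → OSepSet → Set₁
  IsPreTangleOf k P =
    (∀ A B → P A B → IsSep A B × OrderLt k A B) ×
    (∀ A B → IsSep A B → OrderLt k A B → ((A , B) ∈ᴾ P) ⊎ ((B , A) ∈ᴾ P)) ×
    (∀ A B → (A , B) ∈ᴾ P → (B , A) ∈ᴾ P → A ≐ B) ×
    Consistent P

  IsPreTangle : OSepSet → Set₁
  IsPreTangle P = Σ Bound λ k → IsPreTangleOf k P

  -- G[A₁] ∪ G[A₂] ∪ G[A₃] = G
  Cover3 : Subset V → Subset V → Subset V → Set
  Cover3 A₁ A₂ A₃ =
    (∀ v → A₁ v ⊎ A₂ v ⊎ A₃ v) ×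
    (∀ u v → E u v → (A₁ u × A₁ v) ⊎ (A₂ u × A₂ v) ⊎ (A₃ u × A₃ v))

  IsTangle : OSepSet → Set₁
  IsTangle P = IsPreTangle P ×
    (∀ A₁ B₁ A₂ B₂ A₃ B₃ → P A₁ B₁ → P A₂ B₂ → P A₃ B₃ → ¬ Cover3 A₁ A₂ A₃)

  Distinguishes : OSepSet → OSepSet → Subset V → Subset V → Set₁
  Distinguishes P₁ P₂ A B = IsSep A B × ¬ (A ≐ B) ×
    ((((A , B) ∈ᴾ P₁) × ((B , A) ∈ᴾ P₂)) ⊎ (((B , A) ∈ᴾ P₁) × ((A , B) ∈ᴾ P₂)))

  Distinguishable : OSepSet → OSepSet → Set₁
  Distinguishable P₁ P₂ = Σ (Subset V) λ A → Σ (Subset V) λ B → Distinguishes P₁ P₂ A B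

  EfficientlyDistinguishes : OSepSet → OSepSet → Subset V → Subset V → Set₁
  EfficientlyDistinguishes P₁ P₂ A B = Distinguishes P₁ P₂ A B ×
    (∀ C D → Distinguishes P₁ P₂ C D → ∀ m n → Order A B m → Order C D n → m ≤ n)

  record Automorphism : Set where
    field
      to      : V → V
      from    : V → V
      to-from : ∀ v → to (from v) ≡ v
      from-to : ∀ v → from (to v) ≡ v
      adj     : ∀ u v → E u v ⇔ E (to u) (to v)

IsTree : Graph → Set
IsTree T = V × (∀ s t → Reach E s t) ×
           (∀ s t l → Walk E s t l → Unique l → 3 ≤ length l → ¬ E t s)
  where open Graph T

module _ (G T : Graph) (bag : Graph.V T → Subset (Graph.V G)) where
  private
    module G = Graph G
    module T = Graph T

  IsTreeDecomposition : Set
  IsTreeDecomposition =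
    (∀ v → Σ T.V λ t → bag t v) ×
    (∀ u v → G.E u v → Σ T.V λ t → bag t u × bag t v) ×
    (∀ t₁ t₃ l → Walk T.E t₁ t₃ l → Unique l → ∀ t₂ → t₂ ∈ l →
       ∀ v → bag t₁ v → bag t₃ v → bag t₂ v)

  TMinus : T.V → T.V → T.V → T.V → Set
  TMinus t₁ t₂ x y = T.E x y × ¬ (x ≡ t₁ × y ≡ t₂) × ¬ (x ≡ t₂ × y ≡ t₁)

  InducedSide : T.V → T.V → Subset G.V
  InducedSide t₁ t₂ v = Σ T.V λ t → Reach (TMinus t₁ t₂) t₁ t × bag t v

  Canonical : Set
  Canonical = ∀ (φ : Automorphism G) → Σ (Automorphism T) λ ψ →
    ∀ t w → bag (Automorphism.to ψ t) w ⇔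
            (Σ G.V λ v → bag t v × Automorphism.to φ v ≡ w)

  EfficientlyDistinguishesAllTangles : Set₁
  EfficientlyDistinguishesAllTangles =
    ∀ P₁ P₂ → IsTangle G P₁ → IsTangle G P₂ → Distinguishable G P₁ P₂ →
      Σ T.V λ t₁ → Σ T.V λ t₂ → T.E t₁ t₂ ×
        EfficientlyDistinguishes G P₁ P₂ (InducedSide t₁ t₂) (InducedSide t₂ t₁)

{-# OPTIONS --safe #-}
module Submission where

-- Order the pairs of distinguishable tangles by the minimum order k of a separation distinguishing them.  For
-- increasing k, choose for each pair, among its efficient distinguishers nested with everything chosen for
-- smaller k, those crossed by the fewest efficient separations of order k.  These crossing numbers are
-- finite because G is connected and locally finite, and uncrossing at corners (submodularity, tangle axiom)
-- shows that a choice exists and that all chosen separations form a nested set N.  The choice is canonical.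
-- N is the edge set of a tree carrying a tree-decomposition of G if no strictly increasing sequence in N has a vertex
-- on all its large sides.  The limit of such a sequence either has a finite separator, which contradicts
-- efficiency, or an infinite well-linked one, and then G has a thick end.
open import Defs
open import Level using (Level; 0ℓ; Lift; lift; lower) renaming (suc to lsuc)
open import Data.Product using (Σ; _×_; _,_; proj₁; proj₂)
open import Axiom.ExcludedMiddle using (ExcludedMiddle)
open import Data.Nat using (ℕ; zero; suc; _+_; _∸_; _≤_; _<_; z≤n; s≤s)
open import Data.Nat.Properties
open import Data.Nat.Induction using (<-rec)
open import Data.List using (List; []; _∷_; _++_; length; map; filter; concatMap; applyUpTo)
open import Data.List.Properties using (length-++; length-map; length-filter; filter-notAll; length-applyUpTo; map-injective; ∷-injective)
open import Data.List.Membership.Propositional using (_∈_; _∉_; find; lose)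
open import Data.List.Membership.Propositional.Properties using (∈-++⁺ˡ; ∈-++⁺ʳ; ∈-++⁻; ∈-∃++; ∈-filter⁺; ∈-filter⁻; ∈-map⁺; ∈-concatMap⁺; ∈-applyUpTo⁻)
open import Data.List.Relation.Unary.Any using (Any; here; there)
open import Data.List.Relation.Unary.AllPairs using ([]; _∷_)
open import Data.List.Relation.Unary.Unique.Propositional using (Unique)
import Data.List.Relation.Unary.All as All
import Data.List.Relation.Unary.Any as Any
import Data.List.Relation.Unary.Any.Properties as Any
import Data.List.Relation.Unary.Unique.Propositional.Properties as Unique
open import Data.Sum using (_⊎_; inj₁; inj₂; [_,_]′)
open import Data.Empty using (⊥; ⊥-elim)
open import Data.Unit using (⊤; tt)
open import Data.Bool using (Bool; true; false; not) renaming (T to IsTrue)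
open import Relation.Nullary using (¬_; Dec; yes; no; does)
open import Relation.Binary.Definitions using (tri<; tri≈; tri>)
open import Relation.Binary.PropositionalEquality using (_≡_; _≢_; refl; sym; trans; cong; cong₂; subst; subst₂)
open import Function using (_∘_; id)

-- Finiteness of the crossing numbers rests on two facts. An efficient separation has on each side a
-- component to which every vertex of its separator is adjacent, so this separator is a minimal one
-- between any two vertices chosen in these components. If the separation crosses one with separator
-- X, such vertices exist in X or among the neighbours of X, and two given vertices have only
-- finitely many minimal separators of bounded size. All minimisers enter N, not one for each pair
-- of tangles, since a selection could destroy invariance under automorphisms. Separations are pairs
-- of predicates, a large type with extensional equality, whereas the nodes of the tree must form a
-- set compared by `_≡_`. Hence N is indexed by finite codes: a separator, representatives of
-- components and a Boolean for the orientation. Several codes can denote one separation, so N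
-- becomes a preorder with an involution, and a node is a class of codes represented by its least
-- member in an enumeration.

Unique-∷ : ∀ {a} {X : Set a} {x : X} {xs} → x ∉ xs → Unique xs → Unique (x ∷ xs)
Unique-∷ x∉ u = All.tabulate (λ y∈ eq → x∉ (subst (_∈ _) (sym eq) y∈)) ∷ u

Unique-head : ∀ {a} {X : Set a} {x : X} {xs} → Unique (x ∷ xs) → x ∉ xs
Unique-head (h ∷ _) x∈ = All.lookup h x∈ refl

length-≤-of-⊆ : ∀ {a} {X : Set a} {l l′ : List X} → Unique l → (∀ {x} → x ∈ l → x ∈ l′) → length l ≤ length l′
length-≤-of-⊆ {l = []} _ _ = z≤n
length-≤-of-⊆ {l = x ∷ xs} u@(_ ∷ uxs) sub with ∈-∃++ (sub (here refl))
... | as , bs , refl = begin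
  suc (length xs)             ≤⟨ s≤s (length-≤-of-⊆ uxs rest) ⟩
  suc (length (as ++ bs))     ≡⟨ cong suc (length-++ as) ⟩
  suc (length as + length bs) ≡⟨ +-suc (length as) (length bs) ⟨
  length as + length (x ∷ bs) ≡⟨ length-++ as ⟨
  length (as ++ x ∷ bs)       ∎
  where
  open ≤-Reasoning
  rest : ∀ {y} → y ∈ xs → y ∈ as ++ bs
  rest y∈ with ∈-++⁻ as (sub (there y∈))
  ... | inj₁ p = ∈-++⁺ˡ p
  ... | inj₂ (here refl) = ⊥-elim (Unique-head u y∈)
  ... | inj₂ (there p) = ∈-++⁺ʳ as p

rearrange : ∀ p q r s → (p + q) + (r + s) ≡ (p + r) + (q + s)
rearrange p q r s = trans (+-assoc p q (r + s)) (trans (cong (p +_) (trans (sym (+-assoc q r s))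
  (trans (cong (_+ s) (+-comm q r)) (+-assoc r q s)))) (sym (+-assoc p r (q + s))))

Covers : ∀ {a q s} {X : Set a} (_~_ : X → X → Set) (Q : X → Set q) (S : X → Set s) → List X → Set _
Covers _~_ Q S l = ∀ x → Q x → S x → Any (x ~_) l

CardLe : {X : Set} → Subset X → ℕ → Set
CardLe {X} S n = Σ (List X) λ l → length l ≤ n × (∀ x → S x → x ∈ l)

CardLe-mono : {X : Set} {S T : Subset X} {m n : ℕ} → S ⊆ T → m ≤ n → CardLe T m → CardLe S n
CardLe-mono S⊆T m≤n (l , len , c) = l , ≤-trans len m≤n , λ x s → c x (S⊆T x s)

HasCard⇒CardLe : {X : Set} {S : Subset X} {n : ℕ} → HasCard S n → CardLe S n
HasCard⇒CardLe (l , len , _ , iff) = l , ≤-reflexive len , λ x → proj₁ (iff x)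

HasCard-≤ : {X : Set} {S T : Subset X} {m n : ℕ} → HasCard S m → S ⊆ T → CardLe T n → m ≤ n
HasCard-≤ (l , refl , u , iff) S⊆T (l′ , len , c) =
  ≤-trans (length-≤-of-⊆ u (λ {x} x∈ → c x (S⊆T x (proj₂ (iff x) x∈)))) len

HasCard-cong : {X : Set} {S T : Subset X} {n : ℕ} → S ≐ T → HasCard S n → HasCard T n
HasCard-cong (f , g) (l , len , u , iff) =
  l , len , u , λ x → (λ t → proj₁ (iff x) (g x t)) , (λ x∈ → f x (proj₂ (iff x) x∈))

-- Classical counting with lists

module Classical (em : ExcludedMiddle (lsuc 0ℓ)) where

  em₀ : {P : Set} → Dec P
  em₀ {P} with em {Lift (lsuc 0ℓ) P}
  ... | yes (lift p) = yes p
  ... | no ¬p = no (λ p → ¬p (lift p))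

  byContradiction : {P : Set} → ¬ ¬ P → P
  byContradiction {P} ¬¬p with em₀ {P}
  ... | yes p = p
  ... | no ¬p = ⊥-elim (¬¬p ¬p)

  -- Excluded middle makes every proposition small and proof irrelevant.
  ⌈_⌉ : Set₁ → Set
  ⌈ P ⌉ = IsTrue (does (em {P}))

  ⌈⌉-intro : {P : Set₁} → P → ⌈ P ⌉
  ⌈⌉-intro {P} p with em {P}
  ... | yes _ = tt
  ... | no ¬p = ⊥-elim (¬p p)

  ⌈⌉-elim : {P : Set₁} → ⌈ P ⌉ → P
  ⌈⌉-elim {P} t with em {P}
  ... | yes p = p

  ⌈⌉-irrelevant : {P : Set₁} (p q : ⌈ P ⌉) → p ≡ q
  ⌈⌉-irrelevant {P} p q with em {P}
  ... | yes _ = refl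

  least : (P : ℕ → Set₁) → Σ ℕ P → Σ ℕ λ n → P n × (∀ m → P m → n ≤ m)
  least P (n , p) = <-rec (λ n → P n → Σ ℕ λ n → P n × (∀ m → P m → n ≤ m)) go n p
    where
    go : ∀ n → (∀ {m} → m < n → P m → Σ ℕ λ n → P n × (∀ m → P m → n ≤ m)) →
         P n → Σ ℕ λ n → P n × (∀ m → P m → n ≤ m)
    go n rec p with em {Σ ℕ λ m → m < n × P m}
    ... | yes (m , m<n , pm) = rec m<n pm
    ... | no none = n , p , λ m pm → ≮⇒≥ (λ m<n → none (m , m<n , pm))

  keep : ∀ {a} {X : Set a} → (X → Set) → List X → List X
  keep P = filter (λ x → em₀ {P x})

  keep⁺ : ∀ {a} {X : Set a} {P : X → Set} {x l} → x ∈ l → P x → x ∈ keep P l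
  keep⁺ = ∈-filter⁺ _

  keep⁻ : ∀ {a} {X : Set a} {P : X → Set} {x} l → x ∈ keep P l → x ∈ l × P x
  keep⁻ _ = ∈-filter⁻ _

  keep-Unique : ∀ {a} {X : Set a} {P : X → Set} {l} → Unique l → Unique (keep P l)
  keep-Unique = Unique.filter⁺ _

  keep-length : ∀ {a} {X : Set a} (P : X → Set) l → length (keep P l) ≤ length l
  keep-length P = length-filter _

  keep-length-< : ∀ {a} {X : Set a} {P : X → Set} {x} l → x ∈ l → ¬ P x → length (keep P l) < length l
  keep-length-< l x∈ ¬px = filter-notAll _ l (lose x∈ ¬px)

  keep-partition : ∀ {a} {X : Set a} (P : X → Set) l →
    length (keep P l) + length (keep (λ x → ¬ P x) l) ≡ length l
  keep-partition P [] = refl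
  keep-partition P (x ∷ l) with em₀ {P x} | em₀ {¬ P x}
  ... | yes p | yes ¬p = ⊥-elim (¬p p)
  ... | yes p | no _   = cong suc (keep-partition P l)
  ... | no _  | yes _  = trans (+-suc _ _) (cong suc (keep-partition P l))
  ... | no ¬p | no ¬¬p = ⊥-elim (¬¬p ¬p)

  keep-disjoint : ∀ {a} {X : Set a} {P Q : X → Set} → (∀ x → P x → ¬ Q x) → ∀ l →
    length (keep P l) + length (keep Q l) ≤ length l
  keep-disjoint dis [] = z≤n
  keep-disjoint {P = P} {Q} dis (x ∷ l) with em₀ {P x} | em₀ {Q x}
  ... | yes p | yes q = ⊥-elim (dis x p q)
  ... | yes _ | no _  = s≤s (keep-disjoint dis l)
  ... | no _  | yes _ = ≤-trans (≤-reflexive (+-suc _ _)) (s≤s (keep-disjoint dis l))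
  ... | no _  | no _  = m≤n⇒m≤1+n (keep-disjoint dis l)

  keep-disjoint-< : ∀ {a} {X : Set a} {P Q : X → Set} → (∀ x → P x → ¬ Q x) → ∀ l →
    Any (λ x → ¬ P x × ¬ Q x) l → length (keep P l) + length (keep Q l) < length l
  keep-disjoint-< {P = P} {Q} dis (x ∷ l) (here (¬p , ¬q)) with em₀ {P x} | em₀ {Q x}
  ... | yes p | _     = ⊥-elim (¬p p)
  ... | no _  | yes q = ⊥-elim (¬q q)
  ... | no _  | no _  = s≤s (keep-disjoint dis l)
  keep-disjoint-< {P = P} {Q} dis (x ∷ l) (there any) with em₀ {P x} | em₀ {Q x}
  ... | yes p | yes q = ⊥-elim (dis x p q)
  ... | yes _ | no _  = s≤s (keep-disjoint-< dis l any)
  ... | no _  | yes _ = ≤-trans (≤-reflexive (cong suc (+-suc _ _))) (s≤s (keep-disjoint-< dis l any))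
  ... | no _  | no _  = m≤n⇒m≤1+n (keep-disjoint-< dis l any)

  dedupe : ∀ {X : Set} (l : List X) → Σ (List X) λ l′ → Unique l′ × (∀ {x} → x ∈ l′ → x ∈ l) × (∀ {x} → x ∈ l → x ∈ l′)
  dedupe [] = [] , [] , id , id
  dedupe (x ∷ l) with dedupe l | em₀ {x ∈ l}
  ... | l′ , u , f , g | yes x∈ = l′ , u , there ∘ f , λ { (here refl) → g x∈ ; (there p) → g p }
  ... | l′ , u , f , g | no x∉ =
    x ∷ l′ , Unique-∷ (x∉ ∘ f) u ,
    (λ { (here refl) → here refl ; (there p) → there (f p) }) ,
    (λ { (here refl) → here refl ; (there p) → there (g p) })

  CardLe⇒HasCard : {X : Set} {S : Subset X} {n : ℕ} → CardLe S n → Σ ℕ λ m → HasCard S m × m ≤ n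
  CardLe⇒HasCard {S = S} (l , len , c) with dedupe (keep S l)
  ... | l′ , u , f , g =
    length l′ , (l′ , refl , u , λ x → (λ s → g (keep⁺ (c x s) s)) , (λ x∈ → proj₂ (keep⁻ l (f x∈)))) ,
    ≤-trans (length-≤-of-⊆ u f) (≤-trans (keep-length S l) len)

  infinite⇒many : {X : Set} (S : Subset X) → ¬ FiniteSet S → ∀ n →
    Σ (List X) λ l → length l ≡ n × Unique l × (∀ {x} → x ∈ l → S x)
  infinite⇒many S inf zero = [] , refl , [] , λ ()
  infinite⇒many {X} S inf (suc n) with infinite⇒many S inf n
  ... | l , len , u , sub with em₀ {Σ X λ x → S x × x ∉ l}
  ... | yes (x , sx , x∉) = x ∷ l , cong suc len , Unique-∷ x∉ u , λ { (here refl) → sx ; (there p) → sub p }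
  ... | no none = ⊥-elim (inf (l , λ x sx → byContradiction (λ x∉ → none (x , sx , x∉))))

  -- Submodularity in terms of covering lists, for separators as well as for sets of crossing separations.
  module Uncross {a q : Level} {X : Set a} (_~_ : X → X → Set) (Q : X → Set q) (S T C C′ : X → Set)
    (C-resp : ∀ {x y} → x ~ y → C x → C y) (C′-resp : ∀ {x y} → x ~ y → C′ x → C′ y)
    (S-resp : ∀ {x y} → x ~ y → S y → S x) (T-resp : ∀ {x y} → x ~ y → T y → T x)
    (C⊆ : ∀ x → Q x → C x → S x ⊎ T x) (C′⊆ : ∀ x → Q x → C′ x → S x ⊎ T x)
    (∩⊆S : ∀ x → C x → C′ x → S x) (∩⊆T : ∀ x → C x → C′ x → T x)
    (lS lT : List X) (covS : Covers _~_ Q S lS) (covT : Covers _~_ Q T lT) where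

    private
      C∖S C′∖T : X → Set
      C∖S x = C x × ¬ S x
      C′∖T x = C′ x × ¬ T x

    -- No entry is used twice: one of `lS` in both `C` and `C′∖T` would lie in `C ∩ C′`, hence in
    -- `T`, and dually for `lT`. An element of `S ∩ T` may serve both lists, having an entry in each
    -- of `lS` and `lT`.
    lC lC′ : List X
    lC = keep C lS ++ keep C∖S lT
    lC′ = keep C′∖T lS ++ keep C′ lT

    private
      pick : ∀ {P : X → Set} {x} l → Any (x ~_) l → (∀ {y} → x ~ y → P y) → Any (x ~_) (keep P l)
      pick l any p with find any
      ... | y , y∈ , x~y = lose (keep⁺ y∈ (p x~y)) x~y

    covC : Covers _~_ Q C lC
    covC x qx cx with em₀ {S x}
    ... | yes sx = Any.++⁺ˡ (pick lS (covS x qx sx) (λ x~y → C-resp x~y cx))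
    ... | no ¬sx with C⊆ x qx cx
    ... | inj₁ sx = ⊥-elim (¬sx sx)
    ... | inj₂ tx = Any.++⁺ʳ (keep C lS) (pick lT (covT x qx tx) (λ x~y → C-resp x~y cx , ¬sx ∘ S-resp x~y))

    covC′ : Covers _~_ Q C′ lC′
    covC′ x qx cx with em₀ {T x}
    ... | yes tx = Any.++⁺ʳ (keep C′∖T lS) (pick lT (covT x qx tx) (λ x~y → C′-resp x~y cx))
    ... | no ¬tx with C′⊆ x qx cx
    ... | inj₂ tx = ⊥-elim (¬tx tx)
    ... | inj₁ sx = Any.++⁺ˡ (pick lS (covS x qx sx) (λ x~y → C′-resp x~y cx , ¬tx ∘ T-resp x~y))

    private
      lengths : length lC + length lC′ ≡
        (length (keep C lS) + length (keep C′∖T lS)) + (length (keep C∖S lT) + length (keep C′ lT))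
      lengths = trans (cong₂ _+_ (length-++ (keep C lS)) (length-++ (keep C′∖T lS)))
        (rearrange (length (keep C lS)) (length (keep C∖S lT)) (length (keep C′∖T lS)) (length (keep C′ lT)))

      disS : ∀ x → C x → ¬ C′∖T x
      disS x c (c′ , ¬t) = ¬t (∩⊆T x c c′)

      disT : ∀ x → C∖S x → ¬ C′ x
      disT x (c , ¬s) c′ = ¬s (∩⊆S x c c′)

    total-≤ : length lC + length lC′ ≤ length lS + length lT
    total-≤ = ≤-trans (≤-reflexive lengths) (+-mono-≤ (keep-disjoint disS lS) (keep-disjoint disT lT))

    total-< : Any (λ x → ¬ C x × ¬ C′ x) lS → length lC + length lC′ < length lS + length lT
    total-< any = ≤-trans (s≤s (≤-reflexive lengths))
      (+-mono-<-≤ (keep-disjoint-< disS lS (Any.map (λ { (¬c , ¬c′) → ¬c , ¬c′ ∘ proj₁ }) any)) (keep-disjoint disT lT))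

-- Hall's marriage theorem

module Hall (em : ExcludedMiddle (lsuc 0ℓ)) {X : Set} where
  open Classical em

  HallCondition : (X → List X) → List X → Set
  HallCondition nb L = ∀ S c → Unique S → (∀ {x} → x ∈ S → x ∈ L) →
    (∀ {x y} → x ∈ S → y ∈ nb x → y ∈ c) → length S ≤ length c

  Matching : (X → List X) → List X → Set
  Matching nb L = Σ (X → X) λ f →
    (∀ {x} → x ∈ L → f x ∈ nb x) × (∀ {x y} → x ∈ L → y ∈ L → f x ≡ f y → x ≡ y)

  private
    remove : X → (X → List X) → X → List X
    remove y nb x = keep (_≢ y) (nb x)

    Tight : (X → List X) → List X → (X → Set) → Set
    Tight nb L Y = Σ (List X) λ S → Σ (List X) λ c → Unique S × (∀ {x} → x ∈ S → x ∈ L) ×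
      (∀ {x y} → x ∈ S → y ∈ nb x → y ∈ c) × length c ≤ length S × (∀ {y} → Y y → y ∈ c)

    -- Hall's condition for `S ∩ S′`, whose neighbours lie in `c ∩ c′`, gives |c′ ∖ c| ≤ |S′ ∖ S|.
    -- This is submodularity of neighbourhoods.
    tight-∪ : ∀ {nb L Y Z} → HallCondition nb L → Tight nb L Y → Tight nb L Z → Tight nb L (λ y → Y y ⊎ Z y)
    tight-∪ hc (S , c , uS , S⊆ , nbS , lenS , Y⊆) (S′ , c′ , uS′ , S′⊆ , nbS′ , lenS′ , Z⊆) =
      S ++ S′∖S , c ++ c′∖c ,
      Unique.++⁺ uS (keep-Unique uS′) (λ { (p , q) → proj₂ (keep⁻ S′ q) p }) ,
      [ S⊆ , (λ q → S′⊆ (proj₁ (keep⁻ S′ q))) ]′ ∘ ∈-++⁻ S ,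
      (λ x∈ y∈ → [ (λ p → ∈-++⁺ˡ (nbS p y∈)) , (λ q → in-∪ (nbS′ (proj₁ (keep⁻ S′ q)) y∈)) ]′ (∈-++⁻ S x∈)) ,
      ≤-trans (≤-reflexive (length-++ c)) (≤-trans (+-mono-≤ lenS diff) (≤-reflexive (sym (length-++ S)))) ,
      [ (λ y → ∈-++⁺ˡ (Y⊆ y)) , (λ z → in-∪ (Z⊆ z)) ]′
      where
      S′∖S = keep (λ x → ¬ x ∈ S) S′
      c′∖c = keep (λ x → ¬ x ∈ c) c′
      S∩ = keep (_∈ S) S′
      c∩ = keep (_∈ c) c′
      in-∪ : ∀ {y} → y ∈ c′ → y ∈ c ++ c′∖c
      in-∪ {y} y∈ with em₀ {y ∈ c}
      ... | yes p = ∈-++⁺ˡ p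
      ... | no p = ∈-++⁺ʳ c (keep⁺ y∈ p)
      meet : length S∩ ≤ length c∩
      meet = hc S∩ c∩ (keep-Unique uS′) (λ q → S′⊆ (proj₁ (keep⁻ S′ q)))
        (λ x∈ y∈ → keep⁺ (nbS′ (proj₁ (keep⁻ S′ x∈)) y∈) (nbS (proj₂ (keep⁻ S′ x∈)) y∈))
      diff : length c′∖c ≤ length S′∖S
      diff = +-cancelˡ-≤ (length c∩) _ _ (begin
        length c∩ + length c′∖c ≡⟨ keep-partition (_∈ c) c′ ⟩
        length c′               ≤⟨ lenS′ ⟩
        length S′               ≡⟨ keep-partition (_∈ S) S′ ⟨
        length S∩ + length S′∖S ≤⟨ +-monoˡ-≤ _ meet ⟩
        length c∩ + length S′∖S ∎)
        where open ≤-Reasoning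

  -- If no choice of a partner y for the first vertex x leaves Hall's condition intact, then
  -- every y ∈ nb x lies in the neighbourhood of a tight set; the union of these tight sets is
  -- tight, and adding x to it violates Hall's condition.
  hall : ∀ L nb → Unique L → HallCondition nb L → Matching nb L
  hall [] nb _ _ = id , (λ ()) , λ ()
  hall (x ∷ L) nb u@(_ ∷ uL) hc with em₀ {Σ X λ y → y ∈ nb x × HallCondition (remove y nb) L}
  ... | yes (y , y∈ , hc′) with hall L (remove y nb) uL hc′
  ... | f , f∈ , f-inj = g , g∈ , g-inj
    where
    g : X → X
    g z with em₀ {z ≡ x}
    ... | yes _ = y
    ... | no _  = f z
    f∈nb : ∀ {z} → z ∈ L → f z ∈ nb z × f z ≢ y
    f∈nb {z} z∈ = keep⁻ (nb z) (f∈ z∈)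
    g∈ : ∀ {z} → z ∈ x ∷ L → g z ∈ nb z
    g∈ {z} z∈ with em₀ {z ≡ x} | z∈
    ... | yes refl | _ = y∈
    ... | no z≢x | here z≡x = ⊥-elim (z≢x z≡x)
    ... | no _ | there p = proj₁ (f∈nb p)
    g-inj : ∀ {z w} → z ∈ x ∷ L → w ∈ x ∷ L → g z ≡ g w → z ≡ w
    g-inj {z} {w} z∈ w∈ eq with em₀ {z ≡ x} | em₀ {w ≡ x} | z∈ | w∈
    ... | yes refl | yes refl | _ | _ = refl
    ... | yes _ | no w≢ | _ | here w≡ = ⊥-elim (w≢ w≡)
    ... | yes _ | no w≢ | _ | there q = ⊥-elim (proj₂ (f∈nb q) (sym eq))
    ... | no z≢ | _ | here z≡ | _ = ⊥-elim (z≢ z≡)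
    ... | no z≢ | yes _ | there p | _ = ⊥-elim (proj₂ (f∈nb p) eq)
    ... | no z≢ | no w≢ | there p | here w≡ = ⊥-elim (w≢ w≡)
    ... | no z≢ | no w≢ | there p | there q = f-inj p q eq
  hall (x ∷ L) nb u@(_ ∷ uL) hc | no none =
    ⊥-elim (<⇒≱ (s≤s (proj₁ (proj₂ (proj₂ (proj₂ (proj₂ (proj₂ all)))))))
      (hc (x ∷ S) c (Unique-∷ (λ x∈ → Unique-head u (S⊆ x∈)) (proj₁ (proj₂ (proj₂ all))))
        (λ { (here refl) → here refl ; (there p) → there (S⊆ p) })
        (λ { (here refl) y∈ → proj₂ (proj₂ (proj₂ (proj₂ (proj₂ (proj₂ all))))) y∈
           ; (there p) y∈ → proj₁ (proj₂ (proj₂ (proj₂ (proj₂ all)))) p y∈ })))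
    where
    hcL : HallCondition nb L
    hcL S c uS S⊆ = hc S c uS (there ∘ S⊆)
    -- Deleting y spoils Hall's condition at some S covered by c with |c| < |S|; restoring y to c
    -- makes the pair tight.
    single-tight : ∀ {y} → y ∈ nb x → Tight nb L (_≡ y)
    single-tight {y} y∈ = byContradiction λ ¬t → none (y , y∈ , λ S c uS S⊆ nbS → ≮⇒≥ λ c<S →
      ¬t (S , y ∷ c , uS , (λ {z} → S⊆ {z}) ,
        (λ {z} {w} z∈ w∈ → cover S c nbS z∈ w∈) , c<S , λ { refl → here refl }))
      where
      cover : ∀ S c → (∀ {x y′} → x ∈ S → y′ ∈ remove y nb x → y′ ∈ c) → ∀ {z w} → z ∈ S → w ∈ nb z → w ∈ y ∷ c
      cover S c nbS {z} {w} z∈ w∈ with em₀ {w ≡ y}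
      ... | yes refl = here refl
      ... | no w≢ = there (nbS z∈ (keep⁺ w∈ w≢))
    all-tight : ∀ ys → (∀ {y} → y ∈ ys → y ∈ nb x) → Tight nb L (_∈ ys)
    all-tight [] _ = [] , [] , [] , (λ ()) , (λ ()) , z≤n , λ ()
    all-tight (y ∷ ys) ys⊆ with tight-∪ hcL (single-tight (ys⊆ (here refl))) (all-tight ys (ys⊆ ∘ there))
    ... | S , c , uS , S⊆ , nbS , len , Y⊆ =
      S , c , uS , (λ {z} → S⊆ {z}) , (λ {z} {w} → nbS {z} {w}) , len , λ { (here p) → Y⊆ (inj₁ p) ; (there p) → Y⊆ (inj₂ p) }
    all = all-tight (nb x) id
    S = proj₁ all
    c = proj₁ (proj₂ all)
    S⊆ : ∀ {z} → z ∈ S → z ∈ L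
    S⊆ = proj₁ (proj₂ (proj₂ (proj₂ all)))

-- Reachability and separations

Reach-trans : {X : Set} {R : X → X → Set} {x y z : X} → Reach R x y → Reach R y z → Reach R x z
Reach-trans here q = q
Reach-trans (step e p) q = step e (Reach-trans p q)

Reach-sym : {X : Set} {R : X → X → Set} → (∀ {x y} → R x y → R y x) → ∀ {x y} → Reach R x y → Reach R y x
Reach-sym s here = here
Reach-sym s (step e p) = Reach-trans (Reach-sym s p) (step (s e) here)

Reach-closed : {X : Set} {R : X → X → Set} {P : X → Set} → (∀ {x y} → R x y → P x → P y) →
  ∀ {x y} → Reach R x y → P x → P y
Reach-closed c here px = px
Reach-closed c (step e p) px = Reach-closed c p (c e px)

injective-escapes : {X : Set} (g : ℕ → X) → (∀ m n → g m ≡ g n → m ≡ n) → ∀ l → ¬ (∀ n → g n ∈ l)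
injective-escapes g inj l all = <⇒≱ (n<1+n (length l)) (subst (_≤ length l) (length-applyUpTo g _)
  (length-≤-of-⊆ (Unique.applyUpTo⁺₁ g (suc (length l)) (λ i<j _ eq → <⇒≢ i<j (inj _ _ eq)))
    (λ x∈ → let (i , _ , eq) = ∈-applyUpTo⁻ g x∈ in subst (_∈ l) (sym eq) (all i))))

module Separation (em : ExcludedMiddle (lsuc 0ℓ)) (G : Graph) where
  open Classical em
  open Graph G

  -- The edge condition is used throughout in this positive form, with `sep-edge` as the converse.
  mkSep : ∀ {A B} → (∀ v → A v ⊎ B v) → (∀ {u v} → E u v → ¬ A v → B u) → IsSep G A B
  mkSep cover edge = cover , λ u v e _ ¬Bu _ ¬Av → ¬Bu (edge e ¬Av)

  sep-edge : ∀ {A B} → IsSep G A B → ∀ {u v} → E u v → ¬ A v → B u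
  sep-edge {A} {B} (cover , cross) {u} {v} e ¬Av with cover u | cover v
  ... | inj₂ Bu | _ = Bu
  ... | inj₁ _ | inj₁ Av = ⊥-elim (¬Av Av)
  ... | inj₁ Au | inj₂ Bv = byContradiction λ ¬Bu → cross u v e Au ¬Bu Bv ¬Av

  sep-edge′ : ∀ {A B} → IsSep G A B → ∀ {u v} → E u v → ¬ B v → A u
  sep-edge′ {A} {B} s@(cover , _) {u} {v} e ¬Bv with em₀ {A u}
  ... | yes Au = Au
  ... | no ¬Au = ⊥-elim (¬Bv (sep-edge s (E-sym e) ¬Au))

  IsSep-flip : ∀ {A B} → IsSep G A B → IsSep G B A
  IsSep-flip s = mkSep (λ v → [ inj₂ , inj₁ ]′ (proj₁ s v)) (sep-edge′ s)

module Neighbourhood (G : Graph) (lf : LocallyFinite G) where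
  open Graph G

  opaque
    nbrs : List V → List V
    nbrs = concatMap (λ v → proj₁ (lf v))

    nbrs⁺ : ∀ {u v l} → u ∈ l → E u v → v ∈ nbrs l
    nbrs⁺ u∈ e = ∈-concatMap⁺ _ (Any.map (λ { refl → proj₂ (lf _) _ e }) u∈)

-- A thick end from an infinite well-linked set

-- Minimal separators Tₙ between an exhausting sequence of
-- vertex sets and almost all of X grow in size, and by Hall's theorem Tₙ is linked to Tₙ₊₁ by
-- disjoint paths.  Here a linkage is an injection f from F ∖ Tₙ₊₁ to F ∖ Tₙ, for a finite F, that
-- moves every vertex along an edge or fixes it; the rays are orbits of these injections.
module ThickEnd (em : ExcludedMiddle (lsuc 0ℓ)) (G : Graph) (conn : Connected G) (lf : LocallyFinite G)
  (X : Subset (Graph.V G)) (X-infinite : ¬ FiniteSet X)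
  (well-linked : ∀ K L → IsSep G K L → ∀ m → CardLe (λ v → K v × L v) m → ∀ Z Z′ → Unique Z → Unique Z′ →
    (∀ z → z ∈ Z → X z × K z) → (∀ z → z ∈ Z′ → X z × L z) → m < length Z → m < length Z′ → ⊥) where
  open Classical em
  open Graph G
  open Separation em G
  open Neighbourhood G lf
  open Hall em

  root : V
  root = proj₁ conn

  -- By `large-side` and `not-both-large`, exactly one side of each separation of finite order is
  -- small in this sense, so X points towards one end of G; this end turns out to be thick.
  SmallX : Subset V → Set
  SmallX K = FiniteSet (λ v → X v × K v)

  SmallX-∪ : ∀ {A B} → SmallX A → SmallX B → SmallX (λ v → A v ⊎ B v)
  SmallX-∪ (l , c) (l′ , c′) = l ++ l′ , λ
    { v (x , inj₁ a) → ∈-++⁺ˡ (c v (x , a)) ; v (x , inj₂ b) → ∈-++⁺ʳ l (c′ v (x , b)) }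

  SmallX-⊆ : ∀ {A B} → A ⊆ B → SmallX B → SmallX A
  SmallX-⊆ A⊆B (l , c) = l , λ { v (x , a) → c v (x , A⊆B v a) }

  SmallX-list : ∀ l → SmallX (_∈ l)
  SmallX-list l = l , λ v → proj₂

  large-side : ∀ {K L} → IsSep G K L → SmallX K → ¬ SmallX L
  large-side s k l = X-infinite (proj₁ both , λ v x → proj₂ both v (x , proj₁ s v))
    where both = SmallX-∪ k l

  not-both-large : ∀ {K L m} → IsSep G K L → CardLe (λ v → K v × L v) m → ¬ SmallX K → ¬ SmallX L → ⊥
  not-both-large {K} {L} {m} s card ¬k ¬l
    with infinite⇒many (λ v → X v × K v) ¬k (suc m) | infinite⇒many (λ v → X v × L v) ¬l (suc m)
  ... | Z , lenZ , uZ , Z⊆ | Z′ , lenZ′ , uZ′ , Z′⊆ =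
    well-linked K L s m card Z Z′ uZ uZ′ (λ z → Z⊆) (λ z → Z′⊆) (≤-reflexive (sym lenZ)) (≤-reflexive (sym lenZ′))

  -- `minimal` says that fewer than |T| vertices never separate K from the infinite part of X, as in
  -- a Menger-type theorem. K itself may be infinite; only its trace on X is finite.
  record Cut : Set₁ where
    field
      K L     : Subset V
      isSep   : IsSep G K L
      small   : SmallX K
      T       : List V
      uT      : Unique T
      T⇔      : ∀ v → (K v × L v) ⇔ (v ∈ T)
      minimal : ∀ K′ L′ → IsSep G K′ L′ → K ⊆ K′ → SmallX K′ → ∀ n → CardLe (λ v → K′ v × L′ v) n → length T ≤ n

  CutAround : Subset V → Set₁
  CutAround K₀ = Σ Cut λ c → K₀ ⊆ Cut.K c

  minCut : ∀ K₀ K L n → IsSep G K L → K₀ ⊆ K → SmallX K → CardLe (λ v → K v × L v) n → CutAround K₀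
  minCut K₀ K L n s K₀⊆ k card with least
    (λ n → Σ (Subset V) λ K → Σ (Subset V) λ L → IsSep G K L × K₀ ⊆ K × SmallX K × CardLe (λ v → K v × L v) n)
    (n , K , L , s , K₀⊆ , k , card)
  ... | n , (K , L , s , K₀⊆ , k , card) , min with CardLe⇒HasCard card
  ... | m , (T , refl , uT , T⇔) , m≤n = record
    { K = K ; L = L ; isSep = s ; small = k ; T = T ; uT = uT ; T⇔ = T⇔
    ; minimal = λ K′ L′ s′ K⊆′ k′ n′ card′ →
        ≤-trans m≤n (min n′ (K′ , L′ , s′ , (λ v k₀ → K⊆′ v (K₀⊆ v k₀)) , k′ , card′)) } , K₀⊆

  boundedCut : ∀ K₀ D → (∀ {u v} → K₀ u → E u v → ¬ K₀ v → v ∈ D) → SmallX K₀ → CutAround K₀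
  boundedCut K₀ D boundary small = minCut K₀ (λ v → K₀ v ⊎ v ∈ D) (λ v → ¬ K₀ v) (length D)
    (mkSep cover (λ e ¬Kv K₀u → ¬Kv (inj₂ (boundary K₀u e (¬Kv ∘ inj₁)))))
    (λ v → inj₁) (SmallX-∪ small (SmallX-list D))
    (D , ≤-refl , λ { v (inj₁ k , ¬k) → ⊥-elim (¬k k) ; v (inj₂ d , _) → d })
    where
    cover : ∀ v → (K₀ v ⊎ v ∈ D) ⊎ ¬ K₀ v
    cover v with em₀ {K₀ v}
    ... | yes k = inj₁ (inj₁ k)
    ... | no ¬k = inj₂ ¬k

  module _ (c : Cut) where
    open Cut c

    -- If all neighbours of t were in K, then t could be dropped from L, leaving a smaller separator
    -- around the same K.
    outer-neighbour : ∀ {t} → t ∈ T → Σ V λ w → E t w × ¬ K w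
    outer-neighbour {t} t∈ = byContradiction λ none → <⇒≱ (keep-length-< T t∈ (λ p → p refl))
      (minimal K (λ v → L v × v ≢ t)
        (mkSep cover (λ {u} {v} e ¬Kv → sep-edge isSep e ¬Kv , λ { refl → none (v , e , ¬Kv) }))
        (λ v k → k) small _ (keep (_≢ t) T , ≤-refl , λ { v (k , l , ≢) → keep⁺ (proj₁ (T⇔ v) (k , l)) ≢ }))
      where
      cover : ∀ v → K v ⊎ (L v × v ≢ t)
      cover v with proj₁ isSep v | em₀ {v ≡ t}
      ... | inj₁ k | _ = inj₁ k
      ... | inj₂ l | no ≢ = inj₂ (l , ≢)
      ... | inj₂ l | yes refl = inj₁ (proj₁ (proj₂ (T⇔ t) t∈))

    opaque
      manyX : Σ (List V) λ l → length l ≡ suc (length T) × Unique l × (∀ {x} → x ∈ l → X x)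
      manyX = infinite⇒many X X-infinite (suc (length T))

    -- The neighbours of T make the sets K exhaust G. The |T| + 1 vertices of X force the next
    -- separator to be larger, see `T-grows`.
    extension : List V
    extension = nbrs T ++ proj₁ manyX

    extended : Subset V
    extended v = K v ⊎ v ∈ extension

    nextCut : CutAround extended
    nextCut = boundedCut extended (nbrs T ++ nbrs extension) boundary (SmallX-∪ small (SmallX-list extension))
      where
      boundary : ∀ {u v} → extended u → E u v → ¬ extended v → v ∈ nbrs T ++ nbrs extension
      boundary {u} (inj₁ k) e ¬n = ∈-++⁺ˡ (nbrs⁺ (proj₁ (T⇔ u) (k , sep-edge isSep e (¬n ∘ inj₁))) e)
      boundary (inj₂ u∈) e _ = ∈-++⁺ʳ (nbrs T) (nbrs⁺ u∈ e)

  rootCut : CutAround (_≡ root)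
  rootCut = boundedCut (_≡ root) (nbrs (root ∷ [])) (λ { refl e _ → nbrs⁺ (here refl) e })
    ((root ∷ []) , λ { v (_ , eq) → here eq })

  opaque
    cuts : ℕ → Cut
    cuts zero = proj₁ rootCut
    cuts (suc n) = proj₁ (nextCut (cuts n))

    cuts-root : Cut.K (cuts 0) root
    cuts-root = proj₂ rootCut root refl

    cuts-extend : ∀ n {v} → extended (cuts n) v → Cut.K (cuts (suc n)) v
    cuts-extend n {v} = proj₂ (nextCut (cuts n)) v

  module _ (n : ℕ) where
    open Cut (cuts n) public using (K; L; T; isSep; small; uT; minimal)

    inT : ∀ {v} → K v → L v → v ∈ T
    inT k l = proj₁ (Cut.T⇔ (cuts n) _) (k , l)

    T⊆K : ∀ {v} → v ∈ T → K v
    T⊆K t = proj₁ (proj₂ (Cut.T⇔ (cuts n) _) t)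

    T⊆L : ∀ {v} → v ∈ T → L v
    T⊆L t = proj₂ (proj₂ (Cut.T⇔ (cuts n) _) t)

  K-suc : ∀ n {v} → K n v → K (suc n) v
  K-suc n k = cuts-extend n (inj₁ k)

  K-nbr : ∀ n {u v} → K n u → E u v → K (suc n) v
  K-nbr n {u} {v} k e with em₀ {K n v}
  ... | yes k′ = K-suc n k′
  ... | no ¬k = cuts-extend n (inj₂ (∈-++⁺ˡ (nbrs⁺ (inT n k (sep-edge (isSep n) e ¬k)) e)))

  -- A vertex of `K n` in `L (suc n)` would lie in `T (suc n)` and so have a neighbour outside
  -- `K (suc n)`, but that set contains all neighbours of `K n`.
  K-suc-avoids-L : ∀ n {v} → K n v → ¬ L (suc n) v
  K-suc-avoids-L n k l with outer-neighbour (cuts (suc n)) (inT (suc n) (K-suc n k) l)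
  ... | w , e , ¬k = ¬k (K-nbr n k e)

  L-suc : ∀ n {v} → L (suc n) v → L n v
  L-suc n {v} l with proj₁ (isSep n) v
  ... | inj₁ k = ⊥-elim (K-suc-avoids-L n k l)
  ... | inj₂ l′ = l′

  K-+ : ∀ n d {v} → K n v → K (d + n) v
  K-+ n zero k = k
  K-+ n (suc d) k = K-suc (d + n) (K-+ n d k)

  L-+ : ∀ n d {v} → L (d + n) v → L n v
  L-+ n zero l = l
  L-+ n (suc d) l = L-+ n d (L-suc (d + n) l)

  K-≤ : ∀ {m n v} → m ≤ n → K m v → K n v
  K-≤ {m} {n} {v} m≤n k = subst (λ i → K i v) (m∸n+n≡m m≤n) (K-+ m (n ∸ m) k)

  L-≤ : ∀ {m n v} → m ≤ n → L n v → L m v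
  L-≤ {m} {n} {v} m≤n l = L-+ m (n ∸ m) (subst (λ i → L i v) (sym (m∸n+n≡m m≤n)) l)

  K-avoids-L : ∀ {m n v} → m < n → K m v → ¬ L n v
  K-avoids-L {m} m<n k l = K-suc-avoids-L m k (L-≤ m<n l)

  -- `K (suc n)` contains |T n| + 1 vertices of X by construction, and `L (suc n)` infinitely many.
  -- A separator of size at most |T n| between them contradicts well-linkedness.
  T-grows : ∀ n → length (T n) < length (T (suc n))
  T-grows n = ≮⇒≥ λ small → go (≤-pred small)
    where
    module C = Cut (cuts (suc n))
    Z = manyX (cuts n)
    Z′ = infinite⇒many (λ v → X v × C.L v) (large-side C.isSep C.small) (suc (length (T n)))
    go : length (T (suc n)) ≤ length (T n) → ⊥
    go le = well-linked C.K C.L C.isSep (length C.T) (C.T , ≤-refl , λ v → proj₁ (C.T⇔ v))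
      (proj₁ Z) (proj₁ Z′) (proj₁ (proj₂ (proj₂ Z))) (proj₁ (proj₂ (proj₂ Z′)))
      (λ z z∈ → proj₂ (proj₂ (proj₂ Z)) z∈ , cuts-extend n (inj₂ (∈-++⁺ʳ (nbrs (T n)) z∈)))
      (λ z → proj₂ (proj₂ (proj₂ Z′)))
      (≤-trans (s≤s le) (≤-reflexive (sym (proj₁ (proj₂ Z)))))
      (≤-trans (s≤s le) (≤-reflexive (sym (proj₁ (proj₂ Z′)))))

  exhausting : ∀ v → Σ ℕ λ n → K n v
  exhausting v = go 0 cuts-root (proj₂ conn root v)
    where
    go : ∀ n {u} → K n u → Reach E u v → Σ ℕ λ n → K n v
    go n k here = n , k
    go n k (step e p) = go (suc n) (K-nbr n k e) p

  exhausting-list : ∀ l → Σ ℕ λ n → ∀ v → v ∈ l → K n v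
  exhausting-list [] = 0 , λ _ ()
  exhausting-list (v ∷ l) with exhausting v | exhausting-list l
  ... | m , k | n , ks = m + n , λ { _ (here refl) → K-≤ (m≤m+n m n) k ; w (there p) → K-≤ (m≤n+m n m) (ks w p) }

  module Linkage (n : ℕ) where
    Region : Subset V
    Region v = L n v × K (suc n) v

    Link : (V → Set) → List V → Set
    Link F Y = Σ V λ a → Σ V λ b → Σ (List V) λ l →
      Walk E a b l × a ∈ T (suc n) × b ∈ T n × (∀ v → v ∈ l → F v × v ∉ Y)

    T⊆Region : ∀ {v} → v ∈ T n → Region v
    T⊆Region t = T⊆L n t , K-suc n (T⊆K n t)

    T′⊆Region : ∀ {v} → v ∈ T (suc n) → Region v
    T′⊆Region t = L-suc n (T⊆L (suc n) t) , T⊆K (suc n) t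

    opaque
      -- Let M be the set reached from `T n` inside the region, off Y. If M does not meet
      -- `T (suc n)`, then Y separates `K n` and M from the rest, and |Y| < |T n| contradicts
      -- minimality of the cut.
      region-link : ∀ Y → length Y < length (T n) → Link Region Y
      region-link Y short = byContradiction λ none → <⇒≱ short (minimal n K′ L′ (mkSep cover (edge none))
        (λ v k → inj₂ (inj₁ k)) (SmallX-⊆ K′⊆ (SmallX-∪ (SmallX-list Y) (small (suc n))))
        _ (Y , ≤-refl , K′∩L′⊆))
        where
        M K′ L′ : Subset V
        M v = Σ V λ b → Σ (List V) λ l → Walk E v b l × b ∈ T n × (∀ u → u ∈ l → Region u × u ∉ Y)
        K′ v = v ∈ Y ⊎ K n v ⊎ M v
        L′ v = v ∈ Y ⊎ (L n v × ¬ M v)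
        M-start : ∀ {v} → v ∈ T n → v ∉ Y → M v
        M-start {v} t ∉ = v , _ , single v , t , λ { _ (here refl) → T⊆Region t , ∉ }
        M-head : ∀ {v} → M v → Region v
        M-head (_ , _ , single _ , _ , h) = proj₁ (h _ (here refl))
        M-head (_ , _ , cons _ _ , _ , h) = proj₁ (h _ (here refl))
        K′∩L′⊆ : ∀ v → K′ v × L′ v → v ∈ Y
        K′∩L′⊆ v (inj₁ y , _) = y
        K′∩L′⊆ v (inj₂ _ , inj₁ y) = y
        K′∩L′⊆ v (inj₂ (inj₁ k) , inj₂ (l , ¬m)) = byContradiction λ ∉ → ¬m (M-start (inT n k l) ∉)
        K′∩L′⊆ v (inj₂ (inj₂ m) , inj₂ (_ , ¬m)) = ⊥-elim (¬m m)
        K′⊆ : ∀ v → K′ v → v ∈ Y ⊎ K (suc n) v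
        K′⊆ v (inj₁ y) = inj₁ y
        K′⊆ v (inj₂ (inj₁ k)) = inj₂ (K-suc n k)
        K′⊆ v (inj₂ (inj₂ m)) = inj₂ (proj₂ (M-head m))
        cover : ∀ v → K′ v ⊎ L′ v
        cover v with proj₁ (isSep n) v | em₀ {M v}
        ... | inj₁ k | _ = inj₁ (inj₂ (inj₁ k))
        ... | inj₂ l | yes m = inj₁ (inj₂ (inj₂ m))
        ... | inj₂ l | no ¬m = inj₂ (inj₂ (l , ¬m))
        edge : ¬ Link Region Y → ∀ {u v} → E u v → ¬ K′ v → L′ u
        edge none {u} {v} e ¬K′v with em₀ {u ∈ Y}
        ... | yes y = inj₁ y
        ... | no y∉ = inj₂ (sep-edge (isSep n) e (¬K′v ∘ inj₂ ∘ inj₁) , no-M)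
          where
          Lv : L n v
          Lv with proj₁ (isSep n) v
          ... | inj₁ k = ⊥-elim (¬K′v (inj₂ (inj₁ k)))
          ... | inj₂ l = l
          no-M : ¬ M u
          no-M m@(b , l , w , b∈ , h) with em₀ {K (suc n) v}
          ... | yes k = ¬K′v (inj₂ (inj₂ (b , v ∷ l , cons (E-sym e) w , b∈ ,
                λ { _ (here refl) → (Lv , k) , ¬K′v ∘ inj₁ ; x (there p) → h x p })))
          ... | no ¬k = none (u , b , l , w , inT (suc n) (proj₂ (M-head m)) (sep-edge (isSep (suc n)) e ¬k) , b∈ , h)

    -- A set Y of fewer than |Tₙ| vertices containing Z either misses the walk chosen for Z or
    -- contains one of its vertices, which can be added to Z.
    private
      Linked : List V → List V → Set
      Linked Z F = (∀ v → v ∈ F → Region v) ×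
        (∀ Y → length Y < length (T n) → (∀ z → z ∈ Z → z ∈ Y) → Link (_∈ F) Y)
      Link-mono : ∀ {F F′ Y} → (∀ v → v ∈ F → v ∈ F′) → Link (_∈ F) Y → Link (_∈ F′) Y
      Link-mono F⊆ (a , b , l , w , a∈ , b∈ , h) = a , b , l , w , a∈ , b∈ , λ v p → F⊆ v (proj₁ (h v p)) , proj₂ (h v p)
      go : ∀ d Z → Unique Z → length Z + d ≡ length (T n) → Σ (List V) (Linked Z)
      branch : ∀ d Z → Unique Z → length Z + suc d ≡ length (T n) → ∀ qs → (∀ q → q ∈ qs → q ∉ Z) →
        Σ (List V) λ F → (∀ v → v ∈ F → Region v) ×
          (∀ Y → length Y < length (T n) → (∀ z → z ∈ Z → z ∈ Y) → ∀ q → q ∈ qs → q ∈ Y → Link (_∈ F) Y)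
      go zero Z uZ eq = [] , (λ _ ()) , λ Y short Z⊆ → ⊥-elim (<⇒≱ short
        (≤-trans (≤-reflexive (trans (sym eq) (+-identityʳ _))) (length-≤-of-⊆ uZ (λ {z} → Z⊆ z))))
      go (suc d) Z uZ eq with region-link Z (≤-trans (m<m+n (length Z) (s≤s z≤n)) (≤-reflexive eq))
      ... | a , b , l , w , a∈ , b∈ , h with branch d Z uZ eq l (λ q q∈ → proj₂ (h q q∈))
      ... | F , F⊆ , links = l ++ F ,
        (λ v v∈ → [ (λ p → proj₁ (h v p)) , F⊆ v ]′ (∈-++⁻ l v∈)) , λ Y short Z⊆ → choose Y short Z⊆
        where
        choose : ∀ Y → length Y < length (T n) → (∀ z → z ∈ Z → z ∈ Y) → Link (_∈ l ++ F) Y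
        choose Y short Z⊆ with em₀ {Σ V λ q → q ∈ l × q ∈ Y}
        ... | yes (q , q∈ , q∈Y) = Link-mono (λ v → ∈-++⁺ʳ l) (links Y short Z⊆ q q∈ q∈Y)
        ... | no miss = a , b , l , w , a∈ , b∈ , λ v v∈ → ∈-++⁺ˡ v∈ , λ v∈Y → miss (v , v∈ , v∈Y)
      branch d Z uZ eq [] _ = [] , (λ _ ()) , λ _ _ _ _ ()
      branch d Z uZ eq (q ∷ qs) q∉ with go d (q ∷ Z) (Unique-∷ (q∉ q (here refl)) uZ) (trans (sym (+-suc _ d)) eq)
                                     | branch d Z uZ eq qs (λ q′ p → q∉ q′ (there p))
      ... | F , F⊆ , link | F′ , F′⊆ , links = F ++ F′ , (λ v v∈ → [ F⊆ v , F′⊆ v ]′ (∈-++⁻ F v∈)) ,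
        λ { Y short Z⊆ _ (here refl) q∈Y → Link-mono (λ v → ∈-++⁺ˡ)
              (link Y short (λ { _ (here refl) → q∈Y ; z (there p) → Z⊆ z p }))
          ; Y short Z⊆ q′ (there p) q∈Y → Link-mono (λ v → ∈-++⁺ʳ F) (links Y short Z⊆ q′ p q∈Y) }

    opaque
      -- The region may be infinite, whereas Hall's theorem is about finite lists. Hence finitely
      -- many walks are selected such that each short Y is avoided by one of them.
      finite-region : Σ (List V) λ F → (∀ v → v ∈ F → Region v) × (∀ Y → length Y < length (T n) → Link (_∈ F) Y)
      finite-region = wrap (go (length (T n)) [] [] refl)
        where
        wrap : Σ (List V) (Linked []) → Σ (List V) λ F → (∀ v → v ∈ F → Region v) × (∀ Y → length Y < length (T n) → Link (_∈ F) Y)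
        wrap (F , F⊆ , link) = F , F⊆ , λ Y short → link Y short (λ _ ())

    private
      base : List V
      base = proj₁ finite-region ++ (T n ++ T (suc n))

    F : List V
    F = proj₁ (dedupe base)

    uF : Unique F
    uF = proj₁ (proj₂ (dedupe base))

    private
      F⊆base : ∀ {v} → v ∈ F → v ∈ base
      F⊆base = proj₁ (proj₂ (proj₂ (dedupe base)))

      base⊆F : ∀ {v} → v ∈ base → v ∈ F
      base⊆F = proj₂ (proj₂ (proj₂ (dedupe base)))

    F⊆Region : ∀ {v} → v ∈ F → Region v
    F⊆Region {v} v∈ with ∈-++⁻ (proj₁ finite-region) (F⊆base v∈)
    ... | inj₁ p = proj₁ (proj₂ finite-region) v p
    ... | inj₂ p = [ T⊆Region , T′⊆Region ]′ (∈-++⁻ (T n) p)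

    T⊆F : ∀ {v} → v ∈ T n → v ∈ F
    T⊆F t = base⊆F (∈-++⁺ʳ (proj₁ finite-region) (∈-++⁺ˡ t))

    T′⊆F : ∀ {v} → v ∈ T (suc n) → v ∈ F
    T′⊆F t = base⊆F (∈-++⁺ʳ (proj₁ finite-region) (∈-++⁺ʳ (T n) t))

    sources : List V
    sources = keep (λ v → v ∉ T (suc n)) F

    Target : V → V → Set
    Target v w = (w ≡ v ⊎ E v w) × w ∉ T n

    targets : V → List V
    targets v = keep (Target v) F

    -- Here Hall's theorem does the work of Menger's. Suppose c covers the targets of S and |c| <
    -- |S|, and let Y = (T n ∖ S) ∪ (c ∖ S). As S lies in (T n ∩ S) ∪ (c ∩ S), counting gives |Y| <
    -- |T n|. A walk in F off Y, read from its end in `T n`, starts in S and never leaves S, since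
    -- targets of S are in c. Hence it cannot arrive in `T (suc n)`, which is disjoint from S.
    hall-condition : HallCondition targets sources
    hall-condition S c uS S⊆ covered = ≮⇒≥ λ c<S → violated c<S
      where
      Y : List V
      Y = keep (λ v → v ∉ S) (T n) ++ keep (λ v → v ∉ S) c
      S∩ : List V
      S∩ = keep (_∈ S) (T n) ++ keep (_∈ S) c
      S⊆S∩ : ∀ {v} → v ∈ S → v ∈ S∩
      S⊆S∩ {v} v∈ with em₀ {v ∈ T n}
      ... | yes t = ∈-++⁺ˡ (keep⁺ t v∈)
      ... | no t∉ = ∈-++⁺ʳ (keep (_∈ S) (T n)) (keep⁺ (covered v∈ (keep⁺ (proj₁ (keep⁻ F (S⊆ v∈))) (inj₁ refl , t∉))) v∈)
      Y-short : length c < length S → length Y < length (T n)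
      Y-short c<S = +-cancelʳ-< (length S∩) _ _ (begin-strict
        length Y + length S∩ ≡⟨ +-comm (length Y) _ ⟩
        length S∩ + length Y ≡⟨ cong₂ _+_ (length-++ (keep (_∈ S) (T n))) (length-++ (keep (λ v → v ∉ S) (T n))) ⟩
        (a + b) + (a′ + b′)  ≡⟨ rearrange a b a′ b′ ⟩
        (a + a′) + (b + b′)  ≡⟨ cong₂ _+_ (keep-partition (_∈ S) (T n)) (keep-partition (_∈ S) c) ⟩
        length (T n) + length c <⟨ +-monoʳ-< (length (T n)) c<S ⟩
        length (T n) + length S ≤⟨ +-monoʳ-≤ (length (T n)) (length-≤-of-⊆ uS S⊆S∩) ⟩
        length (T n) + length S∩ ∎)
        where
        open ≤-Reasoning
        a = length (keep (_∈ S) (T n))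
        b = length (keep (_∈ S) c)
        a′ = length (keep (λ v → v ∉ S) (T n))
        b′ = length (keep (λ v → v ∉ S) c)
      in-S : ∀ {a b l} → Walk E a b l → b ∈ T n → (∀ v → v ∈ l → v ∈ proj₁ finite-region × v ∉ Y) → a ∈ S
      in-S (single x) x∈ h = byContradiction λ x∉ → proj₂ (h x (here refl)) (∈-++⁺ˡ (keep⁺ x∈ x∉))
      in-S {a} (cons e w) b∈ h with em₀ {a ∈ T n} | in-S w b∈ (λ v p → h v (there p))
      ... | yes t | _ = byContradiction λ a∉ → proj₂ (h a (here refl)) (∈-++⁺ˡ (keep⁺ t a∉))
      ... | no t∉ | y∈ = byContradiction λ a∉ → proj₂ (h a (here refl)) (∈-++⁺ʳ (keep (λ v → v ∉ S) (T n))
            (keep⁺ (covered y∈ (keep⁺ (base⊆F (∈-++⁺ˡ (proj₁ (h a (here refl))))) (inj₂ (E-sym e) , t∉))) a∉))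
      violated : length c < length S → ⊥
      violated c<S with proj₂ (proj₂ finite-region) Y (Y-short c<S)
      ... | a , b , l , w , a∈ , b∈ , h = proj₂ (keep⁻ F (S⊆ (in-S w b∈ h))) a∈

    opaque
     matching : Matching targets sources
     matching = hall sources targets (keep-Unique uF) hall-condition

    f : V → V
    f = proj₁ matching

    f-target : ∀ {v} → v ∈ F → v ∉ T (suc n) → f v ∈ F × Target v (f v)
    f-target v∈ v∉ = keep⁻ F (proj₁ (proj₂ matching) (keep⁺ v∈ v∉))

    f-injective : ∀ {v w} → v ∈ F → v ∉ T (suc n) → w ∈ F → w ∉ T (suc n) → f v ≡ f w → v ≡ w
    f-injective v∈ v∉ w∈ w∉ = proj₂ (proj₂ matching) (keep⁺ v∈ v∉) (keep⁺ w∈ w∉)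

    opaque
      -- `f` injects |F| - |T (suc n)| vertices into F ∖ T n, which is larger because T grows. A
      -- vertex left over starts a new ray.
      unmatched : Σ V λ z → z ∈ F × z ∉ T n × (∀ v → v ∈ F → v ∉ T (suc n) → f v ≢ z)
      unmatched = byContradiction λ none → <⇒≱ (T-grows n) (+-cancelʳ-≤ (length sources) _ _
        (subst (length (T (suc n)) + length sources ≤_) (trans (length-++ (T n)) (cong (length (T n) +_) (length-map f sources)))
        (≤-trans (≤-reflexive (sym (length-++ (T (suc n))))) (length-≤-of-⊆
          (Unique.++⁺ (uT (suc n)) (keep-Unique uF) (λ { (p , q) → proj₂ (keep⁻ F q) p }))
          (λ {v} v∈ → hit none ([ T′⊆F , (λ q → proj₁ (keep⁻ F q)) ]′ (∈-++⁻ (T (suc n)) v∈)))))))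
        where
        hit : ¬ (Σ V λ z → z ∈ F × z ∉ T n × (∀ v → v ∈ F → v ∉ T (suc n) → f v ≢ z)) →
          ∀ {z} → z ∈ F → z ∈ T n ++ map f sources
        hit none {z} z∈ = byContradiction λ z∉ → none (z , z∈ , z∉ ∘ ∈-++⁺ˡ ,
          λ v v∈ v∉ eq → z∉ (∈-++⁺ʳ (T n) (subst (_∈ map f sources) eq (∈-map⁺ f (keep⁺ v∈ v∉)))))

  open Linkage using (F; f)

  record Position : Set where
    constructor position
    field
      level    : ℕ
      vertex   : V
      in-F     : vertex ∈ F level
      not-in-T : vertex ∉ T (suc level)
  open Position

  opaque
    -- A vertex of `T (suc n)` is handed over to level `suc n`, whose linkage continues from there;
    -- `K-suc-avoids-L` keeps it off the separator after that.
    enter : ∀ n {w} → w ∈ F n → w ∉ T n → Position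
    enter n {w} w∈ w∉ with em₀ {w ∈ T (suc n)}
    ... | yes t = position (suc n) w (Linkage.T⊆F (suc n) t) (λ t′ → K-suc-avoids-L (suc n) (T⊆K (suc n) t) (T⊆L (suc (suc n)) t′))
    ... | no t∉ = position n w w∈ t∉

    enter-vertex : ∀ n {w} (w∈ : w ∈ F n) (w∉ : w ∉ T n) → vertex (enter n w∈ w∉) ≡ w
    enter-vertex n {w} w∈ w∉ with em₀ {w ∈ T (suc n)}
    ... | yes _ = refl
    ... | no _ = refl

    enter-level : ∀ n {w} (w∈ : w ∈ F n) (w∉ : w ∉ T n) →
      level (enter n w∈ w∉) ≡ n ⊎ (level (enter n w∈ w∉) ≡ suc n × vertex (enter n w∈ w∉) ∈ T (suc n))
    enter-level n {w} w∈ w∉ with em₀ {w ∈ T (suc n)}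
    ... | yes t = inj₂ (refl , t)
    ... | no _ = inj₁ refl

  image : ∀ s → f (level s) (vertex s) ∈ F (level s) × Linkage.Target (level s) (vertex s) (f (level s) (vertex s))
  image (position n v v∈ v∉) = Linkage.f-target n v∈ v∉

  advance : Position → Position
  advance s = enter (level s) (proj₁ (image s)) (proj₂ (proj₂ (image s)))

  advance-vertex : ∀ s → vertex (advance s) ≡ f (level s) (vertex s)
  advance-vertex s = enter-vertex (level s) (proj₁ (image s)) (proj₂ (proj₂ (image s)))

  -- For i < j, the list `F i` lies in `K j` and `F j` in `L j`, so they meet only in `T j`.
  level-unique : ∀ i j {w} → w ∈ F i → w ∉ T i → w ∈ F j → w ∉ T j → i ≡ j
  level-unique i j w∈i w∉i w∈j w∉j with <-cmp i j
  ... | tri≈ _ eq _ = eq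
  ... | tri< i<j _ _ = ⊥-elim (w∉j (inT j (K-≤ i<j (proj₂ (Linkage.F⊆Region i w∈i))) (proj₁ (Linkage.F⊆Region j w∈j))))
  ... | tri> _ _ j<i = ⊥-elim (w∉i (inT i (K-≤ j<i (proj₂ (Linkage.F⊆Region j w∈j))) (proj₁ (Linkage.F⊆Region i w∈i))))

  advance-injective : ∀ s t → vertex (advance s) ≡ vertex (advance t) → vertex s ≡ vertex t
  advance-injective s t eq = go s t (trans (sym (advance-vertex s)) (trans eq (advance-vertex t)))
    where
    go : ∀ s t → f (level s) (vertex s) ≡ f (level t) (vertex t) → vertex s ≡ vertex t
    go s@(position i v v∈ v∉) t@(position j w w∈ w∉) eq
      with level-unique i j (proj₁ (image s)) (proj₂ (proj₂ (image s)))
        (subst (_∈ F j) (sym eq) (proj₁ (image t))) (subst (_∉ T j) (sym eq) (proj₂ (proj₂ (image t))))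
    ... | refl = Linkage.f-injective i v∈ v∉ w∈ w∉ eq

  source : ℕ → Position
  source n = enter n (proj₁ (proj₂ (Linkage.unmatched n))) (proj₁ (proj₂ (proj₂ (Linkage.unmatched n))))

  source-vertex : ∀ n → vertex (source n) ≡ proj₁ (Linkage.unmatched n)
  source-vertex n = enter-vertex n (proj₁ (proj₂ (Linkage.unmatched n))) (proj₁ (proj₂ (proj₂ (Linkage.unmatched n))))

  source-unmatched : ∀ n s → vertex (source n) ≢ vertex (advance s)
  source-unmatched n s@(position i v v∈ v∉) eq with trans (sym (source-vertex n)) (trans eq (advance-vertex s))
  ... | z≡ with Linkage.unmatched n
  ... | z , z∈ , z∉ , none with level-unique n i z∈ z∉ (subst (_∈ F i) (sym z≡) (proj₁ (image s)))
                                                      (subst (_∉ T i) (sym z≡) (proj₂ (proj₂ (image s))))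
  ... | refl = none v v∈ v∉ (sym z≡)

  source-injective : ∀ m n → vertex (source m) ≡ vertex (source n) → m ≡ n
  source-injective m n eq with Linkage.unmatched m | Linkage.unmatched n | trans (sym (source-vertex m)) (trans eq (source-vertex n))
  ... | z , z∈ , z∉ , _ | .z , z′∈ , z′∉ , _ | refl = level-unique m n z∈ z∉ z′∈ z′∉

  orbit : Position → ℕ → Position
  orbit s zero = s
  orbit s (suc k) = advance (orbit s k)

  -- `advance` is injective and misses every source, so cancelling steps ends in a comparison of two
  -- sources. This yields both the injectivity of the rays and their disjointness.
  orbit-injective : ∀ i j m n → vertex (orbit (source i) m) ≡ vertex (orbit (source j) n) → i ≡ j × m ≡ n
  orbit-injective i j zero zero eq = source-injective i j eq , refl
  orbit-injective i j zero (suc n) eq = ⊥-elim (source-unmatched i (orbit (source j) n) eq)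
  orbit-injective i j (suc m) zero eq = ⊥-elim (source-unmatched j (orbit (source i) m) (sym eq))
  orbit-injective i j (suc m) (suc n) eq with orbit-injective i j m n (advance-injective _ _ eq)
  ... | p , q = p , cong suc q

  ray : ℕ → Ray G
  ray i = record
    { r = λ k → vertex (orbit (source i) k)
    ; r-inj = λ m n eq → proj₂ (orbit-injective i i m n eq)
    ; r-adj = adjacent }
    where
    adjacent : ∀ k → E (vertex (orbit (source i) k)) (vertex (orbit (source i) (suc k)))
    adjacent k with proj₁ (proj₂ (image (orbit (source i) k)))
    ... | inj₂ e = subst (E _) (sym (advance-vertex (orbit (source i) k))) e
    -- A vertex fixed by `f` would be repeated in its orbit.
    ... | inj₁ eq = ⊥-elim (1+n≢n (proj₂ (orbit-injective i i (suc k) k (trans (advance-vertex (orbit (source i) k)) eq))))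

  level-advance : ∀ s → level s ≤ level (advance s)
  level-advance s with enter-level (level s) (proj₁ (image s)) (proj₂ (proj₂ (image s)))
  ... | inj₁ eq = ≤-reflexive (sym eq)
  ... | inj₂ (eq , _) = ≤-trans (n≤1+n _) (≤-reflexive (sym eq))

  level-orbit : ∀ s k d → level (orbit s k) ≤ level (orbit s (d + k))
  level-orbit s k zero = ≤-refl
  level-orbit s k (suc d) = ≤-trans (level-orbit s k d) (level-advance (orbit s (d + k)))

  -- An injective orbit cannot stay in the finite list F of its level, and a level is left only
  -- through the next T.
  climb : ∀ i k → Σ ℕ λ k′ → level (orbit (source i) k′) ≡ suc (level (orbit (source i) k)) ×
    vertex (orbit (source i) k′) ∈ T (suc (level (orbit (source i) k)))
  climb i k = byContradiction λ none → injective-escapes (λ d → vertex (orbit s (d + k)))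
    (λ m n eq → +-cancelʳ-≡ k m n (proj₂ (orbit-injective i i (m + k) (n + k) eq)))
    (F (level (orbit s k))) (λ d → subst (λ l → vertex (orbit s (d + k)) ∈ F l) (stay none d) (in-F (orbit s (d + k))))
    where
    s = source i
    stay : ¬ (Σ ℕ λ k′ → level (orbit s k′) ≡ suc (level (orbit s k)) × vertex (orbit s k′) ∈ T (suc (level (orbit s k)))) →
      ∀ d → level (orbit s (d + k)) ≡ level (orbit s k)
    stay none zero = refl
    stay none (suc d) with enter-level (level (orbit s (d + k))) (proj₁ (image (orbit s (d + k)))) (proj₂ (proj₂ (image (orbit s (d + k)))))
    ... | inj₁ eq = trans eq (stay none d)
    ... | inj₂ (eq , t) = ⊥-elim (none (suc (d + k) , trans eq (cong suc (stay none d)) ,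
                            subst (λ l → vertex (orbit s (suc (d + k))) ∈ T (suc l)) (stay none d) t))

  reaches : ∀ i d → Σ ℕ λ k → level (orbit (source i) k) ≡ suc d + level (source i) ×
    vertex (orbit (source i) k) ∈ T (suc d + level (source i))
  reaches i zero = climb i 0
  reaches i (suc d) with reaches i d
  ... | k , eq , _ with climb i k
  ... | k′ , eq′ , t = k′ , trans eq′ (cong suc eq) , subst (λ l → vertex (orbit (source i) k′) ∈ T (suc l)) eq t

  reaches-T : ∀ i j → level (source i) < j → Σ ℕ λ k → vertex (orbit (source i) k) ∈ T j × (∀ n → k ≤ n → L j (vertex (orbit (source i) n)))
  reaches-T i j lt with reaches i (j ∸ suc (level (source i)))
  ... | k , eq , t = k , subst (λ l → vertex (orbit (source i) k) ∈ T l) j≡ t , tail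
    where
    j≡ : suc (j ∸ suc (level (source i))) + level (source i) ≡ j
    j≡ = trans (sym (+-suc (j ∸ suc (level (source i))) (level (source i)))) (m∸n+n≡m lt)
    tail : ∀ n → k ≤ n → L j (vertex (orbit (source i) n))
    tail n k≤n = L-≤ (≤-trans (≤-reflexive (sym (trans eq j≡)))
      (subst (λ m → level (orbit (source i) k) ≤ level (orbit (source i) m)) (m∸n+n≡m k≤n) (level-orbit (source i) k (n ∸ k))))
      (proj₁ (Linkage.F⊆Region (level (orbit (source i) n)) (in-F (orbit (source i) n))))

  module Component (S : Subset V) (S-finite : FiniteSet S) (p : V) (p∉S : ¬ S p) where
    M : Subset V
    M = Reach (Avoid G S) p

    M-avoids : ∀ {v} → M v → ¬ S v
    M-avoids m = Reach-closed (λ e _ → proj₂ (proj₂ e)) m p∉S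

    M-step : ∀ {u v} → M u → E u v → ¬ S v → M v
    M-step m e ¬s = Reach-trans m (step (e , M-avoids m , ¬s) here)

    M-sep : IsSep G (λ v → M v ⊎ S v) (λ v → ¬ M v)
    M-sep = mkSep cover (λ e ¬k m → ¬k (inj₁ (M-step m e (¬k ∘ inj₂))))
      where
      cover : ∀ v → (M v ⊎ S v) ⊎ ¬ M v
      cover v with em₀ {M v}
      ... | yes m = inj₁ (inj₁ m)
      ... | no ¬m = inj₂ ¬m

    M-order : CardLe (λ v → (M v ⊎ S v) × ¬ M v) (length (proj₁ S-finite))
    M-order = proj₁ S-finite , ≤-refl , λ { v (inj₁ m , ¬m) → ⊥-elim (¬m m) ; v (inj₂ s , _) → proj₂ S-finite v s }

    -- Otherwise M could be added to `K j`. This removes p from the separator, and no vertex enters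
    -- it because S avoids `L j`, contradicting minimality.
    M-large : ∀ j → p ∈ T j → (∀ v → S v → ¬ L j v) → ¬ SmallX M
    M-large j p∈ S∩L M-small = <⇒≱ (keep-length-< (T j) p∈ (λ ¬m → ¬m here))
      (minimal j (λ v → K j v ⊎ M v) (λ v → L j v × ¬ M v) (mkSep cover edge) (λ v → inj₁)
        (SmallX-∪ (small j) M-small) _
        (keep (λ v → ¬ M v) (T j) , ≤-refl ,
          λ { v (inj₁ k , l , ¬m) → keep⁺ (inT j k l) ¬m ; v (inj₂ m , _ , ¬m) → ⊥-elim (¬m m) }))
      where
      cover : ∀ v → (K j v ⊎ M v) ⊎ (L j v × ¬ M v)
      cover v with proj₁ (isSep j) v | em₀ {M v}
      ... | inj₁ k | _ = inj₁ (inj₁ k)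
      ... | inj₂ _ | yes m = inj₁ (inj₂ m)
      ... | inj₂ l | no ¬m = inj₂ (l , ¬m)
      edge : ∀ {u v} → E u v → ¬ (K j v ⊎ M v) → L j u × ¬ M u
      edge {u} {v} e ¬kv = sep-edge (isSep j) e (¬kv ∘ inj₁) , λ m → ¬kv (inj₂ (M-step m e v∉S))
        where
        v∉S : ¬ S v
        v∉S s with proj₁ (isSep j) v
        ... | inj₁ k = ¬kv (inj₁ k)
        ... | inj₂ l = S∩L v s l

  -- For j beyond a stage containing S, both rays pass through `T j` and then stay in `L j`, off S.
  -- Their points in `T j` lie in components of G - S with infinitely many vertices of X, and
  -- well-linkedness allows only one such component.
  rays-equivalent : ∀ i i′ → RayEquiv G (ray i) (ray i′)
  rays-equivalent i i′ S S-finite@(l , covers)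
    with exhausting-list l
  ... | m , ks with reaches-T i (suc (m + (level (source i) + level (source i′)))) (s≤s (≤-trans (m≤m+n _ _) (m≤n+m _ m)))
                  | reaches-T i′ (suc (m + (level (source i) + level (source i′)))) (s≤s (≤-trans (m≤n+m _ (level (source i))) (m≤n+m _ m)))
  ... | k , p∈ , tail | k′ , q∈ , tail′ =
    k , k′ , (λ n k≤n s → S∩L _ s (tail n k≤n)) , (λ n k≤n s → S∩L _ s (tail′ n k≤n)) , connected
    where
    j : ℕ
    j = suc (m + (level (source i) + level (source i′)))
    S∩L : ∀ v → S v → ¬ L j v
    S∩L v s = K-avoids-L (s≤s (m≤m+n m _)) (ks v (covers v s))
    p = vertex (orbit (source i) k)
    q = vertex (orbit (source i′) k′)
    module P = Component S S-finite p (λ s → S∩L p s (T⊆L j p∈))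
    module Q = Component S S-finite q (λ s → S∩L q s (T⊆L j q∈))
    connected : Reach (Avoid G S) p q
    connected = byContradiction λ apart → not-both-large P.M-sep P.M-order
      (λ sm → P.M-large j p∈ S∩L (SmallX-⊆ (λ v → inj₁) sm))
      (λ sm → Q.M-large j q∈ S∩L (SmallX-⊆ (λ v mq mp → apart (Reach-trans mp
        (Reach-sym (λ { (e , a , b) → E-sym e , b , a }) mq))) sm))

  thick-end : ThickEndOf G (ray 0)
  thick-end = ray , (λ i j i≢j m n eq → i≢j (proj₁ (orbit-injective i j m n eq))) , rays-equivalent 0

-- Oriented separations, tangles and uncrossing

module Tangles (em : ExcludedMiddle (lsuc 0ℓ)) (G : Graph) where
  open Classical em
  open Graph G
  open Separation em G

  Sep : Set₁
  Sep = Subset V × Subset V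

  infix 20 _ᵒ
  _ᵒ : Sep → Sep
  x ᵒ = proj₂ x , proj₁ x

  infix 4 _⊑_ _≈_
  record _⊑_ (x y : Sep) : Set where
    constructor mk⊑
    field
      small⊆ : proj₁ x ⊆ proj₁ y
      large⊇ : proj₂ y ⊆ proj₂ x
  open _⊑_ public

  _≈_ : Sep → Sep → Set
  x ≈ y = x ⊑ y × y ⊑ x

  ⊑-refl : ∀ {x} → x ⊑ x
  ⊑-refl = mk⊑ (λ v a → a) (λ v b → b)

  ⊑-trans : ∀ {x y z} → x ⊑ y → y ⊑ z → x ⊑ z
  ⊑-trans (mk⊑ a b) (mk⊑ c d) = mk⊑ (λ v p → c v (a v p)) (λ v p → b v (d v p))

  ⊑-flip : ∀ {x y} → x ⊑ y → y ᵒ ⊑ x ᵒ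
  ⊑-flip (mk⊑ a b) = mk⊑ b a

  ≈-sym : ∀ {x y} → x ≈ y → y ≈ x
  ≈-sym (p , q) = q , p

  ≈-flip : ∀ {x y} → x ≈ y → x ᵒ ≈ y ᵒ
  ≈-flip (p , q) = ⊑-flip q , ⊑-flip p

  IsSepar : Sep → Set
  IsSepar x = IsSep G (proj₁ x) (proj₂ x)

  mid : Sep → Subset V
  mid x v = proj₁ x v × proj₂ x v

  record Order≤ (x : Sep) (n : ℕ) : Set where
    constructor order≤
    field card : CardLe (mid x) n
  open Order≤ public

  Order≤-mono : ∀ {x m n} → m ≤ n → Order≤ x m → Order≤ x n
  Order≤-mono m≤n (order≤ c) = order≤ (CardLe-mono (λ v p → p) m≤n c)

  Order≤-flip : ∀ {x n} → Order≤ x n → Order≤ (x ᵒ) n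
  Order≤-flip (order≤ c) = order≤ (CardLe-mono (λ { v (a , b) → b , a }) ≤-refl c)

  Order≤-resp : ∀ {x y n} → x ≈ y → Order≤ x n → Order≤ y n
  Order≤-resp (p , q) (order≤ c) = order≤ (CardLe-mono (λ { v (a , b) → small⊆ q v a , large⊇ p v b }) ≤-refl c)

  infixr 6 _∨_
  -- One corner of x and y. The other three arise by flipping arguments, with `x ᵒ ∨ y ᵒ` opposite
  -- to `x ∨ y`; its flip is the infimum.
  _∨_ : Sep → Sep → Sep
  x ∨ y = (λ v → proj₁ x v ⊎ proj₁ y v) , (λ v → proj₂ x v × proj₂ y v)

  IsSepar-∨ : ∀ {x y} → IsSepar x → IsSepar y → IsSepar (x ∨ y)
  IsSepar-∨ {x} {y} s t = mkSep cover (λ e ¬a → sep-edge s e (¬a ∘ inj₁) , sep-edge t e (¬a ∘ inj₂))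
    where
    cover : ∀ v → (proj₁ x v ⊎ proj₁ y v) ⊎ (proj₂ x v × proj₂ y v)
    cover v with proj₁ s v | proj₁ t v
    ... | inj₁ a | _ = inj₁ (inj₁ a)
    ... | inj₂ _ | inj₁ c = inj₁ (inj₂ c)
    ... | inj₂ b | inj₂ d = inj₂ (b , d)

  IsSepar-resp : ∀ {x y} → x ≈ y → IsSepar x → IsSepar y
  IsSepar-resp (p , q) s = mkSep (λ v → [ (λ a → inj₁ (small⊆ p v a)) , (λ b → inj₂ (large⊇ q v b)) ]′ (proj₁ s v))
    (λ e ¬a → large⊇ q _ (sep-edge s e (λ a → ¬a (small⊆ p _ a))))

  edge-side : ∀ {x} → IsSepar x → ∀ {u v} → E u v → (proj₁ x u × proj₁ x v) ⊎ (proj₂ x u × proj₂ x v)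
  edge-side {x} s {u} {v} e with em₀ {proj₁ x u} | em₀ {proj₁ x v}
  ... | yes a | yes a′ = inj₁ (a , a′)
  ... | no ¬a | _ = inj₂ ([ (λ a → ⊥-elim (¬a a)) , id ]′ (proj₁ s u) , sep-edge s (E-sym e) ¬a)
  ... | yes _ | no ¬a = inj₂ (sep-edge s e ¬a , [ (λ a → ⊥-elim (¬a a)) , id ]′ (proj₁ s v))

  ∨-upperˡ : ∀ {x y} → x ⊑ x ∨ y
  ∨-upperˡ = mk⊑ (λ v → inj₁) (λ v → proj₁)

  ∨-upperʳ : ∀ {x y} → y ⊑ x ∨ y
  ∨-upperʳ = mk⊑ (λ v → inj₂) (λ v → proj₂)

  ∨-lub : ∀ {x y z} → x ⊑ z → y ⊑ z → x ∨ y ⊑ z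
  ∨-lub (mk⊑ a b) (mk⊑ c d) = mk⊑ (λ v → [ a v , c v ]′) (λ v p → b v p , d v p)

  data Nested (x y : Sep) : Set where
    le    : x ⊑ y → Nested x y
    ge    : y ⊑ x → Nested x y
    le-op : x ⊑ y ᵒ → Nested x y
    op-le : x ᵒ ⊑ y → Nested x y

  Nested-sym : ∀ {x y} → Nested x y → Nested y x
  Nested-sym (le p) = ge p
  Nested-sym (ge p) = le p
  Nested-sym (le-op p) = le-op (⊑-flip p)
  Nested-sym (op-le p) = op-le (⊑-flip p)

  Nested-flipʳ : ∀ {x y} → Nested x y → Nested x (y ᵒ)
  Nested-flipʳ (le p) = le-op p
  Nested-flipʳ (ge p) = op-le (⊑-flip p)
  Nested-flipʳ (le-op p) = le p
  Nested-flipʳ (op-le p) = ge (⊑-flip p)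

  Nested-flipˡ : ∀ {x y} → Nested x y → Nested (x ᵒ) y
  Nested-flipˡ n = Nested-sym (Nested-flipʳ (Nested-sym n))

  Nested-respˡ : ∀ {x x′ y} → x ≈ x′ → Nested x y → Nested x′ y
  Nested-respˡ (p , q) (le r) = le (⊑-trans q r)
  Nested-respˡ (p , q) (ge r) = ge (⊑-trans r p)
  Nested-respˡ (p , q) (le-op r) = le-op (⊑-trans q r)
  Nested-respˡ (p , q) (op-le r) = op-le (⊑-trans (⊑-flip p) r)

  Cross : Sep → Sep → Set
  Cross x y = ¬ Nested x y

  -- All that uncrossing needs of a corner, in a form insensitive to orientations: if y is replaced
  -- by c, the crossing with x disappears, and whatever is nested with x acquires no new crossing.
  record Corner (x y c : Sep) : Set₁ where
    field
      nested₁ : Nested x c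
      nested₂ : Nested y c
      inherit : ∀ {z} → Nested z x → Nested z y → Nested z c

  corner-flip₁ : ∀ {x y c} → Corner (x ᵒ) y c → Corner x y c
  corner-flip₁ c = record
    { nested₁ = Nested-flipˡ (Corner.nested₁ c) ; nested₂ = Corner.nested₂ c
    ; inherit = λ p q → Corner.inherit c (Nested-flipʳ p) q }

  corner-flip₂ : ∀ {x y c} → Corner x (y ᵒ) c → Corner x y c
  corner-flip₂ c = record
    { nested₁ = Corner.nested₁ c ; nested₂ = Nested-flipˡ (Corner.nested₂ c)
    ; inherit = λ p q → Corner.inherit c p (Nested-flipʳ q) }

  corner-flip₃ : ∀ {x y c} → Corner x y c → Corner x y (c ᵒ)
  corner-flip₃ c = record
    { nested₁ = Nested-flipʳ (Corner.nested₁ c) ; nested₂ = Nested-flipʳ (Corner.nested₂ c)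
    ; inherit = λ p q → Nested-flipʳ (Corner.inherit c p q) }

  Cross-flipˡ : ∀ {x y} → Cross x y → Cross (x ᵒ) y
  Cross-flipˡ c n = c (Nested-flipˡ n)

  Cross-flipʳ : ∀ {x y} → Cross x y → Cross x (y ᵒ)
  Cross-flipʳ c n = c (Nested-flipʳ n)

  -- This is the fish lemma. Only `x ⊑ z ⊑ y ᵒ` and `y ⊑ z ⊑ x ᵒ` obstruct the case distinction, and
  -- both would make x and y nested.
  ∨-corner : ∀ {x y} → Cross x y → Corner x y (x ∨ y)
  ∨-corner {x} {y} cross = record { nested₁ = le ∨-upperˡ ; nested₂ = le ∨-upperʳ ; inherit = inherit }
    where
    inherit : ∀ {z} → Nested z x → Nested z y → Nested z (x ∨ y)
    inherit (le p) _ = le (⊑-trans p ∨-upperˡ)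
    inherit (op-le p) _ = op-le (⊑-trans p ∨-upperˡ)
    inherit (ge _) (le q) = le (⊑-trans q ∨-upperʳ)
    inherit (ge _) (op-le q) = op-le (⊑-trans q ∨-upperʳ)
    inherit (le-op _) (le q) = le (⊑-trans q ∨-upperʳ)
    inherit (le-op _) (op-le q) = op-le (⊑-trans q ∨-upperʳ)
    inherit (ge p) (ge q) = ge (∨-lub p q)
    inherit (ge p) (le-op q) = ⊥-elim (cross (le-op (⊑-trans p q)))
    inherit (le-op p) (ge q) = ⊥-elim (cross (le-op (⊑-flip (⊑-trans q p))))
    inherit (le-op p) (le-op q) = le-op (⊑-flip (∨-lub (⊑-flip p) (⊑-flip q)))

  -- Contrapositively, whatever crosses two opposite corners crosses x. This controls the double
  -- counting in `crossing-sum`.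
  opposite-corners : ∀ {x y z} → Nested z x → Nested z (x ∨ y) ⊎ Nested z (x ᵒ ∨ y ᵒ)
  opposite-corners (le p) = inj₁ (le (⊑-trans p ∨-upperˡ))
  opposite-corners (op-le p) = inj₁ (op-le (⊑-trans p ∨-upperˡ))
  opposite-corners (ge p) = inj₂ (op-le (⊑-trans (⊑-flip p) ∨-upperˡ))
  opposite-corners (le-op p) = inj₂ (le (⊑-trans p ∨-upperˡ))

  ∨-swap : ∀ {x y} → y ∨ x ⊑ x ∨ y
  ∨-swap = ∨-lub ∨-upperʳ ∨-upperˡ

  submodular : ∀ {x y a b} → Order≤ x a → Order≤ y b →
    Σ ℕ λ i → Σ ℕ λ j → Order≤ (x ∨ y) i × Order≤ (x ᵒ ∨ y ᵒ) j × i + j ≤ a + b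
  submodular {x} {y} (order≤ (lx , lenx , cx)) (order≤ (ly , leny , cy)) =
    length U.lC , length U.lC′ , order≤ (U.lC , ≤-refl , λ v → U.covC v tt) , order≤ (U.lC′ , ≤-refl , λ v → U.covC′ v tt) ,
    ≤-trans U.total-≤ (+-mono-≤ lenx leny)
    where
    resp : ∀ {S : Subset V} {u v} → u ≡ v → S u → S v
    resp refl p = p
    ∨⊆ : ∀ v → ⊤ → mid (x ∨ y) v → mid x v ⊎ mid y v
    ∨⊆ v _ (inj₁ a , b , _) = inj₁ (a , b)
    ∨⊆ v _ (inj₂ c , _ , d) = inj₂ (c , d)
    ∧⊆ : ∀ v → ⊤ → mid (x ᵒ ∨ y ᵒ) v → mid x v ⊎ mid y v
    ∧⊆ v _ (inj₁ b , a , _) = inj₁ (a , b)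
    ∧⊆ v _ (inj₂ d , _ , c) = inj₂ (c , d)
    both⊆x : ∀ v → mid (x ∨ y) v → mid (x ᵒ ∨ y ᵒ) v → mid x v
    both⊆x v (_ , b , _) (_ , a , _) = a , b
    both⊆y : ∀ v → mid (x ∨ y) v → mid (x ᵒ ∨ y ᵒ) v → mid y v
    both⊆y v (_ , _ , d) (_ , _ , c) = c , d
    module U = Uncross _≡_ (λ _ → ⊤) (mid x) (mid y) (mid (x ∨ y)) (mid (x ᵒ ∨ y ᵒ))
      (resp {mid (x ∨ y)}) (resp {mid (x ᵒ ∨ y ᵒ)}) (λ eq → resp {mid x} (sym eq)) (λ eq → resp {mid y} (sym eq))
      ∨⊆ ∧⊆ both⊆x both⊆y lx ly (λ v _ → cx v) (λ v _ → cy v)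

  Tangle : Set₁
  Tangle = Σ (OSepSet G) (IsTangle G)

  infix 4 _∈ₜ_
  record _∈ₜ_ (x : Sep) (P : Tangle) : Set₁ where
    constructor member
    field raw : _∈ᴾ_ G x (proj₁ P)
  open _∈ₜ_ public

  Below : ℕ → Bound G → Set
  Below n (fin m) = n < m
  Below n ℵ₀ = ⊤

  record Orients (P : Tangle) (n : ℕ) : Set where
    constructor orients
    field below : Below n (proj₁ (proj₁ (proj₂ P)))

  Orients-mono : ∀ {P m n} → m ≤ n → Orients P n → Orients P m
  Orients-mono {P , (fin k , _) , _} m≤n (orients lt) = orients (≤-trans (s≤s m≤n) lt)
  Orients-mono {P , (ℵ₀ , _) , _} m≤n _ = orients tt

  ∈-resp : ∀ {P x y} → x ≈ y → x ∈ₜ P → y ∈ₜ P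
  ∈-resp (p , q) (member (C , D , m , (f , g) , (h , k))) = member (C , D , m ,
    ((λ v c → small⊆ p v (f v c)) , (λ v a → g v (small⊆ q v a))) ,
    ((λ v d → large⊇ q v (h v d)) , (λ v b → k v (large⊇ p v b))))

  ∈-separ : ∀ {P x} → x ∈ₜ P → IsSepar x
  ∈-separ {P , (k , all , _) , _} (member (C , D , m , (f , g) , (h , i))) =
    IsSepar-resp (mk⊑ f i , mk⊑ g h) (proj₁ (all C D m))

  ∈-order : ∀ {P x} → x ∈ₜ P → Σ ℕ λ n → HasCard (mid x) n × Orients P n
  ∈-order {P , (k , all , _) , _} {x} (member (C , D , m , (f , g) , (h , i))) = go k (proj₂ (all C D m)) refl
    where
    eq : (λ v → C v × D v) ≐ mid x
    eq = (λ { v (c , d) → f v c , h v d }) , (λ { v (a , b) → g v a , i v b })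
    go : ∀ k′ → OrderLt G k′ C D → k′ ≡ k → Σ ℕ λ n → HasCard (mid x) n × Orients (P , (k , all , _) , _) n
    go (fin b) (n , c , lt) refl = n , HasCard-cong eq c , orients lt
    go ℵ₀ (n , c) refl = n , HasCard-cong eq c , orients tt

  orient : ∀ {P x n} → IsSepar x → Order≤ x n → Orients P n → x ∈ₜ P ⊎ x ᵒ ∈ₜ P
  orient {P@(_ , (k , _ , total , _) , _)} {x} {n} s (order≤ c) o with CardLe⇒HasCard c
  ... | m , hc , m≤n = wrap (total (proj₁ x) (proj₂ x) s (lt k (Orients.below (Orients-mono m≤n o))))
    where
    lt : ∀ k → Below m k → OrderLt G k (proj₁ x) (proj₂ x)
    lt (fin b) m<b = m , hc , m<b
    lt ℵ₀ _ = m , hc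
    wrap : _∈ᴾ_ G x (proj₁ P) ⊎ _∈ᴾ_ G (x ᵒ) (proj₁ P) → x ∈ₜ P ⊎ x ᵒ ∈ₜ P
    wrap (inj₁ p) = inj₁ (member p)
    wrap (inj₂ p) = inj₂ (member p)

  no-cover : ∀ {P x y z} → x ∈ₜ P → y ∈ₜ P → z ∈ₜ P → ¬ Cover3 G (proj₁ x) (proj₁ y) (proj₁ z)
  no-cover {P , _ , uncovered} (member (C , D , m , (_ , f) , _)) (member (C′ , D′ , m′ , (_ , f′) , _)) (member (C″ , D″ , m″ , (_ , f″) , _)) (vs , es) =
    uncovered C D C′ D′ C″ D″ m m′ m″
      ( (λ v → [ (λ a → inj₁ (f v a)) , [ (λ a → inj₂ (inj₁ (f′ v a))) , (λ a → inj₂ (inj₂ (f″ v a))) ]′ ]′ (vs v))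
      , (λ u v e → [ (λ { (a , b) → inj₁ (f u a , f v b) }) , [ (λ { (a , b) → inj₂ (inj₁ (f′ u a , f′ v b)) }) ,
                     (λ { (a , b) → inj₂ (inj₂ (f″ u a , f″ v b)) }) ]′ ]′ (es u v e)))

  -- The pre-tangle condition only yields A ≐ B here. The contradiction comes from the tangle axiom,
  -- as G[A] ∪ G[B] = G.
  not-both : ∀ {P x} → x ∈ₜ P → x ᵒ ∈ₜ P → ⊥
  not-both {P} {x} p q = no-cover p q q
    ((λ v → [ inj₁ , (λ b → inj₂ (inj₁ b)) ]′ (proj₁ (∈-separ p) v)) ,
     (λ u v e → [ inj₁ , (λ b → inj₂ (inj₁ b)) ]′ (edge-side (∈-separ p) e)))

  not-everything : ∀ {P x} → x ∈ₜ P → ¬ (∀ v → proj₁ x v)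
  not-everything p all = no-cover p p p ((λ v → inj₁ (all v)) , (λ u v _ → inj₁ (all u , all v)))

  -- Consistency speaks of different separations only. If `y ᵒ` is x, then `y ⊑ x` makes the small
  -- side of x all of G; if y is x, there is nothing to show.
  down : ∀ {P x y n} → x ∈ₜ P → IsSepar y → Order≤ y n → Orients P n → y ⊑ x → y ∈ₜ P
  down {P} {x} {y} x∈ s o or y⊑x with orient {P} {y} s o or
  ... | inj₁ y∈ = y∈
  ... | inj₂ (member (C′ , D′ , m′ , (f , g) , (h , i))) = go P x∈ m′
    where
    go : ∀ P → x ∈ₜ P → proj₁ P C′ D′ → y ∈ₜ P
    go P@(_ , (_ , _ , _ , _ , consistent) , _) x∈@(member (C , D , m , (f₁ , g₁) , (h₁ , i₁))) m′
      with em₀ {C′ ≐ C × D′ ≐ D} | em₀ {C′ ≐ D × D′ ≐ C}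
    ... | yes ((a , b) , (c , d)) | _ = ⊥-elim (not-everything x∈ λ v →
          [ id , (λ bv → small⊆ y⊑x v (h v (d v (i₁ v bv)))) ]′ (proj₁ (∈-separ x∈) v))
    ... | no _ | yes ((a , b) , (c , d)) = ∈-resp
          (mk⊑ (λ v a₁ → h v (d v (g₁ v a₁))) (λ v b₁ → h₁ v (a v (g v b₁))) , y⊑x) x∈
    ... | no n₁ | no n₂ = ⊥-elim (consistent C′ D′ C D m′ m (n₁ , n₂)
          ((λ v d′ → g₁ v (small⊆ y⊑x v (h v d′))) , (λ v d → g v (large⊇ y⊑x v (h₁ v d)))))

  -- The small sides of x, y and `(x ∨ y) ᵒ` cover all vertices and edges, so P cannot contain the
  -- third.
  towards : ∀ {P x y n} → x ∈ₜ P → y ∈ₜ P → Order≤ (x ∨ y) n → Orients P n → x ∨ y ∈ₜ P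
  towards {P} {x} {y} x∈ y∈ o or with orient {P} {x ∨ y} (IsSepar-∨ {x} {y} (∈-separ x∈) (∈-separ y∈)) o or
  ... | inj₁ p = p
  ... | inj₂ q = ⊥-elim (no-cover x∈ y∈ q (vs , es))
    where
    vs : ∀ v → proj₁ x v ⊎ proj₁ y v ⊎ (proj₂ x v × proj₂ y v)
    vs v with proj₁ (∈-separ x∈) v | proj₁ (∈-separ y∈) v
    ... | inj₁ a | _ = inj₁ a
    ... | inj₂ _ | inj₁ c = inj₂ (inj₁ c)
    ... | inj₂ b | inj₂ d = inj₂ (inj₂ (b , d))
    es : ∀ u v → E u v → (proj₁ x u × proj₁ x v) ⊎ (proj₁ y u × proj₁ y v) ⊎
      ((proj₂ x u × proj₂ y u) × (proj₂ x v × proj₂ y v))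
    es u v e with edge-side (∈-separ x∈) e | edge-side (∈-separ y∈) e
    ... | inj₁ a | _ = inj₁ a
    ... | inj₂ _ | inj₁ c = inj₂ (inj₁ c)
    ... | inj₂ (b , b′) | inj₂ (d , d′) = inj₂ (inj₂ ((b , d) , (b′ , d′)))

  -- Although `order` is only an upper bound, n is the exact order of x: apply `minimal` to x
  -- itself.
  record Efficient (P P′ : Tangle) (x : Sep) (n : ℕ) : Set₁ where
    field
      in₁     : x ∈ₜ P
      in₂     : x ᵒ ∈ₜ P′
      order   : Order≤ x n
      minimal : ∀ y m → y ∈ₜ P → y ᵒ ∈ₜ P′ → Order≤ y m → n ≤ m
    separ : IsSepar x
    separ = ∈-separ in₁
  open Efficient public

  Efficient-flip : ∀ {P P′ x n} → Efficient P P′ x n → Efficient P′ P (x ᵒ) n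
  Efficient-flip e = record { in₁ = in₂ e ; in₂ = in₁ e ; order = Order≤-flip (order e)
    ; minimal = λ y m p q o → minimal e (y ᵒ) m q p (Order≤-flip o) }

  Efficient-resp : ∀ {P P′ x y n} → x ≈ y → Efficient P P′ x n → Efficient P P′ y n
  Efficient-resp eq e = record { in₁ = ∈-resp eq (in₁ e) ; in₂ = ∈-resp (≈-flip eq) (in₂ e)
    ; order = Order≤-resp eq (order e) ; minimal = minimal e }

  orients₁ : ∀ {P P′ x n} → Efficient P P′ x n → Orients P n
  orients₁ {x = x} e with ∈-order (in₁ e)
  ... | k , hc , o = Orients-mono (minimal e x k (in₁ e) (in₂ e) (order≤ (HasCard⇒CardLe hc))) o

  orients₂ : ∀ {P P′ x n} → Efficient P P′ x n → Orients P′ n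
  orients₂ e = orients₁ (Efficient-flip e)

  agree : ∀ {P P′ x n y m} → Efficient P P′ x n → Order≤ y m → m < n → y ∈ₜ P → y ∈ₜ P′
  agree {y = y} {m} e o m<n y∈ with orient (∈-separ y∈) o (Orients-mono (<⇒≤ m<n) (orients₂ e))
  ... | inj₁ p = p
  ... | inj₂ q = ⊥-elim (<⇒≱ m<n (minimal e y m y∈ q o))

  corner-efficient : ∀ {P P′ w k x y} → Efficient P P′ w k → x ∈ₜ P → y ∈ₜ P → x ᵒ ∈ₜ P′ ⊎ y ᵒ ∈ₜ P′ →
    Order≤ (x ∨ y) k → Efficient P P′ (x ∨ y) k
  corner-efficient {P} {P′} {k = k} {x} {y} e x∈ y∈ opp o = record
    { in₁ = towards x∈ y∈ o (orients₁ e) ; in₂ = away opp ; order = o ; minimal = minimal e }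
    where
    s : IsSepar (x ∨ y)
    s = IsSepar-∨ {x} {y} (∈-separ x∈) (∈-separ y∈)
    away : x ᵒ ∈ₜ P′ ⊎ y ᵒ ∈ₜ P′ → (x ∨ y) ᵒ ∈ₜ P′
    away (inj₁ p) = down p (IsSep-flip s) (Order≤-flip o) (orients₂ e) (⊑-flip ∨-upperˡ)
    away (inj₂ p) = down p (IsSep-flip s) (Order≤-flip o) (orients₂ e) (⊑-flip ∨-upperʳ)

  -- If i ≤ k, both tangles orient the corner and differ on it, so minimality of k applies.
  corner-order : ∀ {P P′ w k x y i} → Efficient P P′ w k → x ∈ₜ P → y ∈ₜ P → x ᵒ ∈ₜ P′ ⊎ y ᵒ ∈ₜ P′ →
    Order≤ (x ∨ y) i → k ≤ i
  corner-order {k = k} {x} {y} {i} e x∈ y∈ opp o with ≤-total k i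
  ... | inj₁ k≤i = k≤i
  ... | inj₂ i≤k = let c = corner-efficient e x∈ y∈ opp (Order≤-mono i≤k o) in
        minimal e (x ∨ y) i (in₁ c) (in₂ c) o

  no-cover-by-corners : ∀ {P x y} → x ᵒ ∈ₜ P → IsSepar y → (x ᵒ ∨ y ᵒ) ᵒ ∈ₜ P → (x ᵒ ∨ y) ᵒ ∈ₜ P → ⊥
  no-cover-by-corners {P} {x} {y} x∈ sy p q = no-cover x∈ p q (vs , es)
    where
    vs : ∀ v → proj₂ x v ⊎ (proj₁ x v × proj₁ y v) ⊎ (proj₁ x v × proj₂ y v)
    vs v with proj₁ (∈-separ x∈) v | proj₁ sy v
    ... | inj₁ b | _ = inj₁ b
    ... | inj₂ a | inj₁ c = inj₂ (inj₁ (a , c))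
    ... | inj₂ a | inj₂ d = inj₂ (inj₂ (a , d))
    es : ∀ u v → E u v → (proj₂ x u × proj₂ x v) ⊎ ((proj₁ x u × proj₁ y u) × (proj₁ x v × proj₁ y v)) ⊎
      ((proj₁ x u × proj₂ y u) × (proj₁ x v × proj₂ y v))
    es u v e with edge-side (∈-separ x∈) e | edge-side sy e
    ... | inj₁ b | _ = inj₁ b
    ... | inj₂ (a , a′) | inj₁ (c , c′) = inj₂ (inj₁ ((a , c) , (a′ , c′)))
    ... | inj₂ (a , a′) | inj₂ (d , d′) = inj₂ (inj₂ ((a , d) , (a′ , d′)))

  -- Otherwise P′ would contain both corners, and together with the other side of x their small sides cover G.
  no-small-corners : ∀ {P P′ x y n i j} → Efficient P P′ x n → IsSepar y →
    Order≤ (x ᵒ ∨ y ᵒ) i → i < n → Order≤ (x ᵒ ∨ y) j → j < n → ⊥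
  no-small-corners {P} {P′} {x} {y} e sy o i<n o′ j<n = no-cover-by-corners {x = x} {y} (in₂ e) sy
    (agree e (Order≤-flip o) i<n (down (in₁ e) (IsSep-flip (IsSepar-∨ {x ᵒ} {y ᵒ} (IsSep-flip (separ e)) (IsSep-flip sy)))
      (Order≤-flip o) (Orients-mono (<⇒≤ i<n) (orients₁ e)) (⊑-flip ∨-upperˡ)))
    (agree e (Order≤-flip o′) j<n (down (in₁ e) (IsSep-flip (IsSepar-∨ {x ᵒ} {y} (IsSep-flip (separ e)) sy))
      (Order≤-flip o′) (Orients-mono (<⇒≤ j<n) (orients₁ e)) (⊑-flip ∨-upperˡ)))

  -- Since m < n, both Q and Q′ contain s, so `s ∨ t` and `s ∨ t ᵒ` distinguish them as soon as
  -- their order is at most n. If both orders exceed n, submodularity makes the opposite corners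
  -- smaller than m, which `no-small-corners` forbids for s.
  uncross-lower-oriented : ∀ {P P′ Q Q′ s t m n} → Efficient P P′ s m → Efficient Q Q′ t n → m < n → Cross s t →
    s ∈ₜ Q → Σ Sep λ c → Efficient Q Q′ c n × Corner s t c
  uncross-lower-oriented {s = s} {t} {m} {n} es et m<n cross s∈Q
    with em₀ {Order≤ (s ∨ t) n} | em₀ {Order≤ (s ∨ t ᵒ) n}
  ... | yes o | _ = s ∨ t , corner-efficient et s∈Q (in₁ et) (inj₂ (in₂ et)) o , ∨-corner cross
  ... | no _ | yes o = (s ∨ t ᵒ) ᵒ ,
        Efficient-flip (corner-efficient (Efficient-flip et) (agree et (order es) m<n s∈Q) (in₂ et) (inj₂ (in₁ et)) o) ,
        corner-flip₃ (corner-flip₂ (∨-corner (Cross-flipʳ cross)))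
  ... | no ¬o | no ¬o′ with submodular (order es) (order et) | submodular (order es) (Order≤-flip (order et))
  ... | i , j , oi , oj , le₁ | i′ , j′ , oi′ , oj′ , le₂ =
    ⊥-elim (no-small-corners es (separ et) oj (smaller ¬o oi le₁) oj′ (smaller ¬o′ oi′ le₂))
    where
    smaller : ∀ {c i j} → ¬ Order≤ c n → Order≤ c i → i + j ≤ m + n → j < m
    smaller {c} {i} {j} ¬o oi bound = +-cancelˡ-< n j m (≤-trans (+-monoˡ-< j (≰⇒> (λ i≤n → ¬o (Order≤-mono i≤n oi))))
      (≤-trans bound (≤-reflexive (+-comm m n))))

  uncross-lower : ∀ {P P′ Q Q′ s t m n} → Efficient P P′ s m → Efficient Q Q′ t n → m < n → Cross s t →
    Σ Sep λ c → Efficient Q Q′ c n × Corner s t c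
  uncross-lower {Q = Q} {s = s} es et m<n cross
    with orient {Q} {s} (separ es) (order es) (Orients-mono (<⇒≤ m<n) (orients₁ et))
  ... | inj₁ s∈Q = uncross-lower-oriented es et m<n cross s∈Q
  ... | inj₂ s∈Q with uncross-lower-oriented (Efficient-flip es) et m<n (Cross-flipˡ cross) s∈Q
  ... | c , ec , corner = c , ec , corner-flip₁ corner

  -- Each of the two opposite corners distinguishes one of the pairs, so its order is at least k;
  -- submodularity leaves at most 2k for both.
  uncross-equal : ∀ {P P′ Q Q′ u w x y k} → Efficient P P′ u k → Efficient Q Q′ w k → Order≤ x k → Order≤ y k →
    x ∈ₜ P → y ∈ₜ P → x ᵒ ∈ₜ P′ ⊎ y ᵒ ∈ₜ P′ → x ᵒ ∈ₜ Q → y ᵒ ∈ₜ Q → x ∈ₜ Q′ ⊎ y ∈ₜ Q′ →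
    Efficient P P′ (x ∨ y) k × Efficient Q Q′ (x ᵒ ∨ y ᵒ) k
  uncross-equal {x = x} {y} {k} eP eQ ox oy xP yP oppP xQ yQ oppQ with submodular ox oy
  ... | i , j , oi , oj , bound = corner-efficient eP xP yP oppP (Order≤-mono i≤k oi) , corner-efficient eQ xQ yQ oppQ (Order≤-mono j≤k oj)
    where
    i≤k : i ≤ k
    i≤k = +-cancelʳ-≤ k i k (≤-trans (+-monoʳ-≤ i (corner-order eQ xQ yQ oppQ oj)) bound)
    j≤k : j ≤ k
    j≤k = +-cancelˡ-≤ k j k (≤-trans (+-monoˡ-≤ j (corner-order eP xP yP oppP oi)) bound)

-- Finiteness of crossing numbers

module FiniteCrossing (em : ExcludedMiddle (lsuc 0ℓ)) (G : Graph) (conn : Connected G) (lf : LocallyFinite G) where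
  open Classical em
  open Graph G
  open Separation em G
  open Tangles em G
  open Neighbourhood G lf

  private
    root : V
    root = proj₁ conn

  Off : List V → V → V → Set
  Off Y = Avoid G (_∈ Y)

  Off-sym : ∀ {Y u v} → Off Y u v → Off Y v u
  Off-sym (e , a , b) = E-sym e , b , a

  Comp : List V → V → Subset V
  Comp Y r v = r ∉ Y × Reach (Off Y) r v

  Comp-avoids : ∀ {Y r v} → Comp Y r v → v ∉ Y
  Comp-avoids (r∉ , p) = Reach-closed (λ e _ → proj₂ (proj₂ e)) p r∉

  Comp-step : ∀ {Y r u v} → Comp Y r u → E u v → v ∉ Y → Comp Y r v
  Comp-step c@(r∉ , p) e v∉ = r∉ , Reach-trans p (step (e , Comp-avoids c , v∉) here)

  reps : List V → List V
  reps Y = root ∷ nbrs Y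

  -- A walk from the root to v either avoids Y or leaves Y for the last time at a neighbour of Y. So
  -- G - Y has finitely many components.
  representative : ∀ Y {v} → v ∉ Y → Σ V λ r → r ∈ reps Y × Comp Y r v
  representative Y {v} v∉ with Reach-closed {P = λ u → u ∈ Y ⊎ Σ V λ r → r ∈ reps Y × Comp Y r u} advance (proj₂ conn root v) start
    where
    start : root ∈ Y ⊎ Σ V λ r → r ∈ reps Y × Comp Y r root
    start with em₀ {root ∈ Y}
    ... | yes p = inj₁ p
    ... | no p = inj₂ (root , here refl , p , here)
    advance : ∀ {u w} → E u w → u ∈ Y ⊎ (Σ V λ r → r ∈ reps Y × Comp Y r u) → w ∈ Y ⊎ Σ V λ r → r ∈ reps Y × Comp Y r w
    advance {u} {w} e h with em₀ {w ∈ Y} | h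
    ... | yes p | _ = inj₁ p
    ... | no p | inj₁ u∈ = inj₂ (w , there (nbrs⁺ u∈ e) , p , here)
    ... | no p | inj₂ (r , r∈ , c) = inj₂ (r , r∈ , Comp-step c e p)
  ... | inj₁ v∈ = ⊥-elim (v∉ v∈)
  ... | inj₂ p = p

  -- A separation with separator Y is given by the components of G - Y on its small side, listed by
  -- representatives.
  decode : List V → List V → Sep
  decode Y R = (λ v → v ∈ Y ⊎ Σ V λ r → r ∈ R × Comp Y r v) , (λ v → v ∈ Y ⊎ ¬ (Σ V λ r → r ∈ R × Comp Y r v))

  small-closed : ∀ {x Y} → IsSepar x → (∀ v → mid x v → v ∈ Y) → ∀ {u v} → Off Y u v → proj₁ x u → proj₁ x v
  small-closed s m (e , u∉ , v∉) a = byContradiction λ ¬a → u∉ (m _ (a , sep-edge s e ¬a))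

  large-closed : ∀ {x Y} → IsSepar x → (∀ v → mid x v → v ∈ Y) → ∀ {u v} → Off Y u v → proj₂ x u → proj₂ x v
  large-closed s m (e , u∉ , v∉) b = byContradiction λ ¬b → u∉ (m _ (sep-edge′ s e ¬b , b))

  codeOf : Sep → List V → List V
  codeOf x Y = keep (proj₁ x) (reps Y)

  decode-codeOf : ∀ {x Y} → IsSepar x → (∀ v → mid x v ⇔ (v ∈ Y)) → x ≈ decode Y (codeOf x Y)
  decode-codeOf {x} {Y} s m = mk⊑ small (λ v → [ (λ v∈ → proj₂ (proj₂ (m v) v∈)) , large v ]′) ,
    mk⊑ (λ v → [ (λ v∈ → proj₁ (proj₂ (m v) v∈)) , back v ]′) large′
    where
    m→ : ∀ v → mid x v → v ∈ Y
    m→ v = proj₁ (m v)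
    back : ∀ v → (Σ V λ r → r ∈ codeOf x Y × Comp Y r v) → proj₁ x v
    back v (r , r∈ , _ , p) = Reach-closed (small-closed {x} s m→) p (proj₂ (keep⁻ (reps Y) r∈))
    small : ∀ v → proj₁ x v → v ∈ Y ⊎ Σ V λ r → r ∈ codeOf x Y × Comp Y r v
    small v a with em₀ {v ∈ Y}
    ... | yes p = inj₁ p
    ... | no p with representative Y p
    ... | r , r∈ , c@(_ , path) = inj₂ (r , keep⁺ r∈ (Reach-closed (small-closed {x} s m→) (Reach-sym Off-sym path) a) , c)
    large : ∀ v → ¬ (Σ V λ r → r ∈ codeOf x Y × Comp Y r v) → proj₂ x v
    large v none with proj₁ s v
    ... | inj₂ b = b
    ... | inj₁ a with small v a
    ... | inj₁ v∈ = proj₂ (proj₂ (m v) v∈)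
    ... | inj₂ p = ⊥-elim (none p)
    large′ : ∀ v → proj₂ x v → v ∈ Y ⊎ ¬ (Σ V λ r → r ∈ codeOf x Y × Comp Y r v)
    large′ v b with em₀ {v ∈ Y}
    ... | yes p = inj₁ p
    ... | no p = inj₂ (λ c → p (m→ v (back v c , b)))

  sublists : ∀ {a} {X : Set a} → List X → List (List X)
  sublists [] = [] ∷ []
  sublists (x ∷ l) = sublists l ++ map (x ∷_) (sublists l)

  keep∈sublists : ∀ {X : Set} (P : X → Set) l → keep P l ∈ sublists l
  keep∈sublists P [] = here refl
  keep∈sublists P (x ∷ l) with em₀ {P x}
  ... | yes _ = ∈-++⁺ʳ (sublists l) (∈-map⁺ (x ∷_) (keep∈sublists P l))
  ... | no _ = ∈-++⁺ˡ (keep∈sublists P l)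

  sepsWith : List V → List Sep
  sepsWith Y = map (decode Y) (sublists (reps Y))

  sepsWith-complete : ∀ {x Y} → IsSepar x → (∀ v → mid x v ⇔ (v ∈ Y)) → Any (x ≈_) (sepsWith Y)
  sepsWith-complete {x} {Y} s m = lose (∈-map⁺ (decode Y) (keep∈sublists (proj₁ x) (reps Y))) (decode-codeOf {x} s m)

  verts : ∀ {R : V → V → Set} {u v} → Reach R u v → List V
  verts {u = u} here = u ∷ []
  verts {u = u} (step _ p) = u ∷ verts p

  verts-avoid : ∀ {S : Subset V} {u v} (p : Reach (Avoid G S) u v) → ¬ S u → ∀ {w} → w ∈ verts p → ¬ S w
  verts-avoid here ¬s (here refl) = ¬s
  verts-avoid (step _ p) ¬s (here refl) = ¬s
  verts-avoid (step (_ , _ , ¬s) p) _ (there w∈) = verts-avoid p ¬s w∈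

  reroute : ∀ {S S′ : Subset V} {u v} (p : Reach (Avoid G S) u v) → (∀ {w} → w ∈ verts p → ¬ S′ w) → Reach (Avoid G S′) u v
  reroute here _ = here
  reroute (step (e , _) p) h = step (e , h (here refl) , h (there (head p))) (reroute p (h ∘ there))
    where
    head : ∀ {R : V → V → Set} {u v} (p : Reach R u v) → u ∈ verts p
    head here = here refl
    head (step _ _) = here refl

  record MinimalSeparator (Y : List V) (y z : V) : Set where
    field
      y∉        : y ∉ Y
      separates : ¬ Reach (Off Y) y z
      minimalʸ  : ∀ p → p ∈ Y → Reach (Avoid G (λ v → v ∈ Y × v ≢ p)) y z

  -- A bounded search tree: a y-z separator extending Z contains a vertex of every y-z walk off Z,
  -- so it suffices to branch over the vertices of one such walk.
  candidates : V → V → ℕ → List V → List (List V)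
  candidates y z zero Z = Z ∷ []
  candidates y z (suc d) Z with em₀ {Reach (Off Z) y z}
  ... | yes p = Z ∷ concatMap (λ q → candidates y z d (q ∷ Z)) (verts p)
  ... | no _  = Z ∷ []

  candidates-head : ∀ y z d Z → Z ∈ candidates y z d Z
  candidates-head y z zero Z = here refl
  candidates-head y z (suc d) Z with em₀ {Reach (Off Z) y z}
  ... | yes _ = here refl
  ... | no _ = here refl

  -- While Z is a proper part of Y, minimality of Y provides a walk off Z, so the search does not
  -- stop there; the walk it branches over meets Y because Y separates.
  candidates-complete : ∀ {Y y z} → MinimalSeparator Y y z → ∀ d Z → Unique Z → (∀ v → v ∈ Z → v ∈ Y) →
    length Y ≤ length Z + d → Σ (List V) λ Y′ → Y′ ∈ candidates y z d Z × (∀ v → (v ∈ Y) ⇔ (v ∈ Y′))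
  candidates-complete {Y} {y} {z} ms d Z uZ Z⊆ len with em₀ {Σ V λ p → p ∈ Y × p ∉ Z}
  ... | no none = Z , candidates-head y z d Z , λ v → (λ v∈ → byContradiction λ v∉ → none (v , v∈ , v∉)) , Z⊆ v
  ... | yes (p , p∈ , p∉) = go d len
    where
    open MinimalSeparator ms
    bigger : suc (length Z) ≤ length Y
    bigger = length-≤-of-⊆ (Unique-∷ p∉ uZ) (λ { (here refl) → p∈ ; (there q) → Z⊆ _ q })
    path : Reach (Off Z) y z
    path = reroute (minimalʸ p p∈) λ w∈ w∈Z →
      verts-avoid (minimalʸ p p∈) (λ q → y∉ (proj₁ q)) w∈ (Z⊆ _ w∈Z , λ { refl → p∉ w∈Z })
    go : ∀ d → length Y ≤ length Z + d → Σ (List V) λ Y′ → Y′ ∈ candidates y z d Z × (∀ v → (v ∈ Y) ⇔ (v ∈ Y′))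
    go zero len = ⊥-elim (<⇒≱ bigger (≤-trans len (≤-reflexive (+-identityʳ _))))
    go (suc d) len with em₀ {Reach (Off Z) y z}
    ... | no none = ⊥-elim (none path)
    ... | yes p with em₀ {Σ V λ q → q ∈ verts p × q ∈ Y}
    ... | no miss = ⊥-elim (separates (reroute p λ w∈ w∈Y → miss (_ , w∈ , w∈Y)))
    ... | yes (q , q∈ , q∈Y) with candidates-complete ms d (q ∷ Z) (Unique-∷ (verts-avoid p (λ y∈ → y∉ (Z⊆ _ y∈)) q∈) uZ)
             (λ { _ (here refl) → q∈Y ; v (there v∈) → Z⊆ v v∈ }) (≤-trans len (≤-reflexive (+-suc _ d)))
    ... | Y′ , Y′∈ , iff = Y′ , there (∈-concatMap⁺ _ (Any.map (λ { refl → Y′∈ }) q∈)) , iff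

  Tight : List V → V → Set
  Tight Y r = ∀ p → p ∈ Y → Σ V λ w → E p w × Comp Y r w

  -- Q points to one component of G - Y. It lies on the large side of t, and efficiency makes every
  -- vertex of Y adjacent to it. With `t ᵒ` in place of t this gives a second such component, on the
  -- small side.
  module TightComponent {Q Q′ t n} (eff : Efficient Q Q′ t n) (Y : List V) (Y⇔ : ∀ v → mid t v ⇔ (v ∈ Y))
    (len : length Y ≤ n) where

    private
      compSep : V → Sep
      compSep r = (λ v → v ∈ Y ⊎ Comp Y r v) , (λ v → v ∈ Y ⊎ ¬ Comp Y r v)

      compSep-separ : ∀ r → IsSepar (compSep r)
      compSep-separ r = mkSep cover edge
        where
        cover : ∀ v → (v ∈ Y ⊎ Comp Y r v) ⊎ (v ∈ Y ⊎ ¬ Comp Y r v)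
        cover v with em₀ {Comp Y r v}
        ... | yes c = inj₁ (inj₂ c)
        ... | no ¬c = inj₂ (inj₂ ¬c)
        edge : ∀ {u v} → E u v → ¬ (v ∈ Y ⊎ Comp Y r v) → u ∈ Y ⊎ ¬ Comp Y r u
        edge e ¬k = inj₂ λ c → ¬k (inj₂ (Comp-step c e (¬k ∘ inj₁)))

      mid-compSep : ∀ r v → mid (compSep r) v → v ∈ Y
      mid-compSep r v (inj₁ y , _) = y
      mid-compSep r v (inj₂ _ , inj₁ y) = y
      mid-compSep r v (inj₂ c , inj₂ ¬c) = ⊥-elim (¬c c)

      order-Y : ∀ {x} → (∀ v → mid x v → v ∈ Y) → Order≤ x n
      order-Y m = order≤ (Y , len , m)

      Found : V → Set₁
      Found r = compSep r ᵒ ∈ₜ Q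

      -- If Q points to no component, it points away from the union of all of them.
      absorb : ∀ l → (Σ V Found) ⊎ (Σ Sep λ x → x ∈ₜ Q × t ⊑ x × (∀ v → mid x v → v ∈ Y) × (∀ r → r ∈ l → compSep r ⊑ x))
      absorb [] = inj₂ (t , in₁ eff , ⊑-refl , (λ v → proj₁ (Y⇔ v)) , λ _ ())
      absorb (r ∷ l) with absorb l
      ... | inj₁ found = inj₁ found
      ... | inj₂ (x , x∈ , t⊑x , m , all) with orient {Q} (compSep-separ r) (order-Y {compSep r} (mid-compSep r)) (orients₁ eff)
      ... | inj₂ found = inj₁ (r , found)
      ... | inj₁ c∈ = inj₂ (x ∨ compSep r , towards x∈ c∈ (order-Y {x ∨ compSep r} m′) (orients₁ eff) ,
            ⊑-trans t⊑x ∨-upperˡ , m′ , λ { _ (here refl) → ∨-upperʳ ; r′ (there p) → ⊑-trans (all r′ p) ∨-upperˡ })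
        where
        m′ : ∀ v → mid (x ∨ compSep r) v → v ∈ Y
        m′ v (inj₁ a , b , _) = m v (a , b)
        m′ v (inj₂ c , _ , d) = mid-compSep r v (c , d)

      found : Σ V Found
      found with absorb (reps Y)
      ... | inj₁ f = f
      ... | inj₂ (x , x∈ , t⊑x , m , all) = ⊥-elim (not-everything x∈ everything)
        where
        everything : ∀ v → proj₁ x v
        everything v with em₀ {v ∈ Y}
        ... | yes v∈ = small⊆ t⊑x v (proj₁ (proj₂ (Y⇔ v) v∈))
        ... | no v∉ with representative Y v∉
        ... | r , r∈ , c = small⊆ (all r r∈) v (inj₂ c)

    rep : V
    rep = proj₁ found

    private
      rep∉ : rep ∉ Y
      rep∉ r∈ = not-everything (proj₂ found) λ v → inj₂ λ c → proj₁ c r∈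

      not-small : ¬ proj₁ t rep
      not-small a = no-cover (in₁ eff) (proj₂ found) (proj₂ found)
        ( (λ v → [ (λ k → inj₁ (in-small k)) , (λ k → inj₂ (inj₁ k)) ]′ (proj₁ (compSep-separ rep) v))
        , (λ u v e → [ (λ { (k , k′) → inj₁ (in-small k , in-small k′) }) , (λ k → inj₂ (inj₁ k)) ]′ (edge-side (compSep-separ rep) e)))
        where
        in-small : ∀ {v} → v ∈ Y ⊎ Comp Y rep v → proj₁ t v
        in-small {v} (inj₁ y) = proj₁ (proj₂ (Y⇔ v) y)
        in-small (inj₂ (_ , p)) = Reach-closed (small-closed {t} (separ eff) (λ v → proj₁ (Y⇔ v))) p a

    comp-large : ∀ {v} → Comp Y rep v → proj₂ t v
    comp-large (_ , p) = Reach-closed (large-closed {t} (separ eff) (λ v → proj₁ (Y⇔ v))) p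
      ([ (λ a → ⊥-elim (not-small a)) , id ]′ (proj₁ (separ eff) rep))

    -- If p had no neighbour in K, it could be dropped from the separator on the side of K. The
    -- resulting `k′` has order below n and Q′ contains `k′ ᵒ`, so by efficiency Q does too. But Q
    -- also contains a separation with small side Y ∪ (V ∖ K), and these two small sides cover G.
    tight : Tight Y rep
    tight p p∈ = byContradiction λ none → contradiction none
      where
      K = Comp Y rep
      k′ : Sep
      k′ = (λ v → v ∈ Y ⊎ ¬ K v) , (λ v → (v ∈ Y × v ≢ p) ⊎ K v)
      contradiction : ¬ (Σ V λ w → E p w × K w) → ⊥
      contradiction none = go (orient {Q} separ′ ord (Orients-mono (<⇒≤ shorter) (orients₁ eff)))
        where
        cover : ∀ v → (v ∈ Y ⊎ ¬ K v) ⊎ ((v ∈ Y × v ≢ p) ⊎ K v)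
        cover v with em₀ {K v}
        ... | yes k = inj₂ (inj₂ k)
        ... | no ¬k = inj₁ (inj₂ ¬k)
        edge : ∀ {u v} → E u v → ¬ (v ∈ Y ⊎ ¬ K v) → (u ∈ Y × u ≢ p) ⊎ K u
        edge {u} {v} e ¬n with em₀ {u ∈ Y}
        ... | yes u∈ = inj₁ (u∈ , λ { refl → none (v , e , byContradiction (¬n ∘ inj₂)) })
        ... | no u∉ = inj₂ (Comp-step (byContradiction (¬n ∘ inj₂)) (E-sym e) u∉)
        separ′ : IsSepar k′
        separ′ = mkSep cover edge
        Y⁻ = keep (_≢ p) Y
        shorter : length Y⁻ < n
        shorter = ≤-trans (keep-length-< Y p∈ (λ ≢ → ≢ refl)) len
        ord : Order≤ k′ (length Y⁻)
        ord = order≤ (Y⁻ , ≤-refl , λ { v (_ , inj₁ (v∈ , ≢)) → keep⁺ v∈ ≢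
          ; v (inj₁ v∈ , inj₂ k) → ⊥-elim (Comp-avoids k v∈) ; v (inj₂ ¬k , inj₂ k) → ⊥-elim (¬k k) })
        k′ᵒ∈Q′ : k′ ᵒ ∈ₜ Q′
        k′ᵒ∈Q′ = down (in₂ eff) (IsSep-flip separ′) (Order≤-flip ord) (Orients-mono (<⇒≤ shorter) (orients₂ eff))
          (mk⊑ (λ v → [ (λ { (v∈ , _) → proj₂ (proj₂ (Y⇔ v) v∈) }) , comp-large ]′) out)
          where
          out : ∀ v → proj₁ t v → v ∈ Y ⊎ ¬ K v
          out v a with em₀ {K v}
          ... | yes k = inj₁ (proj₁ (Y⇔ v) (a , comp-large k))
          ... | no ¬k = inj₂ ¬k
        go : k′ ∈ₜ Q ⊎ k′ ᵒ ∈ₜ Q → ⊥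
        go (inj₁ k∈) = <⇒≱ shorter (minimal eff k′ _ k∈ k′ᵒ∈Q′ ord)
        go (inj₂ k∈) = no-cover (proj₂ found) k∈ k∈
          ( (λ v → [ inj₁ , (λ b → inj₂ (inj₁ b)) ]′ (proj₁ separ′ v))
          , (λ u v e → [ inj₁ , (λ b → inj₂ (inj₁ b)) ]′ (edge-side separ′ e)))

    rep∈Comp : Comp Y rep rep
    rep∈Comp = rep∉ , here

  module _ {P P′ s m} (eff : Efficient P P′ s m) (X : List V) (X⇔ : ∀ v → mid s v ⇔ (v ∈ X)) (lenX : length X ≤ m) where

    -- Names refer to s = (A , B) and t = (C , D) with separators X and Y.
    private
      -- No edge leaves B ∩ C, because X avoids C and Y avoids B. As G is connected and B is not
      -- everything, B ∩ C is empty.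
      no-boundary : ∀ {t} → IsSepar t → (∀ v → mid t v → ¬ proj₂ s v) → (∀ v → v ∈ X → ¬ proj₁ t v) → t ⊑ s
      no-boundary {t} st Y∩B X∩C = mk⊑ (λ v c → [ id , (λ b → ⊥-elim (empty v (b , c))) ]′ (proj₁ (separ eff) v))
        (λ v b → [ (λ c → ⊥-elim (empty v (b , c))) , id ]′ (proj₁ st v))
        where
        closed : ∀ {v u} → E v u → proj₂ s v × proj₁ t v → proj₂ s u × proj₁ t u
        closed {v} {u} e (b , c) = sep-edge (separ eff) (E-sym e) (λ a → X∩C v (proj₁ (X⇔ v) (a , b)) c) ,
          sep-edge′ st (E-sym e) (λ d → Y∩B v (c , d) b)
        empty : ∀ v → ¬ (proj₂ s v × proj₁ t v)
        empty v h = not-everything (in₂ eff) λ u → proj₁ (Reach-closed closed (proj₂ conn v u) h)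

      -- If X met both C and D, it would do so off Y. Two corners would then have separators X ∩ C
      -- and X ∩ D smaller than X, which efficiency of s forbids. Otherwise `no-boundary` applies to
      -- t or `t ᵒ`.
      one-sided : ∀ {t} → IsSepar t → (∀ v → v ∈ X → ¬ mid t v) → (∀ v → mid t v → ¬ proj₂ s v) → Nested s t
      one-sided {t} st X∩Y Y∩B with em₀ {Σ V λ v → v ∈ X × proj₁ t v} | em₀ {Σ V λ v → v ∈ X × proj₂ t v}
      ... | no X∩C | _ = ge (no-boundary st Y∩B (λ v v∈ c → X∩C (v , v∈ , c)))
      ... | yes _ | no X∩D = Nested-sym (op-le (no-boundary (IsSep-flip st) (λ { v (d , c) → Y∩B v (c , d) }) (λ v v∈ d → X∩D (v , v∈ , d))))
      ... | yes (u , u∈ , c) | yes (v , v∈ , d) = ⊥-elim (no-small-corners (Efficient-flip eff) st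
            (order≤ (keep (proj₁ t) X , ≤-refl , λ
              { w (inj₁ a , b , c) → keep⁺ (proj₁ (X⇔ w) (a , b)) c ; w (inj₂ d , b , c) → ⊥-elim (Y∩B w (c , d) b) }))
            (≤-trans (keep-length-< X v∈ (λ c → X∩Y v v∈ (c , d))) lenX)
            (order≤ (keep (proj₂ t) X , ≤-refl , λ
              { w (inj₁ a , b , d) → keep⁺ (proj₁ (X⇔ w) (a , b)) d ; w (inj₂ c , b , d) → ⊥-elim (Y∩B w (c , d) b) }))
            (≤-trans (keep-length-< X u∈ (λ d → X∩Y u u∈ (c , d))) lenX))

    -- The component of r avoids X and starts in A ∖ B, so it stays there. By tightness each vertex
    -- of Y has a neighbour in A ∖ B and hence lies in A; being off X, it is not in B.
    avoiding-B : ∀ {t Y r} → IsSepar t → (∀ v → mid t v → v ∈ Y) → (∀ v → v ∈ X → v ∉ Y) →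
      Tight Y r → r ∉ Y → (∀ v → v ∈ X → ¬ Comp Y r v) → ¬ proj₂ s r → Nested s t
    avoiding-B {t} {Y} {r} st m→ X∩Y tight r∉ X∩K r∉B = one-sided st (λ v v∈ → X∩Y v v∈ ∘ m→ v) (λ v y → Y∩B v (m→ v y))
      where
      closed : ∀ {u v} → Off Y u v → ¬ proj₂ s u × Comp Y r u → ¬ proj₂ s v × Comp Y r v
      closed {u} {v} (e , _ , v∉) (¬b , c) = (λ b → X∩K v (proj₁ (X⇔ v) (sep-edge′ (separ eff) (E-sym e) ¬b , b)) c′) , c′
        where c′ = Comp-step c e v∉
      Y∩B : ∀ v → v ∈ Y → ¬ proj₂ s v
      Y∩B v v∈ b with tight v v∈
      ... | w , e , (_ , p) = X∩Y v (proj₁ (X⇔ v)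
              (sep-edge′ (separ eff) e (proj₁ (Reach-closed closed p (r∉B , r∉ , here))) , b)) v∈

  avoiding : ∀ {P P′ s m t Y r} → Efficient P P′ s m → (X : List V) → (∀ v → mid s v ⇔ (v ∈ X)) → length X ≤ m →
    IsSepar t → (∀ v → mid t v ⇔ (v ∈ Y)) → (∀ v → v ∈ X → v ∉ Y) →
    Tight Y r → r ∉ Y → (∀ v → v ∈ X → ¬ Comp Y r v) → Nested s t
  avoiding {s = s} {r = r} eff X X⇔ lenX st Y⇔ X∩Y tight r∉ X∩K with em₀ {proj₂ s r}
  ... | no ¬b = avoiding-B eff X X⇔ lenX st (λ v → proj₁ (Y⇔ v)) X∩Y tight r∉ X∩K ¬b
  ... | yes b = Nested-flipˡ (avoiding-B (Efficient-flip eff) X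
        (λ v → (λ { (b , a) → proj₁ (X⇔ v) (a , b) }) , (λ v∈ → let (a , b) = proj₂ (X⇔ v) v∈ in b , a)) lenX
        st (λ v → proj₁ (Y⇔ v)) X∩Y tight r∉ X∩K
        (λ a → X∩K r (proj₁ (X⇔ r) (a , b)) (r∉ , here)))

  𝓔 : ℕ → Sep → Set₁
  𝓔 k x = Σ Tangle λ P → Σ Tangle λ P′ → Efficient P P′ x k

  module _ {P P′ s m} (eff : Efficient P P′ s m) where
    private
      X-data = CardLe⇒HasCard (card (order eff))
      X : List V
      X = proj₁ (proj₁ (proj₂ X-data))
      X⇔ : ∀ v → mid s v ⇔ (v ∈ X)
      X⇔ = proj₂ (proj₂ (proj₂ (proj₁ (proj₂ X-data))))
      lenX : length X ≤ m
      lenX = ≤-trans (≤-reflexive (proj₁ (proj₂ (proj₁ (proj₂ X-data))))) (proj₂ (proj₂ X-data))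
      near : List V
      near = X ++ nbrs X

    -- If q lies in both separators, its neighbours in the two tight components serve as y and z. If
    -- X and Y are disjoint, X meets both tight components, since otherwise `avoiding` makes s and t
    -- nested.
    crossing-separator : ∀ {Q Q′ t n} → Efficient Q Q′ t n → Cross t s →
      Σ (List V) λ Y → (∀ v → mid t v ⇔ (v ∈ Y)) × length Y ≤ n ×
      (Σ V λ y → Σ V λ z → y ∈ near × z ∈ near × MinimalSeparator Y y z)
    crossing-separator {Q} {Q′} {t} {n} et cross with CardLe⇒HasCard (card (order et))
    ... | k , (Y , refl , _ , Y⇔) , len = Y , Y⇔ , len , ends
      where
      Y⇔′ : ∀ v → mid (t ᵒ) v ⇔ (v ∈ Y)
      Y⇔′ v = (λ { (d , c) → proj₁ (Y⇔ v) (c , d) }) , (λ v∈ → let (c , d) = proj₂ (Y⇔ v) v∈ in d , c)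
      module L = TightComponent et Y Y⇔ len
      module S = TightComponent (Efficient-flip et) Y Y⇔′ len
      minimal-separator : ∀ {y z} → Comp Y L.rep y → Comp Y S.rep z → MinimalSeparator Y y z
      minimal-separator {y} {z} cy@(_ , py) cz@(_ , pz) = record
        { y∉ = Comp-avoids cy
        ; separates = λ p → Comp-avoids cz (proj₁ (Y⇔ z)
            (S.comp-large cz , Reach-closed (large-closed {t} (separ et) (λ v → proj₁ (Y⇔ v))) p (L.comp-large cy)))
        ; minimalʸ = through }
        where
        loosen : ∀ {p u v} → Reach (Off Y) u v → Reach (Avoid G (λ v → v ∈ Y × v ≢ p)) u v
        loosen here = here
        loosen (step (e , a , b) p) = step (e , a ∘ proj₁ , b ∘ proj₁) (loosen p)
        through : ∀ p → p ∈ Y → Reach (Avoid G (λ v → v ∈ Y × v ≢ p)) y z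
        through p p∈ with L.tight p p∈ | S.tight p p∈
        ... | w , e , cw@(_ , pw) | w′ , e′ , cw′@(_ , pw′) =
          Reach-trans (loosen (Reach-trans (Reach-sym Off-sym py) pw))
            (step (E-sym e , Comp-avoids cw ∘ proj₁ , λ q → proj₂ q refl)
            (step (e′ , (λ q → proj₂ q refl) , Comp-avoids cw′ ∘ proj₁)
              (loosen (Reach-trans (Reach-sym Off-sym pw′) pz))))
      ends : Σ V λ y → Σ V λ z → y ∈ near × z ∈ near × MinimalSeparator Y y z
      ends with em₀ {Σ V λ q → q ∈ X × q ∈ Y}
      ... | yes (q , q∈X , q∈Y) with L.tight q q∈Y | S.tight q q∈Y
      ... | w , e , cw | w′ , e′ , cw′ =
        w , w′ , ∈-++⁺ʳ X (nbrs⁺ q∈X e) , ∈-++⁺ʳ X (nbrs⁺ q∈X e′) , minimal-separator cw cw′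
      ends | no X∩Y with em₀ {Σ V λ v → v ∈ X × Comp Y L.rep v} | em₀ {Σ V λ v → v ∈ X × Comp Y S.rep v}
      ... | yes (y , y∈ , cy) | yes (z , z∈ , cz) = y , z , ∈-++⁺ˡ y∈ , ∈-++⁺ˡ z∈ , minimal-separator cy cz
      ... | no X∩K | _ = ⊥-elim (cross (Nested-sym (avoiding eff X X⇔ lenX (separ et) Y⇔ (λ v v∈ v∈Y → X∩Y (v , v∈ , v∈Y))
              L.tight (proj₁ L.rep∈Comp) (λ v v∈ c → X∩K (v , v∈ , c)))))
      ... | yes _ | no X∩K = ⊥-elim (cross (Nested-flipˡ (Nested-sym (avoiding eff X X⇔ lenX (IsSep-flip (separ et)) Y⇔′
              (λ v v∈ v∈Y → X∩Y (v , v∈ , v∈Y)) S.tight (proj₁ S.rep∈Comp) (λ v v∈ c → X∩K (v , v∈ , c))))))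

    opaque
      -- All orders up to k are covered at once: order k itself for the crossing numbers, the
      -- smaller ones for compatibility with lower layers.
      finite-crossing : ∀ k → Σ (List Sep) λ l → Covers _≈_ (λ z → Σ ℕ λ j → j ≤ k × 𝓔 j z) (λ z → Cross z s) l
      finite-crossing k = concatMap (λ y → concatMap (λ z → concatMap sepsWith (candidates y z k [])) near) near , covers
        where
        covers : Covers _≈_ (λ z → Σ ℕ λ j → j ≤ k × 𝓔 j z) (λ z → Cross z s)
          (concatMap (λ y → concatMap (λ z → concatMap sepsWith (candidates y z k [])) near) near)
        covers t (j , j≤k , Q , Q′ , et) cross with crossing-separator et cross
        ... | Y , Y⇔ , len , y , z , y∈ , z∈ , ms with candidates-complete ms k [] [] (λ _ ()) (≤-trans len j≤k)
        ... | Y′ , Y′∈ , iff with find (sepsWith-complete {t} {Y′} (separ et)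
                (λ v → (λ p → proj₁ (iff v) (proj₁ (Y⇔ v) p)) , (λ p → proj₂ (Y⇔ v) (proj₂ (iff v) p))))
        ... | e , e∈ , eq = lose (inner y∈ (inner z∈ (inner Y′∈ e∈))) eq
          where
          inner : ∀ {a} {A : Set a} {b} {B : Set b} {f : A → List B} {x l} {e : B} → x ∈ l → e ∈ f x → e ∈ concatMap f l
          inner {f = f} x∈ e∈ = ∈-concatMap⁺ f (Any.map (λ { refl → e∈ }) x∈)

-- The nested set of chosen separations

module NestedSet (em : ExcludedMiddle (lsuc 0ℓ)) (G : Graph) (conn : Connected G) (lf : LocallyFinite G) where
  open Classical em
  open Tangles em G
  open FiniteCrossing em G conn lf

  CrossingAtMost : ℕ → Sep → ℕ → Set₁
  CrossingAtMost k x m = Σ (List Sep) λ l → length l ≤ m × Covers _≈_ (𝓔 k) (λ z → Cross z x) l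

  crossing-flip : ∀ {k x m} → CrossingAtMost k x m → CrossingAtMost k (x ᵒ) m
  crossing-flip (l , len , cov) = l , len , λ z e c → cov z e (Cross-flipʳ c)

  crossing-finite : ∀ {P P′ x k} → Efficient P P′ x k → Σ ℕ (CrossingAtMost k x)
  crossing-finite {k = k} eff with finite-crossing eff k
  ... | l , cov = length l , l , ≤-refl , λ z e → cov z (k , ≤-refl , e)

  -- Submodularity of crossing numbers, by the fish lemma and `opposite-corners`. It is strict
  -- because y crosses x but is nested with both corners.
  crossing-sum : ∀ {k x y a b} → Cross x y → 𝓔 k y → CrossingAtMost k x a → CrossingAtMost k y b →
    Σ ℕ λ p → Σ ℕ λ q → CrossingAtMost k (x ∨ y) p × CrossingAtMost k (x ᵒ ∨ y ᵒ) q × p + q < a + b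
  crossing-sum {k} {x} {y} cross ey (lx , lenx , covx) (ly , leny , covy) =
    length U.lC , length U.lC′ , (U.lC , ≤-refl , U.covC) , (U.lC′ , ≤-refl , U.covC′) ,
    ≤-trans (U.total-< (Any.map untouched (covx y ey (cross ∘ Nested-sym)))) (+-mono-≤ lenx leny)
    where
    c = ∨-corner cross
    c′ = corner-flip₁ (corner-flip₂ (∨-corner (Cross-flipˡ (Cross-flipʳ cross))))
    resp : ∀ {c z w} → z ≈ w → Cross z c → Cross w c
    resp eq cr n = cr (Nested-respˡ (≈-sym eq) n)
    from : ∀ {c z} → Corner x y c → Cross z c → Cross z x ⊎ Cross z y
    from {z = z} cor cr with em₀ {Nested z x} | em₀ {Nested z y}
    ... | no n | _ = inj₁ n
    ... | yes _ | no n = inj₂ n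
    ... | yes p | yes q = ⊥-elim (cr (Corner.inherit cor p q))
    module U = Uncross _≈_ (𝓔 k) (λ z → Cross z x) (λ z → Cross z y) (λ z → Cross z (x ∨ y)) (λ z → Cross z (x ᵒ ∨ y ᵒ))
      resp resp (λ eq → resp (≈-sym eq)) (λ eq → resp (≈-sym eq)) (λ z _ → from c) (λ z _ → from c′)
      (λ z cr cr′ n → [ cr , cr′ ]′ (opposite-corners n))
      (λ z cr cr′ n → [ (λ p → cr (Nested-sym (Nested-respˡ (∨-swap , ∨-swap) (Nested-sym p)))) ,
                        (λ p → cr′ (Nested-sym (Nested-respˡ (∨-swap , ∨-swap) (Nested-sym p)))) ]′ (opposite-corners n))
      lx ly covx covy
    untouched : ∀ {z} → y ≈ z → ¬ Cross z (x ∨ y) × ¬ Cross z (x ᵒ ∨ y ᵒ)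
    untouched eq = (λ cr → cr (Nested-respˡ eq (Corner.nested₂ c))) , (λ cr → cr (Nested-respˡ eq (Corner.nested₂ c′)))

  -- Every minimiser for every pair of tangles qualifies, which makes the layer invariant under
  -- automorphisms. `fewest` compares upper bounds, as crossing numbers are accessible through
  -- covering lists only.
  record Layer (k : ℕ) (B : Sep → Set₁) (x : Sep) : Set₁ where
    field
      P P′       : Tangle
      efficient  : Efficient P P′ x k
      compatible : ∀ z → B z → Nested z x
      fewest     : ∀ y → Efficient P P′ y k → (∀ z → B z → Nested z y) → ∀ m → CrossingAtMost k y m → CrossingAtMost k x m

  Lower : ℕ → Sep → Set₁
  Lower zero x = Lift (lsuc 0ℓ) ⊥
  Lower (suc k) x = Lower k x ⊎ Layer k (Lower k) x

  module _ {k : ℕ} {B : Sep → Set₁} {x y : Sep} (lx : Layer k B x) (ly : Layer k B y) (cross : Cross x y) where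
    private
      open Layer lx using (P; P′) renaming (efficient to eP)
      open Layer ly using () renaming (P to Q; P′ to Q′; efficient to eQ)

      leastX = least (CrossingAtMost k x) (crossing-finite eP)
      leastY = least (CrossingAtMost k y) (crossing-finite eQ)
      a = proj₁ leastX
      b = proj₁ leastY

      A B′ : Sep → Set₁
      A c = Efficient P P′ c k ⊎ Efficient P′ P c k
      B′ c = Efficient Q Q′ c k ⊎ Efficient Q′ Q c k

      compatible-corner : ∀ {c} → Corner x y c → ∀ z → B z → Nested z c
      compatible-corner cor z bz = Corner.inherit cor (Layer.compatible lx z bz) (Layer.compatible ly z bz)

      a≤ : ∀ {c m} → A c → Corner x y c → CrossingAtMost k c m → a ≤ m
      a≤ {c} {m} (inj₁ e) cor cr = proj₂ (proj₂ leastX) m (Layer.fewest lx c e (compatible-corner cor) m cr)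
      a≤ {c} {m} (inj₂ e) cor cr = proj₂ (proj₂ leastX) m
        (Layer.fewest lx (c ᵒ) (Efficient-flip e) (compatible-corner (corner-flip₃ cor)) m (crossing-flip cr))

      b≤ : ∀ {c m} → B′ c → Corner x y c → CrossingAtMost k c m → b ≤ m
      b≤ {c} {m} (inj₁ e) cor cr = proj₂ (proj₂ leastY) m (Layer.fewest ly c e (compatible-corner cor) m cr)
      b≤ {c} {m} (inj₂ e) cor cr = proj₂ (proj₂ leastY) m
        (Layer.fewest ly (c ᵒ) (Efficient-flip e) (compatible-corner (corner-flip₃ cor)) m (crossing-flip cr))

      -- s and t are x and y in some orientation, so the inequalities below are proved for one pair
      -- of opposite corners and hold for the other as well.
      record Orientation (s t : Sep) : Set₁ where
        field
          crossing : Cross s t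
          t-eff    : 𝓔 k t
          cr-s     : CrossingAtMost k s a
          cr-t     : CrossingAtMost k t b
          order-s  : Order≤ s k
          order-t  : Order≤ t k
          corner   : ∀ {c} → Corner s t c → Corner x y c
        corners : Corner x y (s ∨ t) × Corner x y (s ᵒ ∨ t ᵒ)
        corners = corner (∨-corner crossing) , corner (corner-flip₁ (corner-flip₂ (∨-corner (Cross-flipˡ (Cross-flipʳ crossing)))))
      open Orientation

      o⁺⁺ : Orientation x y
      o⁺⁺ = record { crossing = cross ; t-eff = Q , Q′ , eQ ; cr-s = proj₁ (proj₂ leastX) ; cr-t = proj₁ (proj₂ leastY)
        ; order-s = order eP ; order-t = order eQ ; corner = id }

      flipˢ : ∀ {s t} → Orientation s t → Orientation (s ᵒ) t
      flipˢ o = record { crossing = Cross-flipˡ (crossing o) ; t-eff = t-eff o ; cr-s = crossing-flip (cr-s o) ; cr-t = cr-t o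
        ; order-s = Order≤-flip (order-s o) ; order-t = order-t o ; corner = λ c → corner o (corner-flip₁ c) }

      flipᵗ : ∀ {s t} → Orientation s t → Orientation s (t ᵒ)
      flipᵗ o = record { crossing = Cross-flipʳ (crossing o)
        ; t-eff = let (R , R′ , e) = t-eff o in R′ , R , Efficient-flip e
        ; cr-s = cr-s o ; cr-t = crossing-flip (cr-t o)
        ; order-s = order-s o ; order-t = Order≤-flip (order-t o) ; corner = λ c → corner o (corner-flip₂ c) }

      -- By `fewest`, a corner efficient for P and P′ has at least a crossings and one efficient for
      -- Q and Q′ at least b, whereas opposite corners together have fewer than a + b.
      clash : ∀ {s t} → Orientation s t → A (s ∨ t) → B′ (s ᵒ ∨ t ᵒ) → ⊥
      clash o p q with crossing-sum (crossing o) (t-eff o) (cr-s o) (cr-t o)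
      ... | i , j , ci , cj , lt = <⇒≱ lt (+-mono-≤ (a≤ p (proj₁ (corners o)) ci) (b≤ q (proj₂ (corners o)) cj))

      -- If both opposite corners serve P and P′, then 2a < a + b. When the other two serve Q and
      -- Q′, also 2b < a + b, which is absurd.
      a<b : ∀ {s t} → Orientation s t → A (s ∨ t) → A (s ᵒ ∨ t ᵒ) → a < b
      a<b o p q with crossing-sum (crossing o) (t-eff o) (cr-s o) (cr-t o)
      ... | i , j , ci , cj , lt = +-cancelˡ-< a a b (≤-trans (s≤s (+-mono-≤ (a≤ p (proj₁ (corners o)) ci) (a≤ q (proj₂ (corners o)) cj))) lt)

      b<a : ∀ {s t} → Orientation s t → B′ (s ∨ t) → B′ (s ᵒ ∨ t ᵒ) → b < a
      b<a o p q with crossing-sum (crossing o) (t-eff o) (cr-s o) (cr-t o)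
      ... | i , j , ci , cj , lt = +-cancelʳ-< b b a (≤-trans (s≤s (+-mono-≤ (b≤ p (proj₁ (corners o)) ci) (b≤ q (proj₂ (corners o)) cj))) lt)

      o⁺⁻ : Orientation x (y ᵒ)
      o⁺⁻ = flipᵗ o⁺⁺
      o⁻⁺ : Orientation (x ᵒ) y
      o⁻⁺ = flipˢ o⁺⁺
      o⁻⁻ : Orientation (x ᵒ) (y ᵒ)
      o⁻⁻ = flipˢ o⁺⁻

    -- The pairs P, P′ and Q, Q′ each occupy two quadrants of x and y.  Either an end of one pair
    -- lies opposite to an end of the other, or each pair occupies two opposite quadrants.
    layer-no-crossing : ⊥
    layer-no-crossing = cases
      (orient {P} (separ eQ) (order eQ) (orients₁ eP)) (orient {P′} (separ eQ) (order eQ) (orients₂ eP))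
      (orient {Q} (separ eP) (order eP) (orients₁ eQ)) (orient {Q′} (separ eP) (order eP) (orients₂ eQ))
      where
      ox = order eP
      oy = order eQ
      ox′ = Order≤-flip ox
      oy′ = Order≤-flip oy
      eP′ = Efficient-flip eP
      eQ′ = Efficient-flip eQ
      P′+ : y ∈ₜ P′ → x ∈ₜ Q′ → ⊥
      P′+ yP′ xQ′ with uncross-equal eP′ eQ′ ox′ oy (in₂ eP) yP′ (inj₁ (in₁ eP)) xQ′ (in₂ eQ) (inj₂ (in₁ eQ))
      ... | p , q = clash o⁻⁺ (inj₂ p) (inj₂ q)
      P′- : y ᵒ ∈ₜ P′ → x ∈ₜ Q → ⊥
      P′- yP′ xQ with uncross-equal eP′ eQ ox′ oy′ (in₂ eP) yP′ (inj₁ (in₁ eP)) xQ (in₁ eQ) (inj₂ (in₂ eQ))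
      ... | p , q = clash o⁻⁻ (inj₂ p) (inj₁ q)
      cases : y ∈ₜ P ⊎ y ᵒ ∈ₜ P → y ∈ₜ P′ ⊎ y ᵒ ∈ₜ P′ → x ∈ₜ Q ⊎ x ᵒ ∈ₜ Q → x ∈ₜ Q′ ⊎ x ᵒ ∈ₜ Q′ → ⊥
      cases (inj₁ yP) _ _ (inj₂ xQ′) with uncross-equal eP eQ′ ox oy (in₁ eP) yP (inj₁ (in₂ eP)) xQ′ (in₂ eQ) (inj₂ (in₁ eQ))
      ... | p , q = clash o⁺⁺ (inj₁ p) (inj₂ q)
      cases (inj₁ yP) (inj₁ yP′) _ (inj₁ xQ′) = P′+ yP′ xQ′
      cases (inj₁ yP) (inj₂ yP′) (inj₁ xQ) (inj₁ xQ′) = P′- yP′ xQ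
      cases (inj₁ yP) (inj₂ yP′) (inj₂ xQ) (inj₁ xQ′)
        with uncross-equal eP eP′ ox oy (in₁ eP) yP (inj₁ (in₂ eP)) (in₂ eP) yP′ (inj₁ (in₁ eP))
           | uncross-equal eQ eQ′ ox′ oy xQ (in₁ eQ) (inj₂ (in₂ eQ)) xQ′ (in₂ eQ) (inj₂ (in₁ eQ))
      ... | p , q | p′ , q′ = <-asym (a<b o⁺⁺ (inj₁ p) (inj₂ q)) (b<a o⁻⁺ (inj₁ p′) (inj₂ q′))
      cases (inj₂ yP) _ (inj₂ xQ) _ with uncross-equal eP eQ ox oy′ (in₁ eP) yP (inj₁ (in₂ eP)) xQ (in₁ eQ) (inj₂ (in₂ eQ))
      ... | p , q = clash o⁺⁻ (inj₁ p) (inj₁ q)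
      cases (inj₂ yP) (inj₂ yP′) (inj₁ xQ) _ = P′- yP′ xQ
      cases (inj₂ yP) (inj₁ yP′) (inj₁ xQ) (inj₁ xQ′) = P′+ yP′ xQ′
      cases (inj₂ yP) (inj₁ yP′) (inj₁ xQ) (inj₂ xQ′)
        with uncross-equal eP eP′ ox oy′ (in₁ eP) yP (inj₁ (in₂ eP)) (in₂ eP) yP′ (inj₁ (in₁ eP))
           | uncross-equal eQ eQ′ ox oy xQ (in₁ eQ) (inj₂ (in₂ eQ)) xQ′ (in₂ eQ) (inj₂ (in₁ eQ))
      ... | p , q | p′ , q′ = <-asym (a<b o⁺⁻ (inj₁ p) (inj₂ q)) (b<a o⁺⁺ (inj₁ p′) (inj₂ q′))

  lower-nested : ∀ k {z w} → Lower k z → Lower k w → Nested z w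
  lower-nested (suc k) (inj₁ p) (inj₁ q) = lower-nested k p q
  lower-nested (suc k) (inj₁ p) (inj₂ q) = Layer.compatible q _ p
  lower-nested (suc k) (inj₂ p) (inj₁ q) = Nested-sym (Layer.compatible p _ q)
  lower-nested (suc k) (inj₂ p) (inj₂ q) = byContradiction (layer-no-crossing p q)

  lower-efficient : ∀ k {z} → Lower k z → Σ ℕ λ j → j < k × 𝓔 j z
  lower-efficient (suc k) (inj₁ p) with lower-efficient k p
  ... | j , j<k , e = j , m≤n⇒m≤1+n j<k , e
  lower-efficient (suc k) (inj₂ l) = k , ≤-refl , Layer.P l , Layer.P′ l , Layer.efficient l

  Compatible : ℕ → Sep → Set₁
  Compatible k y = ∀ z → Lower k z → Nested z y

  -- While x crosses a lower separation z, replace it by a corner with z. The crossing with z is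
  -- gone, and none arises because lower separations are nested with z, so the finite list of those
  -- crossing x shrinks.
  compatible-exists : ∀ {P P′ x k} → Efficient P P′ x k → Σ Sep λ y → Efficient P P′ y k × Compatible k y
  compatible-exists {P} {P′} {x} {k} eff with finite-crossing eff k
  ... | l , cov = go (length l) x l ≤-refl eff
      λ z low → cov z (let (j , j<k , e) = lower-efficient k low in j , <⇒≤ j<k , e)
    where
    go : ∀ m x l → length l ≤ m → Efficient P P′ x k → Covers _≈_ (Lower k) (λ z → Cross z x) l →
      Σ Sep λ y → Efficient P P′ y k × Compatible k y
    go m x l len eff cov with em {Σ Sep λ z → Lower k z × Cross z x}
    ... | no none = x , eff , λ z low → byContradiction λ cr → none (z , low , cr)
    ... | yes (z , low , cr) with lower-efficient k low
    ... | j , j<k , R , R′ , ez with uncross-lower ez eff j<k cr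
    ... | c , ec , cor = continue m len
      where
      l′ = keep (λ w → Cross w c) l
      shorter : length l′ < length l
      shorter with find (cov z low cr)
      ... | w , w∈ , eq = keep-length-< l w∈ (λ cr → cr (Nested-respˡ eq (Corner.nested₁ cor)))
      cov′ : Covers _≈_ (Lower k) (λ w → Cross w c) l′
      cov′ w lw cw with find (cov w lw (λ n → cw (Corner.inherit cor (lower-nested k lw low) n)))
      ... | w′ , w∈ , eq = lose (keep⁺ w∈ (λ n → cw (Nested-respˡ (≈-sym eq) n))) eq
      continue : ∀ m → length l ≤ m → Σ Sep λ y → Efficient P P′ y k × Compatible k y
      continue zero len = ⊥-elim (n≮0 (≤-trans shorter len))
      continue (suc m) len = go m c l′ (≤-pred (≤-trans shorter len)) ec cov′

  layer-exists : ∀ {P P′ x k} → Efficient P P′ x k → Σ Sep λ y → Efficient P P′ y k × Layer k (Lower k) y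
  layer-exists {P} {P′} {x} {k} eff with compatible-exists eff
  ... | y₀ , e₀ , c₀ with crossing-finite e₀
  ... | m₀ , cr₀ with least (λ m → Σ Sep λ y → Efficient P P′ y k × Compatible k y × CrossingAtMost k y m) (m₀ , y₀ , e₀ , c₀ , cr₀)
  ... | a , (y , e , c , (l , len , cov)) , min = y , e , record
    { P = P ; P′ = P′ ; efficient = e ; compatible = c
    ; fewest = λ w ew cw m cr → l , ≤-trans len (min m (w , ew , cw , cr)) , cov }

  N : Sep → Set₁
  N x = Σ ℕ λ k → Layer k (Lower k) x

  N-efficient : ∀ {x} → N x → Σ ℕ λ k → 𝓔 k x
  N-efficient (k , l) = k , Layer.P l , Layer.P′ l , Layer.efficient l

  N-nested : ∀ {x y} → N x → N y → Nested x y
  N-nested (k , p) (j , q) = lower-nested (suc (k + j)) (lift-lower (m≤m+n k j) (inj₂ p)) (lift-lower (m≤n+m j k) (inj₂ q))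
    where
    lower-+ : ∀ d k {x} → Lower k x → Lower (d + k) x
    lower-+ zero k p = p
    lower-+ (suc d) k p = inj₁ (lower-+ d k p)
    lift-lower : ∀ {k n x} → k ≤ n → Lower (suc k) x → Lower (suc n) x
    lift-lower {k} {n} {x} k≤n p = subst (λ i → Lower i x) (trans (+-suc (n ∸ k) k) (cong suc (m∸n+n≡m k≤n))) (lower-+ (n ∸ k) (suc k) p)

  crossing-resp : ∀ {k x y m} → x ≈ y → CrossingAtMost k x m → CrossingAtMost k y m
  crossing-resp eq (l , len , cov) = l , len , λ z e cr → cov z e (λ n → cr (Nested-sym (Nested-respˡ eq (Nested-sym n))))

  N-resp : ∀ {x y} → x ≈ y → N x → N y
  N-resp eq (k , l) = k , record
    { P = Layer.P l ; P′ = Layer.P′ l ; efficient = Efficient-resp eq (Layer.efficient l)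
    ; compatible = λ z low → Nested-sym (Nested-respˡ eq (Nested-sym (Layer.compatible l z low)))
    ; fewest = λ w ew cw m cr → crossing-resp eq (Layer.fewest l w ew cw m cr) }

  N-flip : ∀ {x} → N x → N (x ᵒ)
  N-flip (k , l) = k , record
    { P = Layer.P′ l ; P′ = Layer.P l ; efficient = Efficient-flip (Layer.efficient l)
    ; compatible = λ z low → Nested-flipʳ (Layer.compatible l z low)
    ; fewest = λ w ew cw m cr → crossing-flip
        (Layer.fewest l (w ᵒ) (Efficient-flip ew) (λ z low → Nested-flipʳ (cw z low)) m (crossing-flip cr)) }

-- Increasing chains of efficient separations

module Chains (em : ExcludedMiddle (lsuc 0ℓ)) (G : Graph) (conn : Connected G) (lf : LocallyFinite G)
  (thin : NoThickEnds G) where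
  open Classical em
  open Graph G
  open Separation em G
  open Tangles em G
  open Neighbourhood G lf

  -- Let (A , B) be the limit of a strictly increasing chain of efficient separations sᵢ = (Aᵢ , Bᵢ) with v ∈ ⋂ Bᵢ.
  -- If A ∩ B is infinite, then it is well-linked, because each sᵢ is efficient.
  -- If it is finite, then it is not empty, and once Aᵢ contains all neighbours of A ∩ B in A, the set A ∩ B
  -- can be removed from the separator of sᵢ.
  module _ (s : ℕ → Sep) (order-of : ℕ → ℕ) (P P′ : ℕ → Tangle) (eff : ∀ i → Efficient (P i) (P′ i) (s i) (order-of i))
    (up : ∀ i → s i ⊑ s (suc i)) (strict : ∀ i → ¬ (s (suc i) ⊑ s i)) (v : V) (v∈ : ∀ i → proj₂ (s i) v) where

    private
      A B : ℕ → Subset V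
      A i = proj₁ (s i)
      B i = proj₂ (s i)

      A∞ B∞ X∞ : Subset V
      A∞ w = Σ ℕ λ i → A i w
      B∞ w = ∀ i → B i w
      X∞ w = A∞ w × B∞ w

      lim : Sep
      lim = A∞ , B∞

      A-+ : ∀ d i {w} → A i w → A (d + i) w
      A-+ zero i a = a
      A-+ (suc d) i a = small⊆ (up (d + i)) _ (A-+ d i a)

      A-≤ : ∀ {i j w} → i ≤ j → A i w → A j w
      A-≤ {i} {j} {w} i≤j a = subst (λ k → A k w) (m∸n+n≡m i≤j) (A-+ (j ∸ i) i a)

      bounded : ∀ l → (∀ w → w ∈ l → A∞ w) → Σ ℕ λ i → ∀ w → w ∈ l → A i w
      bounded [] _ = 0 , λ _ ()
      bounded (w ∷ l) h with h w (here refl) | bounded l (λ u p → h u (there p))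
      ... | i , a | j , as = i + j , λ { _ (here refl) → A-≤ (m≤m+n i j) a ; u (there p) → A-≤ (m≤n+m j i) (as u p) }

      lim-separ : IsSepar lim
      lim-separ = mkSep cover (λ e ¬a i → sep-edge (separ (eff i)) e (λ a → ¬a (i , a)))
        where
        cover : ∀ w → A∞ w ⊎ B∞ w
        cover w with em₀ {A∞ w}
        ... | yes a = inj₁ a
        ... | no ¬a = inj₂ λ i → [ (λ a → ⊥-elim (¬a (i , a))) , id ]′ (proj₁ (separ (eff i)) w)

      Xs : ∀ i → Σ (List V) λ l → length l ≤ order-of i × Unique l × (∀ w → mid (s i) w ⇔ (w ∈ l))
      Xs i with CardLe⇒HasCard (card (order (eff i)))
      ... | m , (l , refl , u , iff) , m≤ = l , m≤ , u , iff

      -- The separator of the corner lies in (K ∩ L) ∪ (X ∩ L). Vertices of Z are in K, so those in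
      -- L count towards K ∩ L: the set Z is exchanged for the smaller K ∩ L.
      shrunk : ∀ i K L m → CardLe (λ w → K w × L w) m → ∀ Z → Unique Z → (∀ w → w ∈ Z → mid (s i) w × K w) → m < length Z →
        Σ ℕ λ j → Order≤ (s i ᵒ ∨ (K , L)) j × j < order-of i
      shrunk i K L m (l , len , cov) Z uZ Z⊆ m<Z with Xs i
      ... | X , lenX , uX , X⇔ = length (l ++ keep (_∉ Z) X) , order≤ (l ++ keep (_∉ Z) X , ≤-refl , covers) , short
        where
        covers : ∀ w → mid (s i ᵒ ∨ (K , L)) w → w ∈ l ++ keep (_∉ Z) X
        covers w (inj₂ k , a , ℓ) = ∈-++⁺ˡ (cov w (k , ℓ))
        covers w (inj₁ b , a , ℓ) with em₀ {w ∈ Z}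
        ... | yes z = ∈-++⁺ˡ (cov w (proj₂ (Z⊆ w z) , ℓ))
        ... | no z = ∈-++⁺ʳ l (keep⁺ (proj₁ (X⇔ w) (a , b)) z)
        short : length (l ++ keep (_∉ Z) X) < order-of i
        short = begin-strict
          length (l ++ keep (_∉ Z) X)                      ≡⟨ length-++ l ⟩
          length l + length (keep (_∉ Z) X)                <⟨ +-monoˡ-< _ (≤-trans (s≤s len) m<Z) ⟩
          length Z + length (keep (_∉ Z) X)                ≤⟨ +-monoˡ-≤ _ (length-≤-of-⊆ uZ (λ {w} z → keep⁺ (proj₁ (X⇔ w) (proj₁ (Z⊆ w z))) z)) ⟩
          length (keep (_∈ Z) X) + length (keep (_∉ Z) X)  ≡⟨ keep-partition (_∈ Z) X ⟩
          length X                                         ≤⟨ lenX ⟩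
          order-of i                                       ∎
          where open ≤-Reasoning

      -- For large i, the separator of `s i` contains Z and Z′. Then its corners formed with (K , L)
      -- and (L , K) are both too small.
      well-linked : ∀ K L → IsSep G K L → ∀ m → CardLe (λ w → K w × L w) m → ∀ Z Z′ → Unique Z → Unique Z′ →
        (∀ z → z ∈ Z → X∞ z × K z) → (∀ z → z ∈ Z′ → X∞ z × L z) → m < length Z → m < length Z′ → ⊥
      well-linked K L sep m c Z Z′ uZ uZ′ Z⊆ Z′⊆ m<Z m<Z′ with bounded (Z ++ Z′)
        (λ w p → [ (λ q → proj₁ (proj₁ (Z⊆ w q))) , (λ q → proj₁ (proj₁ (Z′⊆ w q))) ]′ (∈-++⁻ Z p))
      ... | i , as with shrunk i K L m c Z uZ (λ w q → (as w (∈-++⁺ˡ q) , proj₂ (proj₁ (Z⊆ w q)) i) , proj₂ (Z⊆ w q)) m<Z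
                      | shrunk i L K m (CardLe-mono (λ { w (a , b) → b , a }) ≤-refl c) Z′ uZ′
                          (λ w q → (as w (∈-++⁺ʳ Z q) , proj₂ (proj₁ (Z′⊆ w q)) i) , proj₂ (Z′⊆ w q)) m<Z′
      ... | j , o , j< | j′ , o′ , j′< = no-small-corners {y = K , L} (eff i) sep o′ j′< o j<

      start : Σ V (A 0)
      start = byContradiction λ none → not-everything (in₂ (eff 0)) λ w →
        [ (λ a → ⊥-elim (none (w , a))) , id ]′ (proj₁ (separ (eff 0)) w)

      X∞-nonempty : Σ V X∞
      X∞-nonempty = byContradiction λ none → none (v ,
        Reach-closed {P = A∞} (λ e a → byContradiction λ ¬a → none (_ , a , sep-edge lim-separ e ¬a))
          (proj₂ conn (proj₁ start) v) (0 , proj₂ start) , v∈)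

      module Finite (finite : FiniteSet X∞) where
        core : List V
        core = keep X∞ (proj₁ finite)

        in-core : ∀ {w} → X∞ w → w ∈ core
        in-core x = keep⁺ (proj₂ finite _ x) x

        near : List V
        near = core ++ keep A∞ (nbrs core)

        stage = bounded near λ w p → [ (λ q → proj₁ (proj₂ (keep⁻ (proj₁ finite) q))) , (λ q → proj₂ (keep⁻ (nbrs core) q)) ]′ (∈-++⁻ core p)

        i : ℕ
        i = proj₁ stage

        X∞⊆A : ∀ {w} → X∞ w → A i w
        X∞⊆A x = proj₂ stage _ (∈-++⁺ˡ (in-core x))

        nbr⊆A : ∀ {u w} → X∞ u → E u w → A∞ w → A i w
        nbr⊆A x e a = proj₂ stage _ (∈-++⁺ʳ core (keep⁺ (nbrs⁺ (in-core x) e) a))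

        n = order-of i
        X = proj₁ (Xs i)
        lenX = proj₁ (proj₂ (Xs i))
        X⇔ = proj₂ (proj₂ (proj₂ (Xs i)))

        X∞⊆X : ∀ {w} → X∞ w → w ∈ X
        X∞⊆X x = proj₁ (X⇔ _) (X∞⊆A x , proj₂ x i)

        -- If the separator of `s i` were X∞, no edge would leave A∞ ∖ A i. Since G is connected and
        -- A i is not empty, A∞ = A i, and the chain would stop at i.
        not-constant : ¬ (∀ w → mid (s i) w → X∞ w)
        not-constant const = strict i (mk⊑ (λ w a → byContradiction λ ¬a → outside (suc i , a) ¬a)
          (λ w b → byContradiction λ ¬b → no-new ¬b b))
          where
          closed : ∀ {w z} → E w z → A∞ w × ¬ A i w → A∞ z × ¬ A i z
          closed {w} {z} e (a , ¬a) = a′ , λ az → ¬a (nbr⊆A (const z (az , sep-edge (separ (eff i)) (E-sym e) ¬a)) (E-sym e) a)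
            where
            a′ : A∞ z
            a′ = byContradiction λ ¬az → ¬a (X∞⊆A (a , sep-edge lim-separ e ¬az))
          outside : ∀ {w} → A∞ w → ¬ A i w → ⊥
          outside {w} a ¬a = proj₂ (Reach-closed closed (proj₂ conn w (proj₁ start)) (a , ¬a)) (A-≤ z≤n (proj₂ start))
          no-new : ∀ {w} → ¬ B (suc i) w → ¬ B i w
          no-new {w} ¬b b with proj₁ (separ (eff (suc i))) w | em₀ {A i w}
          ... | inj₂ b′ | _ = ¬b b′
          ... | inj₁ a | yes a′ = ¬b (proj₂ (const w (a′ , b)) (suc i))
          ... | inj₁ a | no ¬a = outside (suc i , a) ¬a

        lim-order : Σ ℕ λ j → Order≤ lim j × j < n
        lim-order with byContradiction {Σ V λ z → mid (s i) z × ¬ X∞ z}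
          (λ none → not-constant λ w m → byContradiction λ ¬x → none (w , m , ¬x))
        ... | z , m , ¬x = length (keep X∞ X) , order≤ (keep X∞ X , ≤-refl , λ w x → keep⁺ (X∞⊆X x) x) ,
              ≤-trans (keep-length-< X (proj₁ (X⇔ z) m) ¬x) lenX

        s⊑lim : s i ⊑ lim
        s⊑lim = mk⊑ (λ w a → i , a) (λ w b → b i)

        -- `lim` has order below n, and `lim ᵒ` is in `P′ i` because it lies below `s i ᵒ`. If `P i`
        -- contained `lim`, the two tangles would be distinguished too cheaply.
        limᵒ∈ : lim ᵒ ∈ₜ P i
        limᵒ∈ with lim-order
        ... | j , o , j<n with orient {P i} lim-separ o (Orients-mono (<⇒≤ j<n) (orients₁ (eff i)))
        ... | inj₂ p = p
        ... | inj₁ p = ⊥-elim (<⇒≱ j<n (minimal (eff i) lim j p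
              (down (in₂ (eff i)) (IsSep-flip lim-separ) (Order≤-flip o) (Orients-mono (<⇒≤ j<n) (orients₂ (eff i))) (⊑-flip s⊑lim)) o))

        -- The corner `s i ∨ lim ᵒ` with X∞ removed from its large side. It remains a separation
        -- because all neighbours of X∞ in A∞ are in A i.
        y : Sep
        y = (λ w → A i w ⊎ B∞ w) , (λ w → (B i w × A∞ w) × ¬ X∞ w)

        y-separ : IsSepar y
        y-separ = mkSep cover edge
          where
          cover : ∀ w → (A i w ⊎ B∞ w) ⊎ ((B i w × A∞ w) × ¬ X∞ w)
          cover w with proj₁ (separ (eff i)) w | proj₁ lim-separ w | em₀ {B∞ w}
          ... | inj₁ a | _ | _ = inj₁ (inj₁ a)
          ... | inj₂ _ | inj₂ b | _ = inj₁ (inj₂ b)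
          ... | inj₂ _ | inj₁ _ | yes b = inj₁ (inj₂ b)
          ... | inj₂ b | inj₁ a | no ¬b = inj₂ ((b , a) , ¬b ∘ proj₂)
          edge : ∀ {u w} → E u w → ¬ (A i w ⊎ B∞ w) → (B i u × A∞ u) × ¬ X∞ u
          edge {u} {w} e ¬k = (sep-edge (separ (eff i)) e (¬k ∘ inj₁) , sep-edge′ lim-separ e (¬k ∘ inj₂)) ,
            λ x → ¬k (inj₁ (nbr⊆A x e ([ id , (λ b → ⊥-elim (¬k (inj₂ b))) ]′ (proj₁ lim-separ w))))

        y-list : List V
        y-list = keep (λ w → ¬ X∞ w) X

        y-order : Order≤ y (length y-list)
        y-order = order≤ (y-list , ≤-refl , λ
          { w (inj₁ a , (b , _) , ¬x) → keep⁺ (proj₁ (X⇔ w) (a , b)) ¬x ; w (inj₂ b , (_ , a) , ¬x) → ⊥-elim (¬x (a , b)) })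

        y-short : length y-list < n
        y-short = ≤-trans (keep-length-< X (X∞⊆X (proj₂ X∞-nonempty)) (λ ¬x → ¬x (proj₂ X∞-nonempty))) lenX

        -- The small sides of `s i`, `lim ᵒ` and `y ᵒ` cover G: edges at X∞ within A∞ lie in G[A i],
        -- so removing X∞ loses nothing.
        y∈ : y ∈ₜ P i
        y∈ with orient {P i} y-separ y-order (Orients-mono (<⇒≤ y-short) (orients₁ (eff i)))
        ... | inj₁ p = p
        ... | inj₂ p = ⊥-elim (no-cover (in₁ (eff i)) limᵒ∈ p (vs , es))
          where
          vs : ∀ w → A i w ⊎ B∞ w ⊎ ((B i w × A∞ w) × ¬ X∞ w)
          vs w = [ [ inj₁ , (λ b → inj₂ (inj₁ b)) ]′ , (λ c → inj₂ (inj₂ c)) ]′ (proj₁ y-separ w)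
          es : ∀ u w → E u w → (A i u × A i w) ⊎ (B∞ u × B∞ w) ⊎ (((B i u × A∞ u) × ¬ X∞ u) × ((B i w × A∞ w) × ¬ X∞ w))
          es u w e with edge-side (separ (eff i)) e | edge-side lim-separ e | em₀ {X∞ u} | em₀ {X∞ w}
          ... | inj₁ a | _ | _ | _ = inj₁ a
          ... | inj₂ _ | inj₂ b | _ | _ = inj₂ (inj₁ b)
          ... | inj₂ _ | inj₁ (au , aw) | yes x | _ = inj₁ (X∞⊆A x , nbr⊆A x e aw)
          ... | inj₂ _ | inj₁ (au , aw) | no _ | yes x = inj₁ (nbr⊆A x (E-sym e) au , X∞⊆A x)
          ... | inj₂ (bu , bw) | inj₁ (au , aw) | no ¬x | no ¬x′ = inj₂ (inj₂ (((bu , au) , ¬x) , ((bw , aw) , ¬x′)))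

        impossible : ⊥
        impossible = <⇒≱ y-short (minimal (eff i) y _ y∈
          (down (in₂ (eff i)) (IsSep-flip y-separ) (Order≤-flip y-order) (Orients-mono (<⇒≤ y-short) (orients₂ (eff i)))
            (mk⊑ (λ w c → proj₁ (proj₁ c)) (λ w → inj₁))) y-order)

    no-infinite-chain : ⊥
    no-infinite-chain with em₀ {FiniteSet X∞}
    ... | yes finite = Finite.impossible finite
    ... | no infinite = thin (T.ray 0) T.thick-end
      where
      module T = ThickEnd em G conn lf X∞ infinite well-linked

-- From a nested set to a tree

module OrderTree (em : ExcludedMiddle (lsuc 0ℓ)) (I : Set) (_≤ᵢ_ : I → I → Set)
  (≤ᵢ-refl : ∀ {x} → x ≤ᵢ x) (≤ᵢ-trans : ∀ {x y z} → x ≤ᵢ y → y ≤ᵢ z → x ≤ᵢ z)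
  (_* : I → I) (** : ∀ x → ((x *) *) ≡ x) (anti : ∀ {x y} → x ≤ᵢ y → (y *) ≤ᵢ (x *))
  (nested : ∀ x y → x ≤ᵢ y ⊎ y ≤ᵢ x ⊎ x ≤ᵢ (y *) ⊎ (x *) ≤ᵢ y)
  (proper : ∀ {x} → ¬ (x ≤ᵢ (x *)))
  (bounded-chains : ∀ (s : ℕ → I) → (∀ i → s i ≤ᵢ s (suc i) × ¬ (s (suc i) ≤ᵢ s i)) → ∀ t → ¬ (∀ i → s i ≤ᵢ t))
  (enc : I → ℕ) (enc-injective : ∀ {x y} → enc x ≡ enc y → x ≡ y) where
  open Classical em

  infix 4 _<ᵢ_ _≈ᵢ_ _~_
  _<ᵢ_ _≈ᵢ_ : I → I → Set
  x <ᵢ y = x ≤ᵢ y × ¬ (y ≤ᵢ x)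
  x ≈ᵢ y = x ≤ᵢ y × y ≤ᵢ x

  ≤<ᵢ-trans : ∀ {x y z} → x ≤ᵢ y → y <ᵢ z → x <ᵢ z
  ≤<ᵢ-trans p (q , ¬q) = ≤ᵢ-trans p q , λ r → ¬q (≤ᵢ-trans r p)

  <≤ᵢ-trans : ∀ {x y z} → x <ᵢ y → y ≤ᵢ z → x <ᵢ z
  <≤ᵢ-trans (p , ¬p) q = ≤ᵢ-trans p q , λ r → ¬p (≤ᵢ-trans q r)

  anti⁻¹ : ∀ {x y} → (x *) ≤ᵢ (y *) → y ≤ᵢ x
  anti⁻¹ {x} {y} p = subst (λ z → z ≤ᵢ x) (** y) (subst (λ z → ((y *) *) ≤ᵢ z) (** x) (anti p))

  anti-< : ∀ {x y} → x <ᵢ y → y * <ᵢ x *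
  anti-< (p , ¬p) = anti p , ¬p ∘ anti⁻¹

  swap-< : ∀ {x y} → x <ᵢ y * → y <ᵢ x *
  swap-< {x} {y} p = subst (_<ᵢ (x *)) (** y) (anti-< p)

  ≈-anti : ∀ {x y} → x ≈ᵢ y → x * ≈ᵢ y *
  ≈-anti (p , q) = anti q , anti p

  ≤⇒<⊎≈ : ∀ {x y} → x ≤ᵢ y → x <ᵢ y ⊎ x ≈ᵢ y
  ≤⇒<⊎≈ {x} {y} p with em₀ {y ≤ᵢ x}
  ... | yes q = inj₂ (p , q)
  ... | no ¬q = inj₁ (p , ¬q)

  -- A counterexample would start an infinite increasing chain of counterexamples in D. For the
  -- tree, D is being below a fixed element; for the bags, it is having given vertices on the large
  -- side.
  ascending-induction : (D P : I → Set) →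
    (∀ (s : ℕ → I) → (∀ i → s i <ᵢ s (suc i)) → ¬ (∀ i → D (s i))) →
    (∀ x → D x → (∀ z → x <ᵢ z → D z → P z) → P x) → ∀ x → D x → P x
  ascending-induction D P no-chain ind x d = byContradiction λ ¬p →
    no-chain (proj₁ ∘ bad (x , d , ¬p)) (λ i → proj₂ (next (bad (x , d , ¬p) i))) (λ i → proj₁ (proj₂ (bad (x , d , ¬p) i)))
    where
    Bad = Σ I λ x → D x × ¬ P x
    next : (b : Bad) → Σ Bad λ b′ → proj₁ b <ᵢ proj₁ b′
    next (x , d , ¬p) with em₀ {Σ I λ z → x <ᵢ z × D z × ¬ P z}
    ... | yes (z , x<z , dz , ¬pz) = (z , dz , ¬pz) , x<z
    ... | no none = ⊥-elim (¬p (ind x d λ z x<z dz → byContradiction λ ¬pz → none (z , x<z , dz , ¬pz)))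
    bad : Bad → ℕ → Bad
    bad b zero = b
    bad b (suc i) = proj₁ (next (bad b i))

  bounded-induction : (P : I → Set) (t : I) → (∀ x → x ≤ᵢ t → (∀ z → x <ᵢ z → z ≤ᵢ t → P z) → P x) → ∀ x → x ≤ᵢ t → P x
  bounded-induction P t = ascending-induction (_≤ᵢ t) P (λ s up → bounded-chains s up t)

  Cover : I → I → Set
  Cover x y = x <ᵢ y × (∀ z → x <ᵢ z → ¬ (z <ᵢ y))

  cover-swap : ∀ {x y} → Cover x (y *) → Cover y (x *)
  cover-swap {x} {y} (x<y* , none) = swap-< x<y* , λ z y<z z<x* → none (z *)
    (swap-< z<x*) (anti-< y<z)

  cover-below : ∀ {x y} → x <ᵢ y → Σ I λ z → x ≤ᵢ z × Cover z y
  cover-below {x} {y} x<y = bounded-induction (λ z → z <ᵢ y → Σ I λ w → z ≤ᵢ w × Cover w y) y step-up x (proj₁ x<y) x<y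
    where
    step-up : ∀ z → z ≤ᵢ y → (∀ w → z <ᵢ w → w ≤ᵢ y → w <ᵢ y → Σ I λ u → w ≤ᵢ u × Cover u y) →
      z <ᵢ y → Σ I λ u → z ≤ᵢ u × Cover u y
    step-up z _ rec z<y with em₀ {Σ I λ w → z <ᵢ w × w <ᵢ y}
    ... | no none = z , ≤ᵢ-refl , z<y , λ w p q → none (w , p , q)
    ... | yes (w , p , q) with rec w p (proj₁ q) q
    ... | u , w≤u , c = u , ≤ᵢ-trans (proj₁ p) w≤u , c

  -- The involution turns descending chains into ascending ones.
  cover-above : ∀ {x y} → x <ᵢ y → Σ I λ z → Cover x z × z ≤ᵢ y
  cover-above {x} {y} x<y with cover-below (anti-< x<y)
  ... | z , y*≤z , c = (z *) , cover-swap c , subst ((z *) ≤ᵢ_) (** y) (anti y*≤z)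

  -- Oriented separations with a common head in the tree.
  _~_ : I → I → Set
  x ~ y = x ≈ᵢ y ⊎ Cover x (y *)

  ~-refl : ∀ {x} → x ~ x
  ~-refl = inj₁ (≤ᵢ-refl , ≤ᵢ-refl)

  ~-sym : ∀ {x y} → x ~ y → y ~ x
  ~-sym (inj₁ (p , q)) = inj₁ (q , p)
  ~-sym (inj₂ c) = inj₂ (cover-swap c)

  cover-respˡ : ∀ {x x′ y} → x ≈ᵢ x′ → Cover x y → Cover x′ y
  cover-respˡ (p , q) (lt , none) = ≤<ᵢ-trans q lt , λ z lt′ → none z (≤<ᵢ-trans p lt′)

  no-small : ∀ {x} → ¬ (x <ᵢ x *)
  no-small p = proper (proj₁ p)

  -- For covers x < y * and y < z *, nestedness of x and z leaves x ≈ z or x < z *. In the second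
  -- case, an element strictly between x and z * is nested with y, so it lies between x and y * or
  -- between y and z *, or it forces x ≤ y or y * ≤ z *; all of these are excluded.
  ~-trans : ∀ {x y z} → x ~ y → y ~ z → x ~ z
  ~-trans (inj₁ (p , q)) (inj₁ (p′ , q′)) = inj₁ (≤ᵢ-trans p p′ , ≤ᵢ-trans q′ q)
  ~-trans (inj₁ p) (inj₂ c) = inj₂ (cover-respˡ (proj₂ p , proj₁ p) c)
  ~-trans (inj₂ c) (inj₁ p) = inj₂ (cover-swap (cover-respˡ p (cover-swap c)))
  ~-trans {x} {y} {z} (inj₂ c@(x<y* , none)) (inj₂ c′@(y<z* , none′)) with nested x z
  ... | inj₁ x≤z = [ (λ x<z → ⊥-elim (none z x<z (swap-< y<z*))) , inj₁ ]′ (≤⇒<⊎≈ x≤z)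
  ... | inj₂ (inj₁ z≤x) = [ (λ z<x → ⊥-elim (proj₂ (cover-swap c′) x z<x x<y*)) , (λ { (p , q) → inj₁ (q , p) }) ]′ (≤⇒<⊎≈ z≤x)
  ... | inj₂ (inj₂ (inj₂ x*≤z)) = ⊥-elim (no-small (<≤ᵢ-trans (swap-< x<y*) (≤ᵢ-trans x*≤z (proj₁ (swap-< y<z*)))))
  ... | inj₂ (inj₂ (inj₁ x≤z*)) with ≤⇒<⊎≈ x≤z*
  ... | inj₂ (_ , z*≤x) = ⊥-elim (no-small (<≤ᵢ-trans y<z* (≤ᵢ-trans z*≤x (proj₁ x<y*))))
  ... | inj₁ x<z* = inj₂ (x<z* , between)
    where
    x-small : ¬ (x ≤ᵢ y)
    x-small x≤y = no-small (≤<ᵢ-trans x≤y (swap-< x<y*))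
    z-small : ¬ ((y *) ≤ᵢ (z *))
    z-small q = no-small (≤<ᵢ-trans (anti⁻¹ q) y<z*)
    between : ∀ w → x <ᵢ w → ¬ (w <ᵢ z *)
    between w x<w w<z* with nested w y
    ... | inj₁ w≤y = x-small (≤ᵢ-trans (proj₁ x<w) w≤y)
    ... | inj₂ (inj₁ y≤w) = [ (λ y<w → none′ w y<w w<z*) , (λ { (_ , w≤y) → x-small (≤ᵢ-trans (proj₁ x<w) w≤y) }) ]′ (≤⇒<⊎≈ y≤w)
    ... | inj₂ (inj₂ (inj₁ w≤y*)) = [ (λ w<y* → none w x<w w<y*) , (λ { (_ , y*≤w) → z-small (≤ᵢ-trans y*≤w (proj₁ w<z*)) }) ]′ (≤⇒<⊎≈ w≤y*)
    ... | inj₂ (inj₂ (inj₂ w*≤y)) = z-small (≤ᵢ-trans (subst ((y *) ≤ᵢ_) (** w) (anti w*≤y)) (proj₁ w<z*))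

  private
    minimum : ∀ x → Σ ℕ λ n → Lift (lsuc 0ℓ) (Σ I λ z → x ~ z × enc z ≡ n) ×
      (∀ m → Lift (lsuc 0ℓ) (Σ I λ z → x ~ z × enc z ≡ m) → n ≤ m)
    minimum x = least (λ n → Lift (lsuc 0ℓ) (Σ I λ z → x ~ z × enc z ≡ n)) (enc x , lift (x , ~-refl , refl))

  opaque
    -- Taking the member of least code turns classes into elements, so that equality of nodes is
    -- `_≡_`, as `Unique` in the definitions of trees and paths demands.
    repr : I → I
    repr x = proj₁ (lower (proj₁ (proj₂ (minimum x))))

    repr-~ : ∀ x → x ~ repr x
    repr-~ x = proj₁ (proj₂ (lower (proj₁ (proj₂ (minimum x)))))

    repr-cong : ∀ {x y} → x ~ y → repr x ≡ repr y
    repr-cong {x} {y} x~y = enc-injective (≤-antisym (below x~y) (below (~-sym x~y)))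
      where
      below : ∀ {x y} → x ~ y → enc (repr x) ≤ enc (repr y)
      below {x} {y} x~y = ≤-trans (≤-reflexive (proj₂ (proj₂ (lower (proj₁ (proj₂ (minimum x)))))))
        (proj₂ (proj₂ (minimum x)) _ (lift (repr y , ~-trans x~y (repr-~ y) , refl)))

  Node : Set
  Node = Σ I λ x → repr x ≡ x

  Node-≡ : ∀ {s t : Node} → proj₁ s ≡ proj₁ t → s ≡ t
  Node-≡ {x , p} {.x , q} refl with p | q
  ... | p | q = cong (x ,_) (uip p q)
    where
    uip : ∀ {x y : I} (p q : x ≡ y) → p ≡ q
    uip refl refl = refl

  node : I → Node
  node x = repr x , sym (repr-cong (repr-~ x))

  node-cong : ∀ {x y} → x ~ y → node x ≡ node y
  node-cong x~y = Node-≡ (repr-cong x~y)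

  node-injective : ∀ {x y} → node x ≡ node y → x ~ y
  node-injective {x} {y} eq = ~-trans (repr-~ x) (subst (_~ y) (sym (cong proj₁ eq)) (~-sym (repr-~ y)))

  node-proj : ∀ t → node (proj₁ t) ≡ t
  node-proj (x , p) = Node-≡ p

  edge-unique : ∀ {x y} → x ~ y → x * ~ y * → x ≈ᵢ y
  edge-unique (inj₁ p) _ = p
  edge-unique (inj₂ _) (inj₁ (p , q)) = anti⁻¹ q , anti⁻¹ p
  edge-unique {x} {y} (inj₂ (x<y* , _)) (inj₂ (x*<y , _)) =
    ⊥-elim (proj₂ x<y* (proj₁ (subst (_ <ᵢ_) (** x) (anti-< (subst ((x *) <ᵢ_) (** y) x*<y)))))

  TreeEdge : Node → Node → Set
  TreeEdge s t = Σ I λ x → s ≡ node x × t ≡ node (x *)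

  TreeEdge-sym : ∀ {s t} → TreeEdge s t → TreeEdge t s
  TreeEdge-sym (x , p , q) = (x *) , q , trans p (cong node (sym (** x)))

  TreeEdge-irrefl : ∀ {s} → ¬ TreeEdge s s
  TreeEdge-irrefl (x , p , q) with node-injective (trans (sym p) q)
  ... | inj₁ (x≤x* , _) = proper x≤x*
  ... | inj₂ (x<x** , _) = proj₂ x<x** (subst (λ z → z ≤ᵢ x) (sym (** x)) ≤ᵢ-refl)

  tree : Graph
  tree = record { V = Node ; E = TreeEdge ; E-sym = TreeEdge-sym ; E-irr = TreeEdge-irrefl }

  -- Ahead x r: the head of r lies in the component of the head of x in the tree without the edge x.
  Ahead : I → I → Set
  Ahead x r = x ≤ᵢ r ⊎ x <ᵢ r *

  ahead-self : ∀ {x} → Ahead x x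
  ahead-self = inj₁ ≤ᵢ-refl

  not-ahead-op : ∀ {x} → ¬ Ahead x (x *)
  not-ahead-op (inj₁ p) = proper p
  not-ahead-op {x} (inj₂ (_ , ¬p)) = ¬p (subst (λ z → z ≤ᵢ x) (sym (** x)) ≤ᵢ-refl)

  -- The substantial case is a cover r < q * with x < r *. If then q ≤ x, so that r < x * ≤ q *, the
  -- cover forces x ≈ q.
  ahead-resp : ∀ {x r q} → r ~ q → Ahead x r → Ahead x q
  ahead-resp (inj₁ (p , _)) (inj₁ h) = inj₁ (≤ᵢ-trans h p)
  ahead-resp (inj₁ (_ , q)) (inj₂ h) = inj₂ (<≤ᵢ-trans h (anti q))
  ahead-resp (inj₂ (r<q* , _)) (inj₁ h) = inj₂ (≤<ᵢ-trans h r<q*)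
  ahead-resp {x} {r} {q} (inj₂ (r<q* , none)) (inj₂ x<r*) with nested x q
  ... | inj₁ x≤q = inj₁ x≤q
  ... | inj₂ (inj₁ q≤x) = [ (λ x*<q* → ⊥-elim (none (x *) (swap-< x<r*) x*<q*)) , (λ { (_ , q*≤x*) → inj₁ (anti⁻¹ q*≤x*) }) ]′ (≤⇒<⊎≈ (anti q≤x))
  ... | inj₂ (inj₂ (inj₁ x≤q*)) = [ inj₂ , (λ { (_ , q*≤x) → ⊥-elim (no-small (<≤ᵢ-trans r<q* (≤ᵢ-trans q*≤x (proj₁ x<r*)))) }) ]′ (≤⇒<⊎≈ x≤q*)
  ... | inj₂ (inj₂ (inj₂ x*≤q)) = ⊥-elim (no-small (<≤ᵢ-trans (swap-< x<r*) (≤ᵢ-trans x*≤q (proj₁ (swap-< r<q*)))))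

  ahead-edge : ∀ {x r} → Ahead x r → Ahead x (r *) ⊎ x ≈ᵢ r
  ahead-edge {x} {r} (inj₁ x≤r) = [ (λ x<r → inj₁ (inj₂ (subst (x <ᵢ_) (sym (** r)) x<r))) , inj₂ ]′ (≤⇒<⊎≈ x≤r)
  ahead-edge (inj₂ x<r*) = inj₁ (inj₁ (proj₁ x<r*))

  AheadN : I → Node → Set
  AheadN x t = Ahead x (proj₁ t)

  ahead-node : ∀ {x r} → Ahead x r → AheadN x (node r)
  ahead-node h = ahead-resp (repr-~ _) h

  ahead-node⁻ : ∀ {x r} → AheadN x (node r) → Ahead x r
  ahead-node⁻ h = ahead-resp (~-sym (repr-~ _)) h

  -- x is the only edge joining the nodes ahead of x to the others. Acyclicity, the path axiom for
  -- bags and the description of induced sides rest on this.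
  leave : ∀ {x s t} → TreeEdge s t → AheadN x s → AheadN x t ⊎ (s ≡ node x × t ≡ node (x *))
  leave (r , refl , refl) h = [ inj₁ ∘ ahead-node , (λ eq → inj₂ (node-cong (~-sym (inj₁ eq)) , node-cong (~-sym (inj₁ (≈-anti eq))))) ]′
    (ahead-edge (ahead-node⁻ h))

  walk-head : ∀ {s t l} → Walk TreeEdge s t l → s ∈ l
  walk-head (single _) = here refl
  walk-head (cons _ _) = here refl

  walk-last : ∀ {s t l} → Walk TreeEdge s t l → t ∈ l
  walk-last (single _) = here refl
  walk-last (cons _ w) = there (walk-last w)

  walk-leaves : ∀ {x s t l} → Walk TreeEdge s t l → AheadN x s → ¬ AheadN x t → node (x *) ∈ l
  walk-leaves (single _) h ¬h = ⊥-elim (¬h h)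
  walk-leaves (cons e w) h ¬h with leave e h
  ... | inj₁ h′ = there (walk-leaves w h′ ¬h)
  ... | inj₂ (_ , refl) = there (walk-head w)

  walk-enters : ∀ {x s t l} → Walk TreeEdge s t l → ¬ AheadN x s → AheadN x t → node (x *) ∈ l
  walk-enters (single _) ¬h h = ⊥-elim (¬h h)
  walk-enters {x} (cons {y = y} e w) ¬h h with em₀ {AheadN x y}
  ... | no ¬h′ = there (walk-enters w ¬h′ h)
  ... | yes h′ with leave (TreeEdge-sym e) h′
  ... | inj₁ h″ = ⊥-elim (¬h h″)
  ... | inj₂ (_ , eq) = here (sym eq)

  -- A walk that enters the part ahead of x starts the crossing at `node (x *)` and has to return
  -- through the same node.
  stays-behind : ∀ {x s t l} → Walk TreeEdge s t l → Unique l → ¬ AheadN x s → ¬ AheadN x t → ∀ u → u ∈ l → ¬ AheadN x u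
  stays-behind (single _) _ ¬h _ _ (here refl) = ¬h
  stays-behind (cons e w) _ ¬h _ _ (here refl) = ¬h
  stays-behind {x} (cons {y = y} e w) uq@(_ ∷ u) ¬h ¬h′ z (there z∈) with em₀ {AheadN x y}
  ... | no ¬hy = stays-behind w u ¬hy ¬h′ z z∈
  ... | yes hy with leave (TreeEdge-sym e) hy
  ... | inj₁ h = ⊥-elim (¬h h)
  ... | inj₂ (_ , refl) = ⊥-elim (Unique-head uq (walk-leaves w hy ¬h′))

  -- Let the closing edge be x, so the walk leads from `node (x *)` to `node x`. If its first step
  -- is not along x, it must return to its start to get ahead of x; if it is, the walk is already at
  -- its end and too short.
  acyclic : ∀ s t l → Walk TreeEdge s t l → Unique l → 3 ≤ length l → ¬ TreeEdge t s
  acyclic s .s .(s ∷ []) (single .s) _ (s≤s ()) _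
  acyclic s t l@(.s ∷ l′) (cons {y = y} e w) uq@(_ ∷ u) len (x , refl , refl) with em₀ {AheadN x y}
  ... | no ¬h = Unique-head uq (walk-enters w ¬h (ahead-node ahead-self))
  ... | yes h with leave (TreeEdge-sym e) h
  ... | inj₁ h′ = not-ahead-op (ahead-node⁻ h′)
  ... | inj₂ (refl , _) = closed w u len
    where
    closed : ∀ {t l} → Walk TreeEdge t t l → Unique l → ¬ (3 ≤ suc (length l))
    closed (single _) _ (s≤s (s≤s ()))
    closed (cons _ w) u _ = Unique-head u (walk-last w)

  Without : Node → Node → Node → Node → Set
  Without t₁ t₂ s t = TreeEdge s t × ¬ (s ≡ t₁ × t ≡ t₂) × ¬ (s ≡ t₂ × t ≡ t₁)

  -- A cover z < w gives z ~ w *, so the edge w leads from `node z` to `node w`. All edges climbed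
  -- are strictly above x, hence different from x in either direction.
  ascend : ∀ {x y} → x ≤ᵢ y → Reach (Without (node x) (node (x *))) (node x) (node y)
  ascend {x} {y} x≤y = bounded-induction (λ z → x ≤ᵢ z → Reach (Without (node x) (node (x *))) (node z) (node y)) y up x x≤y ≤ᵢ-refl
    where
    up : ∀ z → z ≤ᵢ y → (∀ w → z <ᵢ w → w ≤ᵢ y → x ≤ᵢ w → Reach (Without (node x) (node (x *))) (node w) (node y)) →
      x ≤ᵢ z → Reach (Without (node x) (node (x *))) (node z) (node y)
    up z z≤y rec x≤z with ≤⇒<⊎≈ z≤y
    ... | inj₂ eq = subst (Reach _ (node z)) (node-cong (inj₁ eq)) here
    ... | inj₁ z<y with cover-above z<y
    ... | w , c , w≤y = step (((w *) , node-cong z~w* , cong node (sym (** w))) , not-x , not-x*) (rec w (proj₁ c) w≤y (≤ᵢ-trans x≤z (proj₁ (proj₁ c))))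
      where
      z~w* : z ~ w *
      z~w* = inj₂ (subst (Cover z) (sym (** w)) c)
      x<w : x <ᵢ w
      x<w = ≤<ᵢ-trans x≤z (proj₁ c)
      not-x : ¬ (node z ≡ node x × node w ≡ node (x *))
      not-x (p , q) = no-small (<≤ᵢ-trans x<w (subst (_≤ᵢ (x *)) (** w) (anti (proj₂
        (edge-unique (~-trans (~-sym z~w*) (node-injective p)) (subst (_~ (x *)) (sym (** w)) (node-injective q)))))))
      not-x* : ¬ (node z ≡ node (x *) × node w ≡ node x)
      not-x* (p , q) = proj₂ x<w (proj₁ (edge-unique (node-injective q) (~-trans (~-sym z~w*) (node-injective p))))

  ascend-reach : ∀ {x y} → x ≤ᵢ y → Reach TreeEdge (node x) (node y)
  ascend-reach x≤y = forget (ascend x≤y)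
    where
    forget : ∀ {a b s t} → Reach (Without a b) s t → Reach TreeEdge s t
    forget here = here
    forget (step (e , _) p) = step e (forget p)

  connected-nodes : ∀ x y → Reach TreeEdge (node x) (node y)
  connected-nodes x y with nested x y
  ... | inj₁ p = ascend-reach p
  ... | inj₂ (inj₁ p) = Reach-sym TreeEdge-sym (ascend-reach p)
  ... | inj₂ (inj₂ (inj₁ p)) = Reach-trans (ascend-reach p) (step (TreeEdge-sym (y , refl , refl)) here)
  ... | inj₂ (inj₂ (inj₂ p)) = step (x , refl , refl) (ascend-reach p)

  tree-isTree : I → IsTree tree
  tree-isTree x = node x , (λ s t → subst (λ a → Reach TreeEdge a t) (node-proj s)
    (subst (Reach TreeEdge _) (node-proj t) (connected-nodes (proj₁ s) (proj₁ t)))) , acyclic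

  -- The laws hold only up to `≈ᵢ`, since the image of a coded separation under an automorphism of G
  -- is coded anew.
  record OrderAutomorphism : Set where
    field
      f g    : I → I
      f-mono : ∀ {x y} → x ≤ᵢ y → f x ≤ᵢ f y
      g-mono : ∀ {x y} → x ≤ᵢ y → g x ≤ᵢ g y
      fg     : ∀ x → f (g x) ≈ᵢ x
      gf     : ∀ x → g (f x) ≈ᵢ x
      f-*    : ∀ x → f (x *) ≈ᵢ f x *
      g-*    : ∀ x → g (x *) ≈ᵢ g x *

  invert : OrderAutomorphism → OrderAutomorphism
  invert o = record { f = g ; g = f ; f-mono = g-mono ; g-mono = f-mono ; fg = gf ; gf = fg ; f-* = g-* ; g-* = f-* }
    where open OrderAutomorphism o

  module _ (o : OrderAutomorphism) where
    open OrderAutomorphism o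

    ~-map : ∀ {x y} → x ~ y → f x ~ f y
    ~-map (inj₁ (p , q)) = inj₁ (f-mono p , f-mono q)
    ~-map {x} {y} (inj₂ ((x≤y* , ¬p) , none)) = inj₂
      ( (≤ᵢ-trans (f-mono x≤y*) (proj₁ (f-* y)) , λ q → ¬p (reflect (≤ᵢ-trans (proj₁ (f-* y)) q)))
      , λ z (p , ¬p′) (q , ¬q′) → none (g z)
          (≤ᵢ-trans (proj₂ (gf x)) (g-mono p) , λ r → ¬p′ (≤ᵢ-trans (proj₂ (fg z)) (f-mono r)))
          (≤ᵢ-trans (g-mono (≤ᵢ-trans q (proj₂ (f-* y)))) (proj₁ (gf (y *))) ,
            λ r → ¬q′ (≤ᵢ-trans (proj₂ (f-* y)) (≤ᵢ-trans (f-mono r) (proj₁ (fg z))))))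
      where
      reflect : ∀ {x y} → f x ≤ᵢ f y → x ≤ᵢ y
      reflect {x} {y} p = ≤ᵢ-trans (proj₂ (gf x)) (≤ᵢ-trans (g-mono p) (proj₁ (gf y)))

    node-map : Node → Node
    node-map t = node (f (proj₁ t))

    node-map-node : ∀ x → node-map (node x) ≡ node (f x)
    node-map-node x = node-cong (~-map (~-sym (repr-~ x)))

    edge-map : ∀ {s t} → TreeEdge s t → TreeEdge (node-map s) (node-map t)
    edge-map (x , refl , refl) = f x , node-map-node x , trans (node-map-node (x *)) (node-cong (inj₁ (f-* x)))

  node-map-inverse : ∀ o t → node-map o (node-map (invert o) t) ≡ t
  node-map-inverse o t = trans (node-map-node o (g (proj₁ t))) (trans (node-cong (inj₁ (fg (proj₁ t)))) (node-proj t))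
    where open OrderAutomorphism o

  tree-automorphism : OrderAutomorphism → Automorphism tree
  tree-automorphism o = record
    { to = node-map o ; from = node-map (invert o)
    ; to-from = node-map-inverse o ; from-to = node-map-inverse (invert o)
    ; adj = λ s t → edge-map o , λ e →
        subst₂ TreeEdge (node-map-inverse (invert o) s) (node-map-inverse (invert o) t) (edge-map (invert o) e) }

-- Invariance under automorphisms

inverse : ∀ {G} → Automorphism G → Automorphism G
inverse {G} φ = record
  { to = from ; from = to ; to-from = from-to ; from-to = to-from
  ; adj = λ u v →
      (λ e → proj₂ (adj (from u) (from v)) (subst₂ E (sym (to-from u)) (sym (to-from v)) e)) ,
      (λ e → subst₂ E (to-from u) (to-from v) (proj₁ (adj (from u) (from v)) e)) }
  where
  open Automorphism φ
  open Graph G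

module Symmetry (em : ExcludedMiddle (lsuc 0ℓ)) (G : Graph) (conn : Connected G) (lf : LocallyFinite G) where
  open Classical em
  open Graph G
  open Separation em G
  open Tangles em G
  open FiniteCrossing em G conn lf
  open NestedSet em G conn lf
  open Automorphism

  pull : Automorphism G → Sep → Sep
  pull φ x = (λ v → proj₁ x (to φ v)) , (λ v → proj₂ x (to φ v))

  pull-⊑ : ∀ φ {x y} → x ⊑ y → pull φ x ⊑ pull φ y
  pull-⊑ φ (mk⊑ a b) = mk⊑ (λ v → a (to φ v)) (λ v → b (to φ v))

  pull-inverse : ∀ φ x → pull φ (pull (inverse φ) x) ≈ x
  pull-inverse φ x =
    mk⊑ (λ v → subst (proj₁ x) (from-to φ v)) (λ v → subst (proj₂ x) (sym (from-to φ v))) ,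
    mk⊑ (λ v → subst (proj₁ x) (sym (from-to φ v))) (λ v → subst (proj₂ x) (from-to φ v))

  pull-separ : ∀ φ {x} → IsSepar x → IsSepar (pull φ x)
  pull-separ φ s = mkSep (λ v → proj₁ s (to φ v)) (λ e → sep-edge s (proj₁ (adj φ _ _) e))

  pull-order : ∀ φ {x n} → Order≤ x n → Order≤ (pull φ x) n
  pull-order φ (order≤ (l , len , c)) = order≤ (map (from φ) l , ≤-trans (≤-reflexive (length-map (from φ) l)) len ,
    λ v m → subst (_∈ map (from φ) l) (from-to φ v) (∈-map⁺ (from φ) (c (to φ v) m)))

  pull-nested : ∀ φ {x y} → Nested x y → Nested (pull φ x) (pull φ y)
  pull-nested φ (le p) = le (pull-⊑ φ p)
  pull-nested φ (ge p) = ge (pull-⊑ φ p)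
  pull-nested φ (le-op p) = le-op (pull-⊑ φ p)
  pull-nested φ (op-le p) = op-le (pull-⊑ φ p)

  pull-nestedˡ : ∀ φ {x y} → Nested (pull (inverse φ) x) y → Nested x (pull φ y)
  pull-nestedˡ φ {x} n = Nested-respˡ (pull-inverse φ x) (pull-nested φ n)

  -- The image φ(P), described through preimages. Membership in P lives in `Set₁`, and `⌈_⌉` brings
  -- it down to the level required of `OSepSet`.
  translate : Automorphism G → Tangle → Tangle
  translate φ P = φP , (bound , all , total , (λ A B p q → ⊥-elim (not-both {P} {pull φ (A , B)} (unraw p) (unraw q))) , consistent) , uncovered
    where
    bound = proj₁ (proj₁ (proj₂ P))
    φP : OSepSet G
    φP A B = ⌈ pull φ (A , B) ∈ₜ P ⌉
    unraw : ∀ {x} → _∈ᴾ_ G x φP → pull φ x ∈ₜ P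
    unraw (C , D , m , (f , g) , (h , i)) = ∈-resp (pull-⊑ φ (mk⊑ f i) , pull-⊑ φ (mk⊑ g h)) (⌈⌉-elim m)
    below-order : ∀ k {A B n} → HasCard (λ v → A v × B v) n → Below n k → OrderLt G k A B
    below-order (fin m) {n = n} c lt = n , c , lt
    below-order ℵ₀ {n = n} c _ = n , c
    order-below : ∀ k {A B} → OrderLt G k A B → Σ ℕ λ n → Order≤ (A , B) n × Below n k
    order-below (fin m) (n , c , lt) = n , order≤ (HasCard⇒CardLe c) , lt
    order-below ℵ₀ (n , c) = n , order≤ (HasCard⇒CardLe c) , tt
    all : ∀ A B → φP A B → IsSep G A B × OrderLt G bound A B
    all A B p = separ-AB , order-AB
      where
      p∈ : pull φ (A , B) ∈ₜ P
      p∈ = ⌈⌉-elim p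
      separ-AB : IsSep G A B
      separ-AB = IsSepar-resp (pull-inverse (inverse φ) (A , B)) (pull-separ (inverse φ) (∈-separ p∈))
      order-AB : OrderLt G bound A B
      order-AB with ∈-order p∈
      ... | n , c , o with CardLe⇒HasCard (card (Order≤-resp (pull-inverse (inverse φ) (A , B))
              (pull-order (inverse φ) {pull φ (A , B)} (order≤ (HasCard⇒CardLe c)))))
      ... | m , hc , m≤n = below-order bound hc (Orients.below (Orients-mono {P} m≤n o))
    total : ∀ A B → IsSep G A B → OrderLt G bound A B → _∈ᴾ_ G (A , B) φP ⊎ _∈ᴾ_ G (B , A) φP
    total A B s o with order-below bound o
    ... | n , c , lt with orient {P} {pull φ (A , B)} (pull-separ φ {A , B} s) (pull-order φ c) (orients lt)
    ... | inj₁ p = inj₁ (A , B , ⌈⌉-intro p , ((λ _ a → a) , (λ _ a → a)) , ((λ _ b → b) , (λ _ b → b)))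
    ... | inj₂ p = inj₂ (B , A , ⌈⌉-intro p , ((λ _ a → a) , (λ _ a → a)) , ((λ _ b → b) , (λ _ b → b)))
    consistent : Consistent G φP
    consistent A B C D p q _ (B⊆C , D⊆A) with ∈-order (⌈⌉-elim {pull φ (A , B) ∈ₜ P} p)
    ... | n , c , o = not-both {P} {pull φ (A , B)} (⌈⌉-elim p)
      (down (⌈⌉-elim {pull φ (C , D) ∈ₜ P} q) (IsSep-flip (∈-separ (⌈⌉-elim {pull φ (A , B) ∈ₜ P} p)))
        (Order≤-flip {pull φ (A , B)} (order≤ (HasCard⇒CardLe c))) o (pull-⊑ φ {B , A} {C , D} (mk⊑ B⊆C D⊆A)))
    uncovered : ∀ A₁ B₁ A₂ B₂ A₃ B₃ → φP A₁ B₁ → φP A₂ B₂ → φP A₃ B₃ → ¬ Cover3 G A₁ A₂ A₃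
    uncovered A₁ B₁ A₂ B₂ A₃ B₃ p q r (vs , es) = no-cover {P} {pull φ (A₁ , B₁)} {pull φ (A₂ , B₂)} {pull φ (A₃ , B₃)}
      (⌈⌉-elim p) (⌈⌉-elim q) (⌈⌉-elim r)
      ((λ v → vs (to φ v)) , (λ u v e → es (to φ u) (to φ v) (proj₁ (adj φ u v) e)))

  ∈-translate⁺ : ∀ φ {P x} → pull φ x ∈ₜ P → x ∈ₜ translate φ P
  ∈-translate⁺ φ {x = A , B} p = member (A , B , ⌈⌉-intro p , ((λ _ a → a) , (λ _ a → a)) , ((λ _ b → b) , (λ _ b → b)))

  ∈-translate⁻ : ∀ φ {P x} → x ∈ₜ translate φ P → pull φ x ∈ₜ P
  ∈-translate⁻ φ (member (C , D , m , (f , g) , (h , i))) = ∈-resp (pull-⊑ φ (mk⊑ f i) , pull-⊑ φ (mk⊑ g h)) (⌈⌉-elim m)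

  translate-efficient : ∀ φ {P P′ x n} → Efficient P P′ x n → Efficient (translate φ P) (translate φ P′) (pull (inverse φ) x) n
  translate-efficient φ {x = x} e = record
    { in₁ = ∈-translate⁺ φ (∈-resp (≈-sym (pull-inverse φ x)) (in₁ e))
    ; in₂ = ∈-translate⁺ φ (∈-resp (≈-flip (≈-sym (pull-inverse φ x))) (in₂ e))
    ; order = pull-order (inverse φ) (order e)
    ; minimal = λ y m p q o → minimal e (pull φ y) m (∈-translate⁻ φ p) (∈-translate⁻ φ q) (pull-order φ o) }

  untranslate-efficient : ∀ φ {P P′ y n} → Efficient (translate φ P) (translate φ P′) y n → Efficient P P′ (pull φ y) n
  untranslate-efficient φ {y = y} e = record
    { in₁ = ∈-translate⁻ φ (in₁ e)
    ; in₂ = ∈-translate⁻ φ (in₂ e)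
    ; order = pull-order φ (order e)
    ; minimal = λ z m p q o → minimal e (pull (inverse φ) z) m
        (∈-translate⁺ φ (∈-resp (≈-sym (pull-inverse φ z)) p))
        (∈-translate⁺ φ (∈-resp (≈-flip (≈-sym (pull-inverse φ z))) q)) (pull-order (inverse φ) o) }

  𝓔-pull : ∀ φ {k x} → 𝓔 k x → 𝓔 k (pull φ x)
  𝓔-pull φ (P , P′ , e) = translate (inverse φ) P , translate (inverse φ) P′ , translate-efficient (inverse φ) e

  crossing-pull : ∀ φ {k x m} → CrossingAtMost k x m → CrossingAtMost k (pull φ x) m
  crossing-pull φ {k} {x} (l , len , cov) = map (pull φ) l , ≤-trans (≤-reflexive (length-map (pull φ) l)) len , covers
    where
    covers : Covers _≈_ (𝓔 k) (λ z → Cross z (pull φ x)) (map (pull φ) l)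
    covers z ez cr with find (cov (pull (inverse φ) z) (𝓔-pull (inverse φ) ez) (cr ∘ pull-nestedˡ φ))
    ... | w , w∈ , (p , q) = lose (∈-map⁺ (pull φ) w∈)
      (⊑-trans (proj₂ (pull-inverse φ z)) (pull-⊑ φ p) , ⊑-trans (pull-⊑ φ q) (proj₁ (pull-inverse φ z)))

  layer-pull : ∀ k → (∀ φ {x} → Lower k x → Lower k (pull φ x)) → ∀ φ {x} → Layer k (Lower k) x → Layer k (Lower k) (pull φ x)
  layer-pull k invariant φ {x} l = record
    { P = translate (inverse φ) P
    ; P′ = translate (inverse φ) P′
    ; efficient = translate-efficient (inverse φ) efficient
    ; compatible = λ z low → pull-nestedˡ φ (compatible _ (invariant (inverse φ) low))
    ; fewest = λ y ey cy m cr → crossing-pull φ (fewest (pull (inverse φ) y) (untranslate-efficient (inverse φ) ey)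
        (λ z low → pull-nestedˡ (inverse φ) (cy _ (invariant φ low))) m (crossing-pull (inverse φ) cr)) }
    where open Layer l

  lower-pull : ∀ k φ {x} → Lower k x → Lower k (pull φ x)
  lower-pull (suc k) φ (inj₁ p) = inj₁ (lower-pull k φ p)
  lower-pull (suc k) φ (inj₂ l) = inj₂ (layer-pull k (lower-pull k) φ l)

  N-pull : ∀ φ {x} → N x → N (pull φ x)
  N-pull φ (k , l) = k , layer-pull k (lower-pull k) φ l

-- Enumeration of vertices and codes

pair : ℕ → ℕ → ℕ
-- The value is 2^a (2b + 1).
pair zero b = suc (b + b)
pair (suc a) b = pair a b + pair a b

double-injective : ∀ {m n} → m + m ≡ n + n → m ≡ n
double-injective {zero} {zero} _ = refl
double-injective {suc m} {suc n} eq = cong suc (double-injective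
  (suc-injective (trans (sym (+-suc m m)) (trans (suc-injective eq) (+-suc n n)))))

odd≢even : ∀ m n → suc (m + m) ≢ n + n
odd≢even (suc m) (suc n) eq = odd≢even m n (suc-injective
  (trans (cong suc (sym (+-suc m m))) (trans (suc-injective eq) (+-suc n n))))
odd≢even zero (suc n) eq = 0≢1+n (trans (suc-injective eq) (+-suc n n))

pair-injective : ∀ {a b a′ b′} → pair a b ≡ pair a′ b′ → a ≡ a′ × b ≡ b′
pair-injective {zero} {b} {zero} eq = refl , double-injective (suc-injective eq)
pair-injective {zero} {b} {suc a′} {b′} eq = ⊥-elim (odd≢even b (pair a′ b′) eq)
pair-injective {suc a} {b} {zero} {b′} eq = ⊥-elim (odd≢even b′ (pair a b) (sym eq))
pair-injective {suc a} {b} {suc a′} eq with pair-injective {a} {b} {a′} (double-injective eq)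
... | p , q = cong suc p , q

pair≢0 : ∀ a b → pair a b ≢ 0
pair≢0 (suc a) b eq = pair≢0 a b (m+n≡0⇒m≡0 (pair a b) eq)

encodeList : List ℕ → ℕ
encodeList [] = 0
encodeList (a ∷ l) = pair a (encodeList l)

encodeList-injective : ∀ {l l′} → encodeList l ≡ encodeList l′ → l ≡ l′
encodeList-injective {[]} {[]} _ = refl
encodeList-injective {[]} {a ∷ l} eq = ⊥-elim (pair≢0 a _ (sym eq))
encodeList-injective {a ∷ l} {[]} eq = ⊥-elim (pair≢0 a _ eq)
encodeList-injective {a ∷ l} {a′ ∷ l′} eq with pair-injective {a} {_} {a′} eq
... | p , q = cong₂ _∷_ p (encodeList-injective q)

position-of : {X : Set} {x : X} {l : List X} → x ∈ l → ℕ
position-of (here _) = 0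
position-of (there p) = suc (position-of p)

position-injective : {X : Set} {x y : X} {l : List X} (p : x ∈ l) (q : y ∈ l) → position-of p ≡ position-of q → x ≡ y
position-injective (here refl) (here refl) _ = refl
position-injective (there p) (there q) eq = position-injective p q (suc-injective eq)

module Encoding (G : Graph) (conn : Connected G) (lf : LocallyFinite G) where
  open Graph G

  -- The steps of a walk from the root, recorded as positions in the finite neighbour lists,
  -- determine its end. So G is countable.
  address : ∀ {u v} → Reach E u v → List ℕ
  address here = []
  address (step {x} e p) = position-of (proj₂ (lf x) _ e) ∷ address p

  address-injective : ∀ {u v w} (p : Reach E u v) (q : Reach E u w) → address p ≡ address q → v ≡ w
  address-injective here here _ = refl
  address-injective (step {x} e p) (step e′ q) eq with ∷-injective eq
  ... | h , t with position-injective (proj₂ (lf x) _ e) (proj₂ (lf x) _ e′) h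
  ... | refl = address-injective p q t

  encodeVertex : V → ℕ
  encodeVertex v = encodeList (address (proj₂ conn (proj₁ conn) v))

  encodeVertex-injective : ∀ {u v} → encodeVertex u ≡ encodeVertex v → u ≡ v
  encodeVertex-injective {u} {v} eq =
    address-injective (proj₂ conn (proj₁ conn) u) (proj₂ conn (proj₁ conn) v) (encodeList-injective eq)

  encodeVertices : List V → ℕ
  encodeVertices l = encodeList (map encodeVertex l)

  encodeVertices-injective : ∀ {l l′} → encodeVertices l ≡ encodeVertices l′ → l ≡ l′
  encodeVertices-injective eq = map-injective encodeVertex-injective (encodeList-injective eq)

  Code : Set
  Code = Bool × List V × List V

  encodeBool : Bool → ℕ
  encodeBool false = 0
  encodeBool true = 1

  encodeBool-injective : ∀ {b b′} → encodeBool b ≡ encodeBool b′ → b ≡ b′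
  encodeBool-injective {false} {false} _ = refl
  encodeBool-injective {true} {true} _ = refl

  encode : Code → ℕ
  encode (b , Y , R) = pair (encodeBool b) (pair (encodeVertices Y) (encodeVertices R))

  encode-injective : ∀ {c c′} → encode c ≡ encode c′ → c ≡ c′
  encode-injective {b , Y , R} {b′ , Y′ , R′} eq with pair-injective {encodeBool b} eq
  ... | p , q with pair-injective {encodeVertices Y} q
  ... | q₁ , q₂ = cong₂ _,_ (encodeBool-injective p) (cong₂ _,_ (encodeVertices-injective q₁) (encodeVertices-injective q₂))

-- The canonical tree-decomposition

module Main (em : ExcludedMiddle (lsuc 0ℓ)) (G : Graph) (conn : Connected G) (lf : LocallyFinite G) (thin : NoThickEnds G) where
  open Classical em
  open Graph G
  open Tangles em G
  open FiniteCrossing em G conn lf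
  open NestedSet em G conn lf
  open Symmetry em G conn lf
  open Encoding G conn lf

  -- The Boolean makes flipping a strict involution on codes, as `**` requires.
  ⟪_⟫ : Code → Sep
  ⟪ true , Y , R ⟫ = decode Y R
  ⟪ false , Y , R ⟫ = decode Y R ᵒ

  flipCode : Code → Code
  flipCode (b , Y , R) = not b , Y , R

  ⟪flip⟫ : ∀ c → ⟪ flipCode c ⟫ ≡ ⟪ c ⟫ ᵒ
  ⟪flip⟫ (true , _) = refl
  ⟪flip⟫ (false , _) = refl

  -- `N` is a predicate in `Set₁`; its truncation makes this type small and its elements determined
  -- by their codes.
  NCode : Set
  NCode = Σ Code λ c → ⌈ N ⟪ c ⟫ ⌉

  NCode-≡ : ∀ {i j : NCode} → proj₁ i ≡ proj₁ j → i ≡ j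
  NCode-≡ {c , p} {.c , q} refl = cong (c ,_) (⌈⌉-irrelevant p q)

  opaque
    I : Set
    I = NCode

    ⟦_⟧ : I → Sep
    ⟦ c , _ ⟧ = ⟪ c ⟫

    ⟦⟧∈N : ∀ i → N ⟦ i ⟧
    ⟦⟧∈N (c , n) = ⌈⌉-elim n

    _* : I → I
    (c , n) * = flipCode c , ⌈⌉-intro (subst N (sym (⟪flip⟫ c)) (N-flip (⌈⌉-elim n)))

    ** : ∀ i → (i *) * ≡ i
    ** ((true , _) , _) = NCode-≡ refl
    ** ((false , _) , _) = NCode-≡ refl

    ⟦*⟧ : ∀ i → ⟦ i * ⟧ ≡ ⟦ i ⟧ ᵒ
    ⟦*⟧ (c , _) = ⟪flip⟫ c

    index : ∀ {x} → N x → Σ I λ i → ⟦ i ⟧ ≈ x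
    index {x} n with N-efficient n
    ... | k , P , P′ , e with CardLe⇒HasCard (card (order e))
    ... | m , (Y , _ , _ , Y⇔) , _ = ((true , Y , codeOf x Y) , ⌈⌉-intro (N-resp eq n)) , ≈-sym eq
      where
      eq : x ≈ decode Y (codeOf x Y)
      eq = decode-codeOf {x} (separ e) Y⇔

    rank : I → ℕ
    rank i = encode (proj₁ i)

    rank-injective : ∀ {i j} → rank i ≡ rank j → i ≡ j
    rank-injective eq = NCode-≡ (encode-injective eq)

  small-nonempty : ∀ {x} → N x → ¬ (∀ v → proj₂ x v)
  small-nonempty n = let (k , P , P′ , e) = N-efficient n in not-everything (in₂ e)

  N-separ : ∀ {x} → N x → IsSepar x
  N-separ n = let (k , P , P′ , e) = N-efficient n in separ e

  large-vertex : ∀ {x} → N x → Σ V (proj₂ x)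
  large-vertex {x} n = byContradiction λ none → small-nonempty (N-flip n) λ v →
    [ id , (λ b → ⊥-elim (none (v , b))) ]′ (proj₁ (N-separ n) v)

  infix 4 _≤ᵢ_
  _≤ᵢ_ : I → I → Set
  i ≤ᵢ j = ⟦ i ⟧ ⊑ ⟦ j ⟧

  B : I → Subset V
  B i = proj₂ ⟦ i ⟧

  opaque
    vertex-chains : ∀ v (s : ℕ → I) → (∀ i → s i ≤ᵢ s (suc i) × ¬ (s (suc i) ≤ᵢ s i)) → ¬ (∀ i → B (s i) v)
    vertex-chains v s up v∈ = Chains.no-infinite-chain em G conn lf thin (λ i → ⟦ s i ⟧)
      (λ i → proj₁ (N-efficient (⟦⟧∈N (s i)))) (λ i → proj₁ (proj₂ (N-efficient (⟦⟧∈N (s i)))))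
      (λ i → proj₁ (proj₂ (proj₂ (N-efficient (⟦⟧∈N (s i)))))) (λ i → proj₂ (proj₂ (proj₂ (N-efficient (⟦⟧∈N (s i))))))
      (λ i → proj₁ (up i)) (λ i → proj₂ (up i)) v v∈

    bounded-chains : ∀ (s : ℕ → I) → (∀ i → s i ≤ᵢ s (suc i) × ¬ (s (suc i) ≤ᵢ s i)) → ∀ t → ¬ (∀ i → s i ≤ᵢ t)
    bounded-chains s up t below with large-vertex (⟦⟧∈N t)
    ... | v , b = vertex-chains v s up (λ i → large⊇ (below i) v b)

    anti : ∀ {i j} → i ≤ᵢ j → (j *) ≤ᵢ (i *)
    anti {i} {j} p = subst₂ _⊑_ (sym (⟦*⟧ j)) (sym (⟦*⟧ i)) (⊑-flip p)

    proper : ∀ {i} → ¬ (i ≤ᵢ (i *))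
    proper {i} p = small-nonempty (⟦⟧∈N i) λ v →
      [ small⊆ (subst (⟦ i ⟧ ⊑_) (⟦*⟧ i) p) v , id ]′ (proj₁ (N-separ (⟦⟧∈N i)) v)

    nested : ∀ i j → i ≤ᵢ j ⊎ j ≤ᵢ i ⊎ i ≤ᵢ (j *) ⊎ (i *) ≤ᵢ j
    nested i j with N-nested (⟦⟧∈N i) (⟦⟧∈N j)
    ... | le p = inj₁ p
    ... | ge p = inj₂ (inj₁ p)
    ... | le-op p = inj₂ (inj₂ (inj₁ (subst (⟦ i ⟧ ⊑_) (sym (⟦*⟧ j)) p)))
    ... | op-le p = inj₂ (inj₂ (inj₂ (subst (_⊑ ⟦ j ⟧) (sym (⟦*⟧ i)) p)))

  open OrderTree em I _≤ᵢ_ ⊑-refl ⊑-trans _* ** anti nested proper bounded-chains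
    rank rank-injective public

  -- The r with `r ~ proj₁ t` are the oriented edges of the tree pointing to t, so this is the part
  -- of G cut out by the star at t.
  bag : Node → Subset V
  bag t v = ∀ r → r ~ proj₁ t → B r v

  bag-node : ∀ {x v} → (∀ r → r ~ x → B r v) → bag (node x) v
  bag-node h r r~ = h r (~-trans r~ (~-sym (repr-~ _)))

  bag-node⁻ : ∀ {x r v} → bag (node x) v → r ~ x → B r v
  bag-node⁻ b r~ = b _ (~-trans r~ (repr-~ _))

  -- If x < r *, some z with x ≤ z is covered by r *. It has the same head as r, so the bag lies in
  -- `B z` and thus in `B x`.
  ahead-bag : ∀ {x t v} → AheadN x t → bag t v → B x v
  ahead-bag (inj₁ x≤r) b = large⊇ x≤r _ (b _ ~-refl)
  ahead-bag (inj₂ x<r*) b with cover-below x<r*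
  ... | z , x≤z , c = large⊇ x≤z _ (b z (inj₂ c))

  -- The case u ≡ w serves the vertex axiom of tree-decompositions and the case of an edge the
  -- second one, by a single argument.
  together : ∀ {u w} → u ≡ w ⊎ E u w → ∀ x → (B (x *) u × B (x *) w) ⊎ (B x u × B x w)
  together {u} {w} uw x = subst (λ y → (proj₂ y u × proj₂ y w) ⊎ (B x u × B x w)) (sym (⟦*⟧ x)) (go uw)
    where
    go : u ≡ w ⊎ E u w → (proj₁ ⟦ x ⟧ u × proj₁ ⟦ x ⟧ w) ⊎ (B x u × B x w)
    go (inj₁ refl) = [ (λ a → inj₁ (a , a)) , (λ b → inj₂ (b , b)) ]′ (proj₁ (N-separ (⟦⟧∈N x)) u)
    go (inj₂ e) = edge-side (N-separ (⟦⟧∈N x)) e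

  -- A maximal separation with u and w on its large side has both in the bag at its head.
  bag-ahead : ∀ {u w} → u ≡ w ⊎ E u w → ∀ x → B x u × B x w → Σ I λ r → x ≤ᵢ r × bag (node r) u × bag (node r) w
  bag-ahead {u} {w} uw = ascending-induction (λ x → B x u × B x w) (λ x → Σ I λ r → x ≤ᵢ r × bag (node r) u × bag (node r) w)
    (λ s up d → vertex-chains u s up (λ i → proj₁ (d i))) maximal
    where
    maximal : ∀ x → B x u × B x w → (∀ z → x <ᵢ z → B z u × B z w → Σ I λ r → z ≤ᵢ r × bag (node r) u × bag (node r) w) →
      Σ I λ r → x ≤ᵢ r × bag (node r) u × bag (node r) w
    maximal x d rec with em₀ {Σ I λ z → x <ᵢ z × B z u × B z w}
    ... | yes (z , x<z , dz) with rec z x<z dz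
    ... | r , z≤r , b = r , ⊑-trans (proj₁ x<z) z≤r , b
    maximal x d rec | no none = x , ⊑-refl , bag-node (λ r r~ → proj₁ (in-bag r r~)) , bag-node (λ r r~ → proj₂ (in-bag r r~))
      where
      in-bag : ∀ q → q ~ x → B q u × B q w
      in-bag q (inj₁ (q≤x , _)) = large⊇ q≤x _ (proj₁ d) , large⊇ q≤x _ (proj₂ d)
      in-bag q (inj₂ (q<x* , _)) with together uw q
      ... | inj₂ b = b
      ... | inj₁ a = ⊥-elim (none ((q *) , swap-< q<x* , a))

  common-bag : I → ∀ {u w} → u ≡ w ⊎ E u w → Σ Node λ t → bag t u × bag t w
  common-bag x {u} {w} uw = [ bag-at (x *) , bag-at x ]′ (together uw x)
    where
    bag-at : ∀ y → B y u × B y w → Σ Node λ t → bag t u × bag t w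
    bag-at y d = let (r , _ , b) = bag-ahead uw y d in node r , b

  isTreeDecomposition : I → IsTreeDecomposition G tree bag
  isTreeDecomposition x =
    (λ v → let (t , b , _) = common-bag x (inj₁ refl) in t , b) ,
    (λ u v e → common-bag x (inj₂ e)) ,
    -- If v is not in `B r`, neither end of the path is ahead of r, so the whole path stays behind
    -- r; but t₂ is the head of r.
    λ t₁ t₃ l w uq t₂ t₂∈ v b₁ b₃ r r~ → byContradiction λ ¬b →
      stays-behind {r} w uq (λ h → ¬b (ahead-bag {r} {t₁} h b₁)) (λ h → ¬b (ahead-bag {r} {t₃} h b₃)) t₂ t₂∈ (ahead-resp r~ ahead-self)

  -- Only nodes ahead of x are reached from `node x` without the edge x, and their bags lie in `B x`
  -- by `ahead-bag`. Conversely, `bag-ahead` and `ascend` lead from x to a bag containing a given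
  -- vertex of `B x`.
  side-B : ∀ x → InducedSide G tree bag (node x) (node (x *)) ≐ B x
  side-B x = (λ { v (t , reach , b) → ahead-bag {x} {t} (Reach-closed stay reach (ahead-node ahead-self)) b }) ,
    λ v b → let (r , x≤r , bv , _) = bag-ahead (inj₁ refl) x (b , b) in node r , ascend x≤r , bv
    where
    stay : ∀ {s t} → TMinus G tree bag (node x) (node (x *)) s t → AheadN x s → AheadN x t
    stay (e , not-x , _) h = [ id , (λ eq → ⊥-elim (not-x eq)) ]′ (leave e h)

  induced : ∀ x → (InducedSide G tree bag (node (x *)) (node x) , InducedSide G tree bag (node x) (node (x *))) ≈ ⟦ x ⟧
  induced x = mk⊑ (proj₁ A≐) (proj₂ (side-B x)) , mk⊑ (proj₂ A≐) (proj₁ (side-B x))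
    where
    A≐ : InducedSide G tree bag (node (x *)) (node x) ≐ proj₁ ⟦ x ⟧
    A≐ = subst₂ (λ y z → InducedSide G tree bag (node (x *)) (node y) ≐ z) (** x) (cong proj₂ (⟦*⟧ x)) (side-B (x *))

  distinguishes-efficiently : ∀ P₁ P₂ → Distinguishable G (proj₁ P₁) (proj₁ P₂) →
    Σ I λ i → Σ ℕ λ k → Efficient P₁ P₂ ⟦ i ⟧ k
  distinguishes-efficiently P₁ P₂ (A , B , _ , _ , d) = from-member (start d)
    where
    start : ((_∈ᴾ_ G (A , B) (proj₁ P₁)) × (_∈ᴾ_ G (B , A) (proj₁ P₂))) ⊎ ((_∈ᴾ_ G (B , A) (proj₁ P₁)) × (_∈ᴾ_ G (A , B) (proj₁ P₂))) →
      Σ Sep λ x → x ∈ₜ P₁ × x ᵒ ∈ₜ P₂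
    start (inj₁ (p , q)) = (A , B) , member p , member q
    start (inj₂ (p , q)) = (B , A) , member p , member q
    Candidate : ℕ → Set₁
    Candidate n = Σ Sep λ x → x ∈ₜ P₁ × x ᵒ ∈ₜ P₂ × Order≤ x n
    from-layer : ∀ {k} → (Σ Sep λ y → Efficient P₁ P₂ y k × Layer k (Lower k) y) → Σ I λ i → Σ ℕ λ k → Efficient P₁ P₂ ⟦ i ⟧ k
    from-layer {k} (y , e , l) = let (i , eq) = index (k , l) in i , k , Efficient-resp (≈-sym eq) e
    from-least : (Σ ℕ λ k → Candidate k × (∀ m → Candidate m → k ≤ m)) → Σ I λ i → Σ ℕ λ k → Efficient P₁ P₂ ⟦ i ⟧ k
    from-least (k , (x , p , q , o) , min) = from-layer (layer-exists {P₁} {P₂} {x} {k} (record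
      { in₁ = p ; in₂ = q ; order = o ; minimal = λ z m p q o → min m (z , p , q , o) }))
    from-member : (Σ Sep λ x → x ∈ₜ P₁ × x ᵒ ∈ₜ P₂) → Σ I λ i → Σ ℕ λ k → Efficient P₁ P₂ ⟦ i ⟧ k
    from-member (x , p , q) = let (n , c , _) = ∈-order p in
      from-least (least Candidate (n , x , p , q , order≤ (HasCard⇒CardLe c)))

  efficient : EfficientlyDistinguishesAllTangles G tree bag
  efficient P₁ P₂ t₁ t₂ d = edge (distinguishes-efficiently (P₁ , t₁) (P₂ , t₂) d)
    where
    edge : (Σ I λ i → Σ ℕ λ k → Efficient (P₁ , t₁) (P₂ , t₂) ⟦ i ⟧ k) → Σ Node λ s → Σ Node λ t → TreeEdge s t ×
      EfficientlyDistinguishes G P₁ P₂ (InducedSide G tree bag s t) (InducedSide G tree bag t s)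
    -- The edge is taken in this direction because `node (i *)` belongs to the small side of i.
    edge (i , k , e) = node (i *) , node i , TreeEdge-sym (i , refl , refl) ,
      (separ e′ , (λ eq → not-everything (in₁ e′) λ v → [ id , proj₂ eq v ]′ (proj₁ (separ e′) v)) , inj₁ (raw (in₁ e′) , raw (in₂ e′))) ,
      λ C D (_ , _ , d) m n hm hn → ≤-trans (HasCard-≤ hm (λ v p → p) (card (order e′))) (below C D d n hn)
      where
      e′ : Efficient (P₁ , t₁) (P₂ , t₂) (InducedSide G tree bag (node (i *)) (node i) , InducedSide G tree bag (node i) (node (i *))) k
      e′ = Efficient-resp (≈-sym (induced i)) e
      below : ∀ C D → ((_∈ᴾ_ G (C , D) P₁) × (_∈ᴾ_ G (D , C) P₂)) ⊎ ((_∈ᴾ_ G (D , C) P₁) × (_∈ᴾ_ G (C , D) P₂)) →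
        ∀ n → Order G C D n → k ≤ n
      below C D (inj₁ (p , q)) n hn = minimal e (C , D) n (member p) (member q) (order≤ (HasCard⇒CardLe hn))
      below C D (inj₂ (p , q)) n hn = minimal e (D , C) n (member p) (member q) (Order≤-flip {C , D} (order≤ (HasCard⇒CardLe hn)))

  act : Automorphism G → I → I
  act φ i = proj₁ (index (N-pull (inverse φ) (⟦⟧∈N i)))

  ⟦act⟧ : ∀ φ i → ⟦ act φ i ⟧ ≈ pull (inverse φ) ⟦ i ⟧
  ⟦act⟧ φ i = proj₂ (index (N-pull (inverse φ) (⟦⟧∈N i)))

  act-mono : ∀ φ {i j} → i ≤ᵢ j → act φ i ≤ᵢ act φ j
  act-mono φ {i} {j} p = ⊑-trans (proj₁ (⟦act⟧ φ i)) (⊑-trans (pull-⊑ (inverse φ) p) (proj₂ (⟦act⟧ φ j)))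

  act-inverse : ∀ φ i → act φ (act (inverse φ) i) ≈ᵢ i
  act-inverse φ i =
    ⊑-trans (proj₁ (⟦act⟧ φ _)) (⊑-trans (pull-⊑ (inverse φ) (proj₁ (⟦act⟧ (inverse φ) i))) (proj₁ (pull-inverse (inverse φ) ⟦ i ⟧))) ,
    ⊑-trans (proj₂ (pull-inverse (inverse φ) ⟦ i ⟧)) (⊑-trans (pull-⊑ (inverse φ) (proj₂ (⟦act⟧ (inverse φ) i))) (proj₂ (⟦act⟧ φ _)))

  inverse-act : ∀ φ i → act (inverse φ) (act φ i) ≈ᵢ i
  inverse-act φ i =
    ⊑-trans (proj₁ (⟦act⟧ (inverse φ) _)) (⊑-trans (pull-⊑ φ (proj₁ (⟦act⟧ φ i))) (proj₁ (pull-inverse φ ⟦ i ⟧))) ,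
    ⊑-trans (proj₂ (pull-inverse φ ⟦ i ⟧)) (⊑-trans (pull-⊑ φ (proj₂ (⟦act⟧ φ i))) (proj₂ (⟦act⟧ (inverse φ) _)))

  act-* : ∀ φ i → act φ (i *) ≈ᵢ act φ i *
  act-* φ i = ⊑-trans (proj₁ (⟦act⟧ φ (i *))) (proj₁ mid-eq) , ⊑-trans (proj₂ mid-eq) (proj₂ (⟦act⟧ φ (i *)))
    where
    mid-eq : pull (inverse φ) ⟦ i * ⟧ ≈ ⟦ act φ i * ⟧
    mid-eq = subst₂ (λ a b → pull (inverse φ) a ≈ b) (sym (⟦*⟧ i)) (sym (⟦*⟧ (act φ i))) (≈-flip (≈-sym (⟦act⟧ φ i)))

  order-automorphism : Automorphism G → OrderAutomorphism
  order-automorphism φ = record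
    { f = act φ ; g = act (inverse φ) ; f-mono = act-mono φ ; g-mono = act-mono (inverse φ)
    ; fg = act-inverse φ ; gf = inverse-act φ ; f-* = act-* φ ; g-* = act-* (inverse φ) }

  canonical : Canonical G tree bag
  canonical φ = tree-automorphism o , λ t w →
    (λ b → from w , (λ r r~ → large⊇ (proj₂ (⟦act⟧ φ r)) w (bag-node⁻ b (~-map o r~))) , to-from w) ,
    λ { (v , b , refl) → bag-node λ r r~ → large⊇ (proj₂ (⟦act⟧ (inverse φ) r)) v
          (b _ (~-trans (~-map (invert o) r~) (inj₁ (inverse-act φ (proj₁ t))))) }
    where
    open Automorphism φ
    o = order-automorphism φ

theorem1 : ExcludedMiddle (lsuc 0ℓ) →
    (G : Graph) → Connected G → LocallyFinite G → NoThickEnds G →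
    Σ Graph λ T → Σ (Graph.V T → Subset (Graph.V G)) λ bag →
    IsTree T × IsTreeDecomposition G T bag × Canonical G T bag ×
    EfficientlyDistinguishesAllTangles G T bag
theorem1 em G conn lf thin with em {Lift (lsuc 0ℓ) (Main.I em G conn lf thin)}
... | yes (lift i) = tree , bag , tree-isTree i , isTreeDecomposition i , canonical , efficient
  where
  open Main em G conn lf thin
-- Without chosen separations `Node` is empty, so a tree with one node replaces it. No two tangles
-- are distinguishable then, as they would yield an element of `I`.
... | no none = point , (λ _ _ → ⊤) ,
  (tt , (λ _ _ → here) , λ _ _ _ _ _ _ ()) ,
  ((λ _ → tt , tt) , (λ _ _ _ → tt , tt , tt) , λ _ _ _ _ _ _ _ _ _ _ → tt) ,
  (λ φ → record { to = id ; from = id ; to-from = λ _ → refl ; from-to = λ _ → refl ; adj = λ _ _ → id , id } ,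
    λ _ w → (λ _ → Automorphism.from φ w , tt , Automorphism.to-from φ w) , λ _ → tt) ,
  λ P₁ P₂ t₁ t₂ d → ⊥-elim (none (lift (proj₁ (distinguishes-efficiently (P₁ , t₁) (P₂ , t₂) d))))
  where
  open Main em G conn lf thin using (distinguishes-efficiently)
  point : Graph
  point = record { V = ⊤ ; E = λ _ _ → ⊥ ; E-sym = λ () ; E-irr = λ () }
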